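{- Let $q$ be a prime power and $n\geq 12$ an integer. For an even integer $x$ let $$\begin{aligned}M(x)={}&q^{4(x-5)}+(q^{2x-10}+q^{2x-14})\big(q^{2x-14}+\tfrac{x-8}{2}q^{x-9}\big)+(q^{2x-11}+q^{2x-13})\big(\tfrac{x-8}{2}q^{x-10}+q^{2x-15}\big)\\&+(q^{2x-12}+q^{2x-13})\big(2q^{2x-16}+\tfrac{x-10}{2}q^{x-11}\big)\\&+(q^{2x-12}+q^{2x-14})\Big[\sum_{i=3}^{\min\{\lceil q/2\rceil+2,\lfloor (x-5)/2\rfloor\}}\big(iq^{2x-2i-12}+(\tfrac{x-6}{2}-i)q^{x-2i-7}\big)\\&\qquad+\sum_{i=2}^{\min\{\lfloor q/2\rfloor+2,\lceil (x-7)/2\rceil\}}\big(iq^{2x-2i-13}+(\tfrac{x-6}{2}-i)q^{x-2i-8}\big)\Big],\end{aligned}$$ and for an odd integer $x$ let $$\begin{aligned}M(x)={}&q^{4(x-5)}+(q^{2x-10}+q^{2x-14})\big(q^{2x-14}+\tfrac{x-9}{2}q^{x-8}+q^{\frac{x-9}{2}}\big)+(q^{2x-11}+q^{2x-13})\big(\tfrac{x-9}{2}q^{x-9}+q^{2x-15}+q^{x-8}\big)\\&+(q^{2x-12}+q^{2x-13})\big(q^{2x-16}+\tfrac{x-11}{2}q^{x-10}+q^{\frac{x-11}{2}}\big)\\&+(q^{2x-12}+q^{2x-14})\Big[\sum_{i=3}^{\min\{\lceil q/2\rceil+2,\lfloor (x-5)/2\rfloor\}}\big(iq^{2x-2i-12}+(\tfrac{x-7}{2}-i)q^{x-2i-6}+q^{\frac{x-7}{2}-i}\big)\\&\qquad+\sum_{i=2}^{\min\{\lfloor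 q/2\rfloor+2,\lceil (x-7)/2\rceil\}}\big(iq^{2x-2i-13}+(\tfrac{x-7}{2}-i)q^{x-2i-7}+q^{x-i-7}\big)\Big].\end{aligned}$$ Let $M_1=\sum_{j=0}^{\lfloor (n-12)/5\rfloor} M(n-5j)$. Then $$\bar A_q(n,4,5)\geq M_1+q^4+q^3+q^2+q+1.$$
   Context: $\mathcal G_q(n,k)$ is the set of $k$-dimensional subspaces of $\mathbb F_q^n$, with subspace distance $d_S(\mathcal U,\mathcal V)=\dim\mathcal U+\dim\mathcal V-2\dim(\mathcal U\cap\mathcal V)$; an $(n,d,k)_q$-CDC is a subset of $\mathcal G_q(n,k)$ with pairwise subspace distance at least $d$. An MRD$[k\times(n-k),\delta]_q$ code is an $\mathbb F_q$-linear subspace of $\mathbb F_q^{k\times(n-k)}$ of dimension $\max\{k,n-k\}(\min\{k,n-k\}-\delta+1)$ whose nonzero elements have rank at least $\delta$; a lifted MRD code is $\{\mathrm{rowspace}(\boldsymbol I_k\mid\boldsymbol A):\boldsymbol A\in\mathcal D\}$ for such $\mathcal D$. $\bar A_q(n,2\delta,k)$ is the maximum size of an $(n,2\delta,k)_q$-CDC containing a lifted MRD code as a subset (here $k=5$, $\delta=2$). -}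

module Defs where

open import Level using (Level; _⊔_) renaming (suc to lsuc)
open import Algebra.Bundles using (CommutativeRing)
open import Relation.Nullary using (¬_)
open import Relation.Nullary.Decidable using (⌊_⌋)
open import Relation.Binary.Bundles using (Setoid)
import Relation.Binary.PropositionalEquality as ≡
open import Relation.Binary.PropositionalEquality using (_≡_; _≢_)
open import Function.Bundles using (Inverse)
open import Function using (_∘_)
open import Data.Bool using (if_then_else_)
open import Data.Product using (Σ; ∃; _×_; _,_)
open import Data.Sum using ([_,_]′)
open import Data.Fin using (Fin; zero; suc; splitAt; _≟_)
open import Data.List using (List; length; lookup)
open import Data.List.Relation.Unary.All using (All)
import Data.Nat as ℕ
open ℕ using (ℕ; zero; suc; _⊓_)
open import Data.Nat.Properties using (m^n≢0)
import Data.Integer as ℤ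
open ℤ using (ℤ; +_; -[1+_])
import Data.Rational as ℚ
open ℚ using (ℚ; 0ℚ)

record Field (c ℓ : Level) : Set (lsuc (c ⊔ ℓ)) where
  field
    commutativeRing : CommutativeRing c ℓ
  open CommutativeRing commutativeRing public
  field
    0≉1     : ¬ (0# ≈ 1#)
    inverse : ∀ x → ¬ (x ≈ 0#) → ∃ λ y → (x * y) ≈ 1#

HasSize : ∀ {c ℓ} → Field c ℓ → ℕ → Set (c ⊔ ℓ)
HasSize F q = Inverse (Field.setoid F) (≡.setoid (Fin q))

module LinAlg {c ℓ} (F : Field c ℓ) where
  open Field F using (Carrier; _≈_; _+_; _*_; 0#; 1#)

  -- vectors indexed by a finite index set I (F^n is Vect (Fin n),
  -- k×m matrices are Vect (Fin k × Fin m))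
  Vect : Set → Set c
  Vect I = I → Carrier

  VPred : Set → (p : Level) → Set (c ⊔ lsuc p)
  VPred I p = Vect I → Set p

  _≈v_ : ∀ {I} → Vect I → Vect I → Set ℓ
  u ≈v v = ∀ i → u i ≈ v i

  0v : ∀ {I} → Vect I
  0v i = 0#

  _+v_ : ∀ {I} → Vect I → Vect I → Vect I
  (u +v v) i = u i + v i

  _·v_ : ∀ {I} → Carrier → Vect I → Vect I
  (a ·v v) i = a * v i

  sumF : ∀ {k} → (Fin k → Carrier) → Carrier
  sumF {zero}  f = 0#
  sumF {suc k} f = f zero + sumF (f ∘ suc)

  lincomb : ∀ {I k} → (Fin k → Carrier) → (Fin k → Vect I) → Vect I
  lincomb {k = k} cs b i = sumF (λ j → cs j * b j i)

  record IsSubspace {I p} (U : VPred I p) : Set (c ⊔ ℓ ⊔ p) where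
    field
      resp  : ∀ {u v} → u ≈v v → U u → U v
      zero∈ : U 0v
      +∈    : ∀ {u v} → U u → U v → U (u +v v)
      ·∈    : ∀ a {v} → U v → U (a ·v v)

  LinIndep : ∀ {I k} → (Fin k → Vect I) → Set (c ⊔ ℓ)
  LinIndep b = ∀ cs → lincomb cs b ≈v 0v → ∀ j → cs j ≈ 0#

  HasDim : ∀ {I p} → VPred I p → ℕ → Set (c ⊔ ℓ ⊔ p)
  HasDim U k = Σ (Fin k → Vect _) λ b →
    (∀ j → U (b j)) × LinIndep b × (∀ v → U v → ∃ λ cs → v ≈v lincomb cs b)

  span : ∀ {I k} → (Fin k → Vect I) → VPred I (c ⊔ ℓ)
  span g v = ∃ λ cs → v ≈v lincomb cs g

  _∩_ : ∀ {I p r} → VPred I p → VPred I r → VPred I (p ⊔ r)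
  (U ∩ V) v = U v × V v

  SameSpace : ∀ {I p r} → VPred I p → VPred I r → Set (c ⊔ p ⊔ r)
  SameSpace U V = ∀ v → (U v → V v) × (V v → U v)

  DistAtLeast : ∀ {I p} → ℕ → VPred I p → VPred I p → Set (c ⊔ ℓ ⊔ p)
  DistAtLeast d U V = ∀ a b e → HasDim U a → HasDim V b → HasDim (U ∩ V) e →
    d ℕ.≤ (a ℕ.+ b) ℕ.∸ (2 ℕ.* e)

  Mat : ℕ → ℕ → Set c
  Mat k m = Vect (Fin k × Fin m)

  rows : ∀ {k m} → Mat k m → Fin k → Vect (Fin m)
  rows A i j = A (i , j)

  RankAtLeast : ∀ {k m} → ℕ → Mat k m → Set (c ⊔ ℓ)
  RankAtLeast δ A = ∀ r → HasDim (span (rows A)) r → δ ℕ.≤ r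

  record IsMRD (k m δ : ℕ) {p} (D : VPred (Fin k × Fin m) p) : Set (c ⊔ ℓ ⊔ p) where
    field
      subspace : IsSubspace D
      dim      : HasDim D ((k ℕ.⊔ m) ℕ.* ((k ⊓ m) ℕ.∸ δ ℕ.+ 1))
      rank     : ∀ A → D A → ¬ (A ≈v 0v) → RankAtLeast δ A

  liftedRows : ∀ {k m} → Mat k m → Fin k → Vect (Fin (k ℕ.+ m))
  liftedRows {k} A i j =
    [ (λ j′ → if ⌊ i ≟ j′ ⌋ then 1# else 0#) , (λ j′ → A (i , j′)) ]′ (splitAt k j)

  -- Ā_q(k+m, d, k) ≥ N (with MRD[k × m, δ]): there is an (k+m, d, k)_q-CDC
  -- of size ≥ N containing a lifted MRD[k × m, δ]_q code. Codewords are
  -- given by generator families g (the codeword is span g); a codeword is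
  -- k-dimensional; distinct positions in the list are at distance ≥ d.
  AbarAtLeast : (k m d δ : ℕ) → ℚ → Set (lsuc (c ⊔ ℓ))
  AbarAtLeast k m d δ N =
    Σ (List (Fin k → Vect (Fin (k ℕ.+ m)))) λ C →
      All (λ g → HasDim (span g) k) C ×
      (∀ (i j : Fin (length C)) → i ≢ j →
         DistAtLeast d (span (lookup C i)) (span (lookup C j))) ×
      (Σ (VPred (Fin k × Fin m) (c ⊔ ℓ)) λ D →
         IsMRD k m δ D ×
         (∀ A → D A → ∃ λ i → SameSpace (span (lookup C i)) (span (liftedRows A)))) ×
      (N ℚ.≤ ((+ length C) ℚ./ 1))

-- q^e for an integer exponent e (q ≥ 1; value at q = 0, e < 0 irrelevant)
powZ : ℕ → ℤ → ℚ
powZ q (+ e) = (+ (q ℕ.^ e)) ℚ./ 1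
powZ zero -[1+ e ] = 0ℚ
powZ (suc q) -[1+ e ] = ℚ._/_ (+ 1) (suc q ℕ.^ suc e) {{m^n≢0 (suc q) (suc e)}}

half : ℤ → ℚ
half z = z ℚ./ 2

toQ : ℤ → ℚ
toQ z = z ℚ./ 1

-- Σ_{i=a}^{b} f i  (empty if b < a)
sumRange : ℕ → ℕ → (ℕ → ℚ) → ℚ
sumRange a b f = go (suc b ℕ.∸ a) a
  where
  go : ℕ → ℕ → ℚ
  go zero    i = 0ℚ
  go (suc t) i = f i ℚ.+ go t (suc i)

module _ (q x : ℕ) where
  private
    X : ℤ
    X = + x
    P : ℤ → ℚ
    P = powZ q
    _-ℤ_ : ℤ → ℤ → ℤ
    _-ℤ_ = ℤ._-_
    infixl 6 _-ℤ_
    _⊕_ : ℚ → ℚ → ℚ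
    _⊕_ = ℚ._+_
    infixl 6 _⊕_
    _⊗_ : ℚ → ℚ → ℚ
    _⊗_ = ℚ._*_
    infixl 7 _⊗_
    _⊝_ : ℚ → ℚ → ℚ
    _⊝_ = ℚ._-_
    infixl 6 _⊝_
    2X : ℤ
    2X = + 2 ℤ.* X
    2I : ℕ → ℤ
    2I i = + (2 ℕ.* i)
    I : ℕ → ℚ
    I i = toQ (+ i)
    top1 : ℕ
    top1 = (((q ℕ.+ 1) ℕ./ 2) ℕ.+ 2) ⊓ ((x ℕ.∸ 5) ℕ./ 2)   -- min{⌈q/2⌉+2, ⌊(x-5)/2⌋}
    top2 : ℕ
    top2 = ((q ℕ./ 2) ℕ.+ 2) ⊓ ((x ℕ.∸ 6) ℕ./ 2)           -- min{⌊q/2⌋+2, ⌈(x-7)/2⌉}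

  Meven : ℚ
  Meven =
      P (+ 4 ℤ.* (X -ℤ + 5))
    ⊕ (P (2X -ℤ + 10) ⊕ P (2X -ℤ + 14)) ⊗ (P (2X -ℤ + 14) ⊕ half (X -ℤ + 8) ⊗ P (X -ℤ + 9))
    ⊕ (P (2X -ℤ + 11) ⊕ P (2X -ℤ + 13)) ⊗ (half (X -ℤ + 8) ⊗ P (X -ℤ + 10) ⊕ P (2X -ℤ + 15))
    ⊕ (P (2X -ℤ + 12) ⊕ P (2X -ℤ + 13)) ⊗ (toQ (+ 2) ⊗ P (2X -ℤ + 16) ⊕ half (X -ℤ + 10) ⊗ P (X -ℤ + 11))
    ⊕ (P (2X -ℤ + 12) ⊕ P (2X -ℤ + 14)) ⊗
        ( sumRange 3 top1 (λ i →
            I i ⊗ P (2X -ℤ 2I i -ℤ + 12) ⊕ (half (X -ℤ + 6) ⊝ I i) ⊗ P (X -ℤ 2I i -ℤ + 7))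
        ⊕ sumRange 2 top2 (λ i →
            I i ⊗ P (2X -ℤ 2I i -ℤ + 13) ⊕ (half (X -ℤ + 6) ⊝ I i) ⊗ P (X -ℤ 2I i -ℤ + 8)))

  -- (for odd x ≥ 11 the exponents (x-9)/2, (x-11)/2, (x-7)/2 are exact)
  Modd : ℚ
  Modd =
      P (+ 4 ℤ.* (X -ℤ + 5))
    ⊕ (P (2X -ℤ + 10) ⊕ P (2X -ℤ + 14)) ⊗
        (P (2X -ℤ + 14) ⊕ half (X -ℤ + 9) ⊗ P (X -ℤ + 8) ⊕ P (+ ((x ℕ.∸ 9) ℕ./ 2)))
    ⊕ (P (2X -ℤ + 11) ⊕ P (2X -ℤ + 13)) ⊗
        (half (X -ℤ + 9) ⊗ P (X -ℤ + 9) ⊕ P (2X -ℤ + 15) ⊕ P (X -ℤ + 8))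
    ⊕ (P (2X -ℤ + 12) ⊕ P (2X -ℤ + 13)) ⊗
        (P (2X -ℤ + 16) ⊕ half (X -ℤ + 11) ⊗ P (X -ℤ + 10) ⊕ P (+ ((x ℕ.∸ 11) ℕ./ 2)))
    ⊕ (P (2X -ℤ + 12) ⊕ P (2X -ℤ + 14)) ⊗
        ( sumRange 3 top1 (λ i →
            I i ⊗ P (2X -ℤ 2I i -ℤ + 12) ⊕ (half (X -ℤ + 7) ⊝ I i) ⊗ P (X -ℤ 2I i -ℤ + 6)
              ⊕ P (+ ((x ℕ.∸ 7) ℕ./ 2) -ℤ + i))
        ⊕ sumRange 2 top2 (λ i →
            I i ⊗ P (2X -ℤ 2I i -ℤ + 13) ⊕ (half (X -ℤ + 7) ⊝ I i) ⊗ P (X -ℤ 2I i -ℤ + 7)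
              ⊕ P (X -ℤ + i -ℤ + 7)))

M : ℕ → ℕ → ℚ
M q x with x ℕ.% 2
... | zero  = Meven q x
... | suc _ = Modd q x

M₁ : ℕ → ℕ → ℚ
M₁ q n = sumRange 0 ((n ℕ.∸ 12) ℕ./ 5) (λ j → M q (n ℕ.∸ 5 ℕ.* j))

bound : ℕ → ℕ → ℚ
bound q n = M₁ q n ℚ.+ toQ (+ (q ℕ.^ 4 ℕ.+ q ℕ.^ 3 ℕ.+ q ℕ.^ 2 ℕ.+ q ℕ.+ 1))

-- Each codeword is the row space of a 5 × n matrix in echelon form with a prescribed set of pivot columns.
-- Let X be the multiplication by x on F[x]/(f), where f is irreducible of degree k ≥ 5. A nonzero
-- combination of 1, X, …, X⁴ is invertible, so the 5 × k matrices with rows r₀, …, r₄ satisfying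
-- r₀ + X r₁ + … + X⁴ r₄ = 0 have no member of rank one, while r₁, …, r₄ can be prescribed freely. Hence
-- all echelon matrices with the same pivots may be used, with row 0 determined by the others, and two
-- of them are at distance at least 4. Codewords with different pivots are at distance at least 4 as soon as
-- the pivot sets share at most three elements, since a vector of both spaces has its leading entry in
-- a common pivot column.
--
-- The pivots 1, …, 5 give a lifted MRD code. Another 22 pivot sets, made of three of the first five and
-- two of the next six columns, contribute more than all other terms of M(n) together; what they
-- contribute in excess also absorbs the terms M(n - 5 j) with j ≥ 1 and q⁴ + q³ + q² + q + 1.
--
-- An irreducible polynomial of degree k exists by a sieve: the monic polynomials not divisible by the
-- irreducibles p₁, …, p_r are counted by ∏ (1 − t^deg pᵢ) / (1 − q t), and its logarithmic derivative
-- shows that the coefficient of t^k does not vanish when all pᵢ have degree less than k.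
module Submission where

open import Defs
open import Data.Nat using (ℕ; _≤_; _∸_)

open import Algebra.Bundles using (CommutativeRing)
open import Data.Bool using (if_then_else_)
open import Data.Fin as Fin using (Fin; zero; suc; toℕ; fromℕ; fromℕ<; inject₁; punchIn; punchOut; #_; _↑ˡ_; _↑ʳ_; splitAt; combine; finToFun; funToFin)
import Data.Fin.Properties as Finₚ
import Data.Integer as ℤ
import Data.Integer.Properties as ℤₚ
import Data.Integer.Tactic.RingSolver as ℤSolver
open import Data.List as List using (List; []; _∷_; _++_; map; length; filter; allFin; cartesianProductWith)
open import Data.List.Membership.Propositional using (_∈_)
open import Data.List.Membership.Propositional.Properties
  using (∈-filter⁺; ∈-filter⁻; ∈-allFin; ∈-lookup; ∈-tabulate⁺; ∈-++⁺ˡ)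
import Data.List.Properties as Listₚ
open import Data.List.Relation.Unary.All as All using (All; []; _∷_)
import Data.List.Relation.Unary.All.Properties as Allₚ
open import Data.List.Relation.Unary.AllPairs using (AllPairs; []; _∷_; allPairs?)
import Data.List.Relation.Unary.AllPairs.Properties as AllPairsₚ
import Data.List.Relation.Unary.Any as Any
open import Data.List.Relation.Unary.Any.Properties using (lookup-index)
open import Data.List.Relation.Unary.Unique.Propositional using (Unique)
open import Data.List.Relation.Unary.Unique.Propositional.Properties using (filter⁺; allFin⁺)
open import Data.Nat as ℕ using (zero; suc; z≤n; s≤s; _<_)
import Data.Nat.Divisibility as ∣ₙ
import Data.Nat.DivMod as DivMod
import Data.Nat.ListAction as ListAction
import Data.Nat.Properties as ℕₚ
open import Algebra.Properties.CommutativeMonoid.Sum ℕₚ.+-0-commutativeMonoid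
  using (sum-cong-≗; ∑-distrib-+; ∑-comm) renaming (sum to ∑)
import Data.Nat.Solver as NatSolver
import Data.Nat.Tactic.RingSolver as ℕSolver
open import Data.Product using (∃; ∃₂; _×_; _,_; proj₁; proj₂)
import Data.Rational as ℚ
import Data.Rational.Properties as ℚₚ
import Data.Rational.Unnormalised as ℚᵘ
import Data.Rational.Unnormalised.Properties as ℚᵘₚ
open import Data.Sum using (_⊎_; inj₁; inj₂; [_,_]′)
open import Data.Unit using (tt)
open import Data.Vec as Vec using (Vec; []; _∷_)
open import Function using (_∘_; id)
open import Function.Bundles using (Inverse)
open import Function.Definitions using (Injective)
open import Level using (_⊔_)
open import Relation.Binary.Bundles using (Setoid)
open import Relation.Binary.Definitions using (Symmetric; tri<; tri≈; tri>)
import Relation.Binary.PropositionalEquality as ≡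
open ≡ using (_≡_; _≢_; _≗_)
import Relation.Binary.Reasoning.Setoid as SetoidReasoning
open import Relation.Nullary using (¬_; Dec; yes; no; does)
open import Relation.Nullary.Decidable using (⌊_⌋; ¬?; _×-dec_; _→-dec_; map′; from-yes; dec-true; dec-false)
open import Relation.Nullary.Negation using (contradiction)

-- With n = 11 + t and t ≥ 1, all pivots lie in the first eleven columns. The last t columns are
-- then free in each row, a pivot set contributes q^(4t + c) codewords with c independent of n, and
-- both sides of the claim scale like q^(4t). What remains is one polynomial inequality in q. Its
-- two sides agree in q^24 + q^20 + q^18; at q^16 the code has coefficient 6 where the estimate of
-- M(n) has 4. The two spare q^16 pay for all lower terms, including inner sums worth about 4 q^15.
-- For q ≥ 3 geometric estimates suffice; for q = 2 the inner sums have to be evaluated. It is row 0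
-- that is solved for, because the relation gives no control over the support of the row it
-- determines, and row 0 may occupy every free column. Two codewords with the same pivots that share
-- four independent vectors assign to them the same coordinates, so the difference of the two
-- matrices is annihilated by four independent vectors of F⁵ and has rank at most one. The sieve
-- rests on Euclid's lemma for one irreducible at a time.

-- Polynomials over a commutative ring as coefficient lists

module Polynomial {c ℓ} (R : CommutativeRing c ℓ) where
  open CommutativeRing R
  open import Algebra.Properties.Ring ring using (-‿distribˡ-*)
  import Algebra.Properties.CommutativeSemigroup +-commutativeSemigroup as +ₛ

  private
    refl′ : ∀ {x} → x ≈ x
    refl′ = CommutativeRing.refl R

  Poly : Set c
  Poly = List Carrier

  coeff : Poly → ℕ → Carrier
  coeff []      i       = 0#
  coeff (a ∷ f) zero    = a
  coeff (a ∷ f) (suc i) = coeff f i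

  infix 4 _~_
  -- Lists that differ by trailing zeros must be identified, hence equality of all coefficients. As
  -- a record, a proof still determines `f` and `g` for unification.
  record _~_ (f g : Poly) : Set ℓ where
    constructor mk~
    field at : ∀ i → coeff f i ≈ coeff g i
  open _~_ public

  ~-refl : ∀ {f} → f ~ f
  ~-refl .at i = refl′

  ~-sym : ∀ {f g} → f ~ g → g ~ f
  ~-sym e .at i = sym (at e i)

  ~-trans : ∀ {f g h} → f ~ g → g ~ h → f ~ h
  ~-trans d e .at i = trans (at d i) (at e i)

  polySetoid : Setoid c ℓ
  polySetoid = record
    { Carrier = Poly ; _≈_ = _~_
    ; isEquivalence = record { refl = ~-refl ; sym = ~-sym ; trans = ~-trans } }

  infixl 6 _⊕_
  infixr 8 _⊙_
  infixl 7 _⊗_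

  -- Later proofs see the operations only through the coefficient and cons laws exported here, which
  -- keeps `⊕`, `⊙` and `⊗` rigid under unification.
  opaque
    _⊕_ : Poly → Poly → Poly
    []      ⊕ g       = g
    (a ∷ f) ⊕ []      = a ∷ f
    (a ∷ f) ⊕ (b ∷ g) = (a + b) ∷ (f ⊕ g)

    _⊙_ : Carrier → Poly → Poly
    a ⊙ f = map (a *_) f

    _⊗_ : Poly → Poly → Poly
    []      ⊗ g = []
    (a ∷ f) ⊗ g = (a ⊙ g) ⊕ (0# ∷ (f ⊗ g))

    coeff-⊕ : ∀ f g i → coeff (f ⊕ g) i ≈ coeff f i + coeff g i
    coeff-⊕ []      g       i       = sym (+-identityˡ _)
    coeff-⊕ (a ∷ f) []      i       = sym (+-identityʳ _)
    coeff-⊕ (a ∷ f) (b ∷ g) zero    = refl′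
    coeff-⊕ (a ∷ f) (b ∷ g) (suc i) = coeff-⊕ f g i

    coeff-⊙ : ∀ a f i → coeff (a ⊙ f) i ≈ a * coeff f i
    coeff-⊙ a []      i       = sym (zeroʳ a)
    coeff-⊙ a (b ∷ f) zero    = refl′
    coeff-⊙ a (b ∷ f) (suc i) = coeff-⊙ a f i

    ∷-⊕ : ∀ a b f g → (a ∷ f) ⊕ (b ∷ g) ~ (a + b) ∷ (f ⊕ g)
    ∷-⊕ a b f g = ~-refl

    ∷-⊙ : ∀ a b f → a ⊙ (b ∷ f) ~ (a * b) ∷ (a ⊙ f)
    ∷-⊙ a b f = ~-refl

    []-⊗ : ∀ g → [] ⊗ g ~ []
    []-⊗ g = ~-refl

    ∷-⊗ : ∀ a f g → (a ∷ f) ⊗ g ~ (a ⊙ g) ⊕ (0# ∷ (f ⊗ g))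
    ∷-⊗ a f g = ~-refl

  infix 9 ⊖_
  ⊖_ : Poly → Poly
  ⊖ f = (- 1#) ⊙ f

  ∷-cong : ∀ {a b f g} → a ≈ b → f ~ g → a ∷ f ~ b ∷ g
  ∷-cong e d .at zero    = e
  ∷-cong e d .at (suc i) = at d i

  shift-cong : ∀ {a f g} → f ~ g → a ∷ f ~ a ∷ g
  shift-cong = ∷-cong (refl′)

  0∷[] : 0# ∷ [] ~ []
  0∷[] .at zero    = refl′
  0∷[] .at (suc i) = refl′

  ⊕-cong : ∀ {f f′ g g′} → f ~ f′ → g ~ g′ → f ⊕ g ~ f′ ⊕ g′
  ⊕-cong {f} {f′} {g} {g′} d e .at i =
    trans (coeff-⊕ f g i) (trans (+-cong (at d i) (at e i)) (sym (coeff-⊕ f′ g′ i)))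

  ⊙-cong : ∀ {a b f g} → a ≈ b → f ~ g → a ⊙ f ~ b ⊙ g
  ⊙-cong {a} {b} {f} {g} d e .at i =
    trans (coeff-⊙ a f i) (trans (*-cong d (at e i)) (sym (coeff-⊙ b g i)))

  ⊕-comm : ∀ f g → f ⊕ g ~ g ⊕ f
  ⊕-comm f g .at i = trans (coeff-⊕ f g i) (trans (+-comm _ _) (sym (coeff-⊕ g f i)))

  ⊕-assoc : ∀ f g h → (f ⊕ g) ⊕ h ~ f ⊕ (g ⊕ h)
  ⊕-assoc f g h .at i =
    trans (coeff-⊕ (f ⊕ g) h i) (trans (+-congʳ (coeff-⊕ f g i)) (trans (+-assoc _ _ _)
      (sym (trans (coeff-⊕ f (g ⊕ h) i) (+-congˡ (coeff-⊕ g h i))))))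

  ⊕-identityʳ : ∀ f → f ⊕ [] ~ f
  ⊕-identityʳ f .at i = trans (coeff-⊕ f [] i) (+-identityʳ _)

  ⊕-identityˡ : ∀ f → [] ⊕ f ~ f
  ⊕-identityˡ f .at i = trans (coeff-⊕ [] f i) (+-identityˡ _)

  ⊕-medial : ∀ f g h k → (f ⊕ g) ⊕ (h ⊕ k) ~ (f ⊕ h) ⊕ (g ⊕ k)
  ⊕-medial f g h k .at i =
    trans (coeff-⊕ (f ⊕ g) (h ⊕ k) i) (trans (+-cong (coeff-⊕ f g i) (coeff-⊕ h k i))
      (trans (+ₛ.interchange _ _ _ _)
        (sym (trans (coeff-⊕ (f ⊕ h) (g ⊕ k) i) (+-cong (coeff-⊕ f h i) (coeff-⊕ g k i))))))

  ⊙-⊕ : ∀ a f g → a ⊙ (f ⊕ g) ~ a ⊙ f ⊕ a ⊙ g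
  ⊙-⊕ a f g .at i =
    trans (coeff-⊙ a (f ⊕ g) i) (trans (*-congˡ (coeff-⊕ f g i)) (trans (distribˡ _ _ _)
      (sym (trans (coeff-⊕ (a ⊙ f) (a ⊙ g) i) (+-cong (coeff-⊙ a f i) (coeff-⊙ a g i))))))

  +-⊙ : ∀ a b f → (a + b) ⊙ f ~ a ⊙ f ⊕ b ⊙ f
  +-⊙ a b f .at i =
    trans (coeff-⊙ (a + b) f i) (trans (distribʳ _ _ _)
      (sym (trans (coeff-⊕ (a ⊙ f) (b ⊙ f) i) (+-cong (coeff-⊙ a f i) (coeff-⊙ b f i)))))

  *-⊙ : ∀ a b f → (a * b) ⊙ f ~ a ⊙ (b ⊙ f)
  *-⊙ a b f .at i =
    trans (coeff-⊙ (a * b) f i) (trans (*-assoc _ _ _)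
      (sym (trans (coeff-⊙ a (b ⊙ f) i) (*-congˡ (coeff-⊙ b f i)))))

  1-⊙ : ∀ f → 1# ⊙ f ~ f
  1-⊙ f .at i = trans (coeff-⊙ 1# f i) (*-identityˡ _)

  ⊙-[] : ∀ a → a ⊙ [] ~ []
  ⊙-[] a .at i = trans (coeff-⊙ a [] i) (zeroʳ a)

  0-⊙ : ∀ f → 0# ⊙ f ~ []
  0-⊙ f .at i = trans (coeff-⊙ 0# f i) (zeroˡ _)

  ⊖-inverse : ∀ f → f ⊕ ⊖ f ~ []
  ⊖-inverse f = ~-trans (⊕-cong (~-sym (1-⊙ f)) ~-refl)
    (~-trans (~-sym (+-⊙ 1# (- 1#) f)) (~-trans (⊙-cong (-‿inverseʳ 1#) ~-refl) (0-⊙ f)))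

  shift-⊕ : ∀ f g → 0# ∷ (f ⊕ g) ~ (0# ∷ f) ⊕ (0# ∷ g)
  shift-⊕ f g = ~-trans (∷-cong (sym (+-identityˡ 0#)) ~-refl) (~-sym (∷-⊕ 0# 0# f g))

  shift-⊙ : ∀ a f → 0# ∷ (a ⊙ f) ~ a ⊙ (0# ∷ f)
  shift-⊙ a f = ~-trans (∷-cong (sym (zeroʳ a)) ~-refl) (~-sym (∷-⊙ a 0# f))

  shift-⊗ : ∀ f g → (0# ∷ f) ⊗ g ~ 0# ∷ (f ⊗ g)
  shift-⊗ f g = ~-trans (∷-⊗ 0# f g) (~-trans (⊕-cong (0-⊙ g) ~-refl) (⊕-identityˡ _))

  module ~R = SetoidReasoning polySetoid

  ⊗-zeroˡ : ∀ {f} g → f ~ [] → f ⊗ g ~ []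
  ⊗-zeroˡ {[]}    g e = []-⊗ g
  ⊗-zeroˡ {a ∷ f} g e = ~-trans (∷-⊗ a f g) (~-trans
    (⊕-cong (~-trans (⊙-cong (at e 0) ~-refl) (0-⊙ g))
            (~-trans (shift-cong (⊗-zeroˡ g (mk~ λ i → at e (suc i)))) 0∷[])) (⊕-identityʳ []))

  ⊗-congʳ : ∀ {f f′} g → f ~ f′ → f ⊗ g ~ f′ ⊗ g
  ⊗-congʳ {[]}    {f′}     g e = ~-trans ([]-⊗ g) (~-sym (⊗-zeroˡ g (~-sym e)))
  ⊗-congʳ {a ∷ f} {[]}     g e = ~-trans (⊗-zeroˡ g e) (~-sym ([]-⊗ g))
  ⊗-congʳ {a ∷ f} {b ∷ f′} g e =
    ~-trans (∷-⊗ a f g) (~-trans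
      (⊕-cong (⊙-cong (at e 0) ~-refl) (shift-cong (⊗-congʳ g (mk~ λ i → at e (suc i)))))
      (~-sym (∷-⊗ b f′ g)))

  -- The defining recursion mirrored to the right factor; commutativity is then an induction on the
  -- left factor.
  ⊗-∷ʳ : ∀ f b g → f ⊗ (b ∷ g) ~ b ⊙ f ⊕ (0# ∷ (f ⊗ g))
  ⊗-∷ʳ []      b g = ~-trans ([]-⊗ (b ∷ g)) (~-sym (begin
    b ⊙ [] ⊕ (0# ∷ ([] ⊗ g))   ≈⟨ ⊕-cong (⊙-[] b) (~-trans (shift-cong ([]-⊗ g)) 0∷[]) ⟩
    [] ⊕ []                    ≈⟨ ⊕-identityˡ [] ⟩
    []                         ∎))
    where open ~R
  ⊗-∷ʳ (a ∷ f) b g = begin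
    (a ∷ f) ⊗ (b ∷ g)
      ≈⟨ ∷-⊗ a f (b ∷ g) ⟩
    a ⊙ (b ∷ g) ⊕ (0# ∷ (f ⊗ (b ∷ g)))
      ≈⟨ ⊕-cong (∷-⊙ a b g) (shift-cong (⊗-∷ʳ f b g)) ⟩
    ((a * b) ∷ a ⊙ g) ⊕ (0# ∷ (b ⊙ f ⊕ (0# ∷ (f ⊗ g))))
      ≈⟨ ∷-⊕ (a * b) 0# (a ⊙ g) _ ⟩
    (a * b + 0#) ∷ (a ⊙ g ⊕ (b ⊙ f ⊕ (0# ∷ (f ⊗ g))))
      ≈⟨ ∷-cong (+-congʳ (*-comm a b)) (begin
        a ⊙ g ⊕ (b ⊙ f ⊕ (0# ∷ (f ⊗ g)))    ≈⟨ ~-sym (⊕-assoc _ _ _) ⟩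
        a ⊙ g ⊕ b ⊙ f ⊕ (0# ∷ (f ⊗ g))      ≈⟨ ⊕-cong (⊕-comm (a ⊙ g) _) ~-refl ⟩
        b ⊙ f ⊕ a ⊙ g ⊕ (0# ∷ (f ⊗ g))      ≈⟨ ⊕-assoc _ _ _ ⟩
        b ⊙ f ⊕ (a ⊙ g ⊕ (0# ∷ (f ⊗ g)))    ∎) ⟩
    (b * a + 0#) ∷ (b ⊙ f ⊕ (a ⊙ g ⊕ (0# ∷ (f ⊗ g))))
      ≈⟨ ~-sym (∷-⊕ (b * a) 0# (b ⊙ f) _) ⟩
    ((b * a) ∷ b ⊙ f) ⊕ (0# ∷ (a ⊙ g ⊕ (0# ∷ (f ⊗ g))))
      ≈⟨ ~-sym (⊕-cong (∷-⊙ b a f) (shift-cong (∷-⊗ a f g))) ⟩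
    b ⊙ (a ∷ f) ⊕ (0# ∷ ((a ∷ f) ⊗ g)) ∎
    where open ~R

  ⊗-zeroʳ : ∀ f → f ⊗ [] ~ []
  ⊗-zeroʳ []      = []-⊗ []
  ⊗-zeroʳ (a ∷ f) = ~-trans (∷-⊗ a f []) (~-trans
    (⊕-cong (⊙-[] a) (~-trans (shift-cong (⊗-zeroʳ f)) 0∷[])) (⊕-identityʳ []))

  ⊗-comm : ∀ f g → f ⊗ g ~ g ⊗ f
  ⊗-comm []      g = ~-trans ([]-⊗ g) (~-sym (⊗-zeroʳ g))
  ⊗-comm (a ∷ f) g = ~-trans (∷-⊗ a f g) (~-trans
    (⊕-cong ~-refl (shift-cong (⊗-comm f g))) (~-sym (⊗-∷ʳ g a f)))

  ⊗-congˡ : ∀ f {g g′} → g ~ g′ → f ⊗ g ~ f ⊗ g′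
  ⊗-congˡ f {g} {g′} e = ~-trans (⊗-comm f g) (~-trans (⊗-congʳ f e) (⊗-comm g′ f))

  ⊙-⊗ : ∀ a f g → (a ⊙ f) ⊗ g ~ a ⊙ (f ⊗ g)
  ⊙-⊗ a []      g = ~-trans (⊗-zeroˡ g (⊙-[] a)) (~-sym (~-trans (⊙-cong refl′ ([]-⊗ g)) (⊙-[] a)))
  ⊙-⊗ a (b ∷ f) g = begin
    (a ⊙ (b ∷ f)) ⊗ g                    ≈⟨ ⊗-congʳ g (∷-⊙ a b f) ⟩
    ((a * b) ∷ a ⊙ f) ⊗ g                ≈⟨ ∷-⊗ (a * b) (a ⊙ f) g ⟩
    (a * b) ⊙ g ⊕ (0# ∷ ((a ⊙ f) ⊗ g))   ≈⟨ ⊕-cong (*-⊙ a b g) (shift-cong (⊙-⊗ a f g)) ⟩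
    a ⊙ b ⊙ g ⊕ (0# ∷ (a ⊙ (f ⊗ g)))     ≈⟨ ⊕-cong ~-refl (shift-⊙ a (f ⊗ g)) ⟩
    a ⊙ b ⊙ g ⊕ a ⊙ (0# ∷ (f ⊗ g))       ≈⟨ ~-sym (⊙-⊕ a _ _) ⟩
    a ⊙ (b ⊙ g ⊕ (0# ∷ (f ⊗ g)))         ≈⟨ ⊙-cong refl′ (~-sym (∷-⊗ b f g)) ⟩
    a ⊙ ((b ∷ f) ⊗ g)                    ∎
    where open ~R

  ⊗-⊙ : ∀ a f g → f ⊗ (a ⊙ g) ~ a ⊙ (f ⊗ g)
  ⊗-⊙ a f g = ~-trans (⊗-comm f _) (~-trans (⊙-⊗ a g f) (⊙-cong (refl′) (⊗-comm g f)))

  ⊗-distribʳ : ∀ h f g → (f ⊕ g) ⊗ h ~ f ⊗ h ⊕ g ⊗ h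
  ⊗-distribʳ h []      g       = ~-trans (⊗-congʳ h (⊕-identityˡ g))
    (~-sym (~-trans (⊕-cong ([]-⊗ h) ~-refl) (⊕-identityˡ _)))
  ⊗-distribʳ h (a ∷ f) []      = ~-trans (⊗-congʳ h (⊕-identityʳ (a ∷ f)))
    (~-sym (~-trans (⊕-cong ~-refl ([]-⊗ h)) (⊕-identityʳ _)))
  ⊗-distribʳ h (a ∷ f) (b ∷ g) = begin
    ((a ∷ f) ⊕ (b ∷ g)) ⊗ h
      ≈⟨ ⊗-congʳ h (∷-⊕ a b f g) ⟩
    ((a + b) ∷ (f ⊕ g)) ⊗ h
      ≈⟨ ∷-⊗ (a + b) (f ⊕ g) h ⟩
    (a + b) ⊙ h ⊕ (0# ∷ ((f ⊕ g) ⊗ h))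
      ≈⟨ ⊕-cong (+-⊙ a b h) (~-trans (shift-cong (⊗-distribʳ h f g)) (shift-⊕ _ _)) ⟩
    (a ⊙ h ⊕ b ⊙ h) ⊕ ((0# ∷ (f ⊗ h)) ⊕ (0# ∷ (g ⊗ h)))
      ≈⟨ ⊕-medial (a ⊙ h) _ _ _ ⟩
    (a ⊙ h ⊕ (0# ∷ (f ⊗ h))) ⊕ (b ⊙ h ⊕ (0# ∷ (g ⊗ h)))
      ≈⟨ ~-sym (⊕-cong (∷-⊗ a f h) (∷-⊗ b g h)) ⟩
    (a ∷ f) ⊗ h ⊕ (b ∷ g) ⊗ h ∎
    where open ~R

  ⊗-distribˡ : ∀ h f g → h ⊗ (f ⊕ g) ~ h ⊗ f ⊕ h ⊗ g
  ⊗-distribˡ h f g = ~-trans (⊗-comm h _)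
    (~-trans (⊗-distribʳ h f g) (⊕-cong (⊗-comm f h) (⊗-comm g h)))

  ⊗-assoc : ∀ f g h → (f ⊗ g) ⊗ h ~ f ⊗ (g ⊗ h)
  ⊗-assoc []      g h = ~-trans (⊗-zeroˡ h ([]-⊗ g)) (~-sym ([]-⊗ (g ⊗ h)))
  ⊗-assoc (a ∷ f) g h = begin
    ((a ∷ f) ⊗ g) ⊗ h                    ≈⟨ ⊗-congʳ h (∷-⊗ a f g) ⟩
    (a ⊙ g ⊕ (0# ∷ (f ⊗ g))) ⊗ h         ≈⟨ ⊗-distribʳ h (a ⊙ g) _ ⟩
    (a ⊙ g) ⊗ h ⊕ (0# ∷ (f ⊗ g)) ⊗ h     ≈⟨ ⊕-cong (⊙-⊗ a g h) (shift-⊗ (f ⊗ g) h) ⟩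
    a ⊙ (g ⊗ h) ⊕ (0# ∷ ((f ⊗ g) ⊗ h))   ≈⟨ ⊕-cong ~-refl (shift-cong (⊗-assoc f g h)) ⟩
    a ⊙ (g ⊗ h) ⊕ (0# ∷ (f ⊗ (g ⊗ h)))   ≈⟨ ~-sym (∷-⊗ a f (g ⊗ h)) ⟩
    (a ∷ f) ⊗ (g ⊗ h)                    ∎
    where open ~R

  one : Poly
  one = 1# ∷ []

  ⊗-identityˡ : ∀ f → one ⊗ f ~ f
  ⊗-identityˡ f = ~-trans (∷-⊗ 1# [] f)
    (~-trans (⊕-cong (1-⊙ f) (~-trans (shift-cong ([]-⊗ f)) 0∷[])) (⊕-identityʳ f))

  -- Vanishing from `n` on makes sense for the zero polynomial and is blind to trailing zeros.
  -- Degree at most d reads `Deg< (suc d)`.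
  Deg< : ℕ → Poly → Set ℓ
  Deg< n f = ∀ i → n ≤ i → coeff f i ≈ 0#

  Deg<-weaken : ∀ {m n} f → m ≤ n → Deg< m f → Deg< n f
  Deg<-weaken f m≤n d i n≤i = d i (ℕₚ.≤-trans m≤n n≤i)

  Deg<-~ : ∀ {n f g} → f ~ g → Deg< n f → Deg< n g
  Deg<-~ e d i n≤i = trans (sym (at e i)) (d i n≤i)

  Deg<-⊕ : ∀ {n} f g → Deg< n f → Deg< n g → Deg< n (f ⊕ g)
  Deg<-⊕ f g df dg i n≤i =
    trans (coeff-⊕ f g i) (trans (+-cong (df i n≤i) (dg i n≤i)) (+-identityˡ 0#))

  Deg<-⊙ : ∀ {n} a f → Deg< n f → Deg< n (a ⊙ f)
  Deg<-⊙ a f df i n≤i = trans (coeff-⊙ a f i) (trans (*-congˡ (df i n≤i)) (zeroʳ a))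

  Deg<-shift : ∀ {n} a f → Deg< n f → Deg< (suc n) (a ∷ f)
  Deg<-shift a f df (suc i) (s≤s n≤i) = df i n≤i

  Deg<1-tail : ∀ {a f} → Deg< 1 (a ∷ f) → f ~ []
  Deg<1-tail df .at i = df (suc i) (s≤s z≤n)

  constant-⊗ : ∀ a f g → Deg< 1 (a ∷ f) → (a ∷ f) ⊗ g ~ a ⊙ g
  constant-⊗ a f g df = ~-trans (∷-⊗ a f g) (~-trans
    (⊕-cong ~-refl (~-trans (shift-cong (⊗-zeroˡ g (Deg<1-tail df))) 0∷[])) (⊕-identityʳ _))

  Deg<-⊗ : ∀ f g {d e} → Deg< (suc d) f → Deg< (suc e) g → Deg< (suc (d ℕ.+ e)) (f ⊗ g)
  Deg<-⊗ []      g         df dg i le = at ([]-⊗ g) i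
  Deg<-⊗ (a ∷ f) g {zero}  df dg = Deg<-~ (~-sym (constant-⊗ a f g df)) (Deg<-⊙ a g dg)
  Deg<-⊗ (a ∷ f) g {suc d} {e} df dg = Deg<-~ (~-sym (∷-⊗ a f g))
    (Deg<-⊕ (a ⊙ g) (0# ∷ (f ⊗ g))
      (Deg<-weaken (a ⊙ g) (s≤s (ℕₚ.m≤n+m e (suc d))) (Deg<-⊙ a g dg))
      (Deg<-shift 0# (f ⊗ g) (Deg<-⊗ f g (λ i le → df (suc i) (s≤s le)) dg)))

  coeff-⊗-top : ∀ f g {d e} → Deg< (suc d) f → Deg< (suc e) g →
    coeff (f ⊗ g) (d ℕ.+ e) ≈ coeff f d * coeff g e
  coeff-⊗-top []      g df dg = trans (at ([]-⊗ g) _) (sym (zeroˡ _))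
  coeff-⊗-top (a ∷ f) g {zero}  {e} df dg = trans (at (constant-⊗ a f g df) e) (coeff-⊙ a g e)
  coeff-⊗-top (a ∷ f) g {suc d} {e} df dg =
    trans (at (∷-⊗ a f g) _) (trans (coeff-⊕ (a ⊙ g) (0# ∷ (f ⊗ g)) (suc (d ℕ.+ e))) (trans
      (+-cong (Deg<-⊙ a g dg (suc (d ℕ.+ e)) (s≤s (ℕₚ.m≤n+m e d)))
              (coeff-⊗-top f g (λ i le → df (suc i) (s≤s le)) dg)) (+-identityˡ _)))

  Monic : ℕ → Poly → Set ℓ
  Monic d f = Deg< (suc d) f × coeff f d ≈ 1#

  Monic-~ : ∀ {d f g} → f ~ g → Monic d f → Monic d g
  Monic-~ e (df , l) = Deg<-~ e df , trans (sym (at e _)) l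

  Monic-⊗ : ∀ {d e} f g → Monic d f → Monic e g → Monic (d ℕ.+ e) (f ⊗ g)
  Monic-⊗ f g (df , lf) (dg , lg) =
    Deg<-⊗ f g df dg , trans (coeff-⊗-top f g df dg) (trans (*-cong lf lg) (*-identityˡ 1#))

  Monic-one : Monic 0 one
  Monic-one = (λ { (suc i) le → refl′ }) , refl′

  Monic0~one : ∀ {f} → Monic 0 f → f ~ one
  Monic0~one (df , l) .at zero    = l
  Monic0~one (df , l) .at (suc i) = df (suc i) (s≤s z≤n)

  infix 4 _∣_
  record _∣_ (f g : Poly) : Set (c ⊔ ℓ) where
    constructor divides
    field
      quotient : Poly
      equality : g ~ f ⊗ quotient

  ∣-~ : ∀ {f g h} → g ~ h → f ∣ g → f ∣ h
  ∣-~ e (divides k p) = divides k (~-trans (~-sym e) p)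

  ∣-⊗ˡ : ∀ {f g} h → f ∣ g → f ∣ h ⊗ g
  ∣-⊗ˡ {f} {g} h (divides k p) = divides (k ⊗ h)
    (~-trans (⊗-comm h g) (~-trans (⊗-congʳ h p) (⊗-assoc f k h)))

  ∣-⊗ʳ : ∀ {f g} h → f ∣ g → f ∣ g ⊗ h
  ∣-⊗ʳ {f} {g} h d = ∣-~ (⊗-comm h g) (∣-⊗ˡ h d)

  ∣-⊙ : ∀ {f g} a → f ∣ g → f ∣ a ⊙ g
  ∣-⊙ {f} a (divides k p) = divides (a ⊙ k) (~-trans (⊙-cong (refl′) p) (~-sym (⊗-⊙ a f k)))

  ∣-⊕ : ∀ {f g h} → f ∣ g → f ∣ h → f ∣ g ⊕ h
  ∣-⊕ {f} (divides k p) (divides l q) =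
    divides (k ⊕ l) (~-trans (⊕-cong p q) (~-sym (⊗-distribˡ f k l)))

  ∣-self : ∀ f g → f ∣ f ⊗ g
  ∣-self f g = divides g ~-refl

  ∣-trans : ∀ {f g h} → f ∣ g → g ∣ h → f ∣ h
  ∣-trans {f} (divides k p) (divides l q) =
    divides (k ⊗ l) (~-trans q (~-trans (⊗-congʳ l p) (⊗-assoc f k l)))

  move-⊕ : ∀ {f} g h → f ~ g ⊕ h → h ~ f ⊕ ⊖ g
  move-⊕ {f} g h e = ~-sym (begin
    f ⊕ ⊖ g           ≈⟨ ⊕-cong e ~-refl ⟩
    (g ⊕ h) ⊕ ⊖ g     ≈⟨ ⊕-cong (⊕-comm g h) ~-refl ⟩
    (h ⊕ g) ⊕ ⊖ g     ≈⟨ ⊕-assoc h g _ ⟩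
    h ⊕ (g ⊕ ⊖ g)     ≈⟨ ⊕-cong ~-refl (⊖-inverse g) ⟩
    h ⊕ []            ≈⟨ ⊕-identityʳ h ⟩
    h                 ∎)
    where open ~R

  ∣-cancel-⊕ : ∀ {f} g h → f ∣ g → f ∣ g ⊕ h → f ∣ h
  ∣-cancel-⊕ g h d e = ∣-~ (~-sym (move-⊕ g h ~-refl)) (∣-⊕ e (∣-⊙ (- 1#) d))

  record Division (g : Poly) (d : ℕ) (f : Poly) : Set (c ⊔ ℓ) where
    field
      quo rem   : Poly
      equation  : f ~ g ⊗ quo ⊕ rem
      rem<      : Deg< d rem

  -- Recursion on the coefficient list: the division of the tail `f` is multiplied by x and `a` is
  -- added, so the new remainder `a ∷ rem` has degree at most d, and subtracting one multiple of the
  -- monic `g` removes its coefficient at d.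
  divMod : ∀ g {d} → Monic d g → ∀ f → Division g d f
  divMod g mg [] = record
    { quo = [] ; rem = []
    ; equation = ~-sym (~-trans (⊕-identityʳ (g ⊗ [])) (⊗-zeroʳ g))
    ; rem< = λ i le → refl′ }
  divMod g {d} (dg , lg) (a ∷ f) = record
    { quo = l ∷ quo
    ; rem = s ⊕ ⊖ (l ⊙ g)
    ; equation = eqn
    ; rem< = small }
    where
    open Division (divMod g (dg , lg) f)
    s = a ∷ rem
    l = coeff s d
    ds : Deg< (suc d) s
    ds = Deg<-shift a rem rem<
    r<1+d : Deg< (suc d) (s ⊕ ⊖ (l ⊙ g))
    r<1+d = Deg<-⊕ s _ ds (Deg<-⊙ (- 1#) (l ⊙ g) (Deg<-⊙ l g dg))
    small : Deg< d (s ⊕ ⊖ (l ⊙ g))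
    small i d≤i with ℕₚ.m≤n⇒m<n∨m≡n d≤i
    ... | inj₁ d<i = r<1+d i d<i
    ... | inj₂ ≡.refl = begin
      coeff (s ⊕ ⊖ (l ⊙ g)) d            ≈⟨ coeff-⊕ s _ d ⟩
      l + coeff (⊖ (l ⊙ g)) d            ≈⟨ +-congˡ (coeff-⊙ (- 1#) (l ⊙ g) d) ⟩
      l + - 1# * coeff (l ⊙ g) d         ≈⟨ +-congˡ (*-congˡ (trans (coeff-⊙ l g d) (trans (*-congˡ lg) (*-identityʳ l)))) ⟩
      l + - 1# * l                       ≈⟨ +-congˡ (trans (sym (-‿distribˡ-* 1# l)) (-‿cong (*-identityˡ l))) ⟩
      l + - l                            ≈⟨ -‿inverseʳ l ⟩
      0#                                 ∎
      where open SetoidReasoning setoid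
    cancel : ∀ u v → u ⊕ (v ⊕ ⊖ u) ~ v
    cancel u v = begin
      u ⊕ (v ⊕ ⊖ u)   ≈⟨ ⊕-cong ~-refl (⊕-comm v _) ⟩
      u ⊕ (⊖ u ⊕ v)   ≈⟨ ~-sym (⊕-assoc u _ v) ⟩
      (u ⊕ ⊖ u) ⊕ v   ≈⟨ ⊕-cong (⊖-inverse u) ~-refl ⟩
      [] ⊕ v          ≈⟨ ⊕-identityˡ v ⟩
      v               ∎
      where open ~R
    eqn : a ∷ f ~ g ⊗ (l ∷ quo) ⊕ (s ⊕ ⊖ (l ⊙ g))
    eqn = begin
      a ∷ f                                                  ≈⟨ ~-trans (∷-cong (sym (+-identityˡ a)) equation) (~-sym (∷-⊕ 0# a (g ⊗ quo) rem)) ⟩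
      (0# ∷ (g ⊗ quo)) ⊕ s                                   ≈⟨ ⊕-cong ~-refl (~-sym (cancel (l ⊙ g) s)) ⟩
      (0# ∷ (g ⊗ quo)) ⊕ (l ⊙ g ⊕ (s ⊕ ⊖ (l ⊙ g)))           ≈⟨ ~-sym (⊕-assoc _ (l ⊙ g) _) ⟩
      (0# ∷ (g ⊗ quo)) ⊕ l ⊙ g ⊕ (s ⊕ ⊖ (l ⊙ g))             ≈⟨ ⊕-cong (⊕-comm _ (l ⊙ g)) ~-refl ⟩
      l ⊙ g ⊕ (0# ∷ (g ⊗ quo)) ⊕ (s ⊕ ⊖ (l ⊙ g))             ≈⟨ ⊕-cong (~-sym (⊗-∷ʳ g l quo)) ~-refl ⟩
      g ⊗ (l ∷ quo) ⊕ (s ⊕ ⊖ (l ⊙ g))                        ∎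
      where open ~R

-- Divisibility over a field and Euclid's lemma

module Irreducibility {c ℓ} (F : Field c ℓ) (_≈?_ : ∀ x y → Dec (Field._≈_ F x y)) where
  open Field F hiding (zero)
  open Polynomial commutativeRing

  -- A list may end in zeros, so the leading coefficient has to be found by testing.
  top : ∀ f → f ~ [] ⊎ ∃ λ d → Deg< (suc d) f × ¬ coeff f d ≈ 0#
  top [] = inj₁ ~-refl
  top (a ∷ f) with top f
  ... | inj₂ (d , df , ne) = inj₂ (suc d , Deg<-shift a f df , ne)
  ... | inj₁ f~[] with a ≈? 0#
  ...   | yes a≈0 = inj₁ (~-trans (∷-cong a≈0 f~[]) 0∷[])
  ...   | no  a≉0 = inj₂ (0 , (λ { (suc i) le → at f~[] i }) , a≉0)

  Deg<-bound : ∀ {f n d} → Deg< n f → ¬ coeff f d ≈ 0# → d < n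
  Deg<-bound {f} {n} {d} df ne with d ℕₚ.<? n
  ... | yes d<n = d<n
  ... | no  d≮n = contradiction (df d (ℕₚ.≮⇒≥ d≮n)) ne

  record MonicPart (f : Poly) : Set (c ⊔ ℓ) where
    field
      degree     : ℕ
      scale      : Carrier
      lead≉0     : ¬ coeff f degree ≈ 0#
      part       : Poly
      monic      : Monic degree part
      part~      : part ~ scale ⊙ f

  monicPart : ∀ f → f ~ [] ⊎ MonicPart f
  monicPart f with top f
  ... | inj₁ e = inj₁ e
  ... | inj₂ (d , df , ne) with inverse (coeff f d) ne
  ...   | y , xy≈1 = inj₂ (record
    { degree = d ; scale = y ; lead≉0 = ne ; part = y ⊙ f
    ; monic = Deg<-⊙ y f df , trans (coeff-⊙ y f d) (trans (*-comm _ _) xy≈1)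
    ; part~ = ~-refl })

  -- The leading coefficient of `h` would reappear unchanged in `p ⊗ h`, in a degree at least d.
  monic-⊗-small : ∀ p h {d} → Monic d p → Deg< d (p ⊗ h) → h ~ []
  monic-⊗-small p h {d} (dp , lp) small with top h
  ... | inj₁ e = e
  ... | inj₂ (e , dh , ne) = contradiction
    (trans (sym (trans (coeff-⊗-top p h dp dh) (trans (*-congʳ lp) (*-identityˡ _))))
           (small (d ℕ.+ e) (ℕₚ.m≤m+n d e))) ne

  ∣-small : ∀ {p f d} → Monic d p → p ∣ f → Deg< d f → f ~ []
  ∣-small {p} mp (divides k e) df = ~-trans e (~-trans
    (⊗-congˡ p (monic-⊗-small p k mp (Deg<-~ e df))) (⊗-zeroʳ p))

  infix 4 _∣?_
  _∣?_ : ∀ {p d} → Monic d p → ∀ f → Dec (p ∣ f)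
  _∣?_ {p} mp f with divMod p mp f
  ... | record { quo = k ; rem = r ; equation = e ; rem< = lt } with top r
  ...   | inj₁ r~[] = yes (divides k (~-trans e (~-trans (⊕-cong ~-refl r~[]) (⊕-identityʳ _))))
  -- If `p` divided `f`, it would divide the remainder, whose degree is below d and which would then
  -- vanish.
  ...   | inj₂ (_ , _ , ne) = no λ p∣f → contradiction
    (at (∣-small mp (∣-cancel-⊕ (p ⊗ k) r (∣-self p k) (∣-~ e p∣f)) lt) _) ne

  -- Only monic factors of intermediate degree are excluded: these are the polynomials that the
  -- sieve counts.
  record Irreducible (d : ℕ) (p : Poly) : Set (c ⊔ ℓ) where
    field
      monic     : Monic d p
      positive  : 1 ≤ d
      no-factor : ∀ {e g} → 1 ≤ e → e < d → Monic e g → ¬ g ∣ p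

  module _ {d p} (irr : Irreducible d p) where
    open Irreducible irr

    -- Descent on the degree of r: dividing p by r leaves a nonzero remainder of smaller degree
    -- which still multiplies b into the ideal of p.
    coprime-cancel : ∀ n {e} r → e < n → Monic e r → e < d → ∀ b → p ∣ r ⊗ b → p ∣ b
    coprime-cancel (suc n) {zero} r lt mr e<d b p∣rb =
      ∣-~ (~-trans (⊗-congʳ b (Monic0~one mr)) (⊗-identityˡ b)) p∣rb
    coprime-cancel (suc n) {suc e} r (s≤s lt) mr e<d b p∣rb with divMod r mr p
    ... | record { quo = k ; rem = s ; equation = eq ; rem< = s< } with monicPart s
    ...   | inj₁ s~[] = contradiction
      (divides k (~-trans eq (~-trans (⊕-cong ~-refl s~[]) (⊕-identityʳ _))))
      (no-factor (s≤s z≤n) e<d mr)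
    ...   | inj₂ mp = coprime-cancel n part (ℕₚ.≤-trans deg<e lt) monic′ (ℕₚ.<-trans deg<e e<d) b
        (∣-~ (~-trans (~-sym (⊙-⊗ scale s b)) (⊗-congʳ b (~-sym part~))) (∣-⊙ scale p∣sb))
      where
      open MonicPart mp renaming (monic to monic′)
      deg<e : degree < suc e
      deg<e = Deg<-bound {s} s< lead≉0
      p∣sb : p ∣ s ⊗ b
      -- s b is the difference of p b and r k b, both multiples of p.
      p∣sb = ∣-cancel-⊕ ((r ⊗ k) ⊗ b) (s ⊗ b)
        (∣-~ (~-trans (~-sym (⊗-assoc k r b)) (⊗-congʳ b (⊗-comm k r))) (∣-⊗ˡ k p∣rb))
        (∣-~ (~-trans (⊗-congʳ b eq) (⊗-distribʳ b (r ⊗ k) s)) (∣-⊗ʳ b (divides one (~-sym (~-trans (⊗-comm p one) (⊗-identityˡ p))))))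

    -- The remainder of `a` modulo p is zero or has a monic associate of degree below d, which
    -- `coprime-cancel` strips off.
    euclid : ∀ a b → p ∣ a ⊗ b → p ∣ a ⊎ p ∣ b
    euclid a b p∣ab with divMod p monic a
    ... | record { quo = k ; rem = s ; equation = eq ; rem< = s< } with monicPart s
    ...   | inj₁ s~[] = inj₁ (divides k (~-trans eq (~-trans (⊕-cong ~-refl s~[]) (⊕-identityʳ _))))
    ...   | inj₂ mp = inj₂ (coprime-cancel (suc degree) part ℕₚ.≤-refl monic′ (Deg<-bound {s} s< lead≉0) b
        (∣-~ (~-trans (~-sym (⊙-⊗ scale s b)) (⊗-congʳ b (~-sym part~))) (∣-⊙ scale p∣sb)))
      where
      open MonicPart mp renaming (monic to monic′)
      p∣sb : p ∣ s ⊗ b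
      p∣sb = ∣-cancel-⊕ ((p ⊗ k) ⊗ b) (s ⊗ b)
        (∣-⊗ʳ b (∣-self p k))
        (∣-~ (~-trans (⊗-congʳ b eq) (⊗-distribʳ b (p ⊗ k) s)) p∣ab)

-- Finite sums and indicators

funToFin-cong : ∀ {m n} {f g : Fin m → Fin n} → f ≗ g → funToFin f ≡ funToFin g
funToFin-cong {zero}  e = ≡.refl
funToFin-cong {suc m} e = ≡.cong₂ Fin.combine (e zero) (funToFin-cong (e ∘ suc))

finToFun-injective : ∀ {m n} {i j : Fin (n ℕ.^ m)} → finToFun {n} {m} i ≗ finToFun j → i ≡ j
finToFun-injective {m} {n} {i} {j} e =
  ≡.trans (≡.sym (Finₚ.funToFin-finToFin {m} {n} i))
    (≡.trans (funToFin-cong e) (Finₚ.funToFin-finToFin {m} {n} j))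

indicator : ∀ {p} {P : Set p} → Dec P → ℕ
indicator d = if does d then 1 else 0

indicator-true : ∀ {p} {P : Set p} (d : Dec P) → P → indicator d ≡ 1
indicator-true d x rewrite dec-true d x = ≡.refl

indicator-false : ∀ {p} {P : Set p} (d : Dec P) → ¬ P → indicator d ≡ 0
indicator-false d ¬x rewrite dec-false d ¬x = ≡.refl

indicator-cong : ∀ {p r} {P : Set p} {R : Set r} (d : Dec P) (e : Dec R) →
  (P → R) → (R → P) → indicator d ≡ indicator e
indicator-cong (yes x) e f g = ≡.sym (indicator-true e (f x))
indicator-cong (no ¬x) e f g = ≡.sym (indicator-false e (λ y → ¬x (g y)))

sum-0 : ∀ {n} (f : Fin n → ℕ) → (∀ i → f i ≡ 0) → ∑ f ≡ 0
sum-0 {zero}  f e = ≡.refl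
sum-0 {suc n} f e = ≡.cong₂ ℕ._+_ (e zero) (sum-0 (f ∘ suc) (e ∘ suc))

sum-1 : ∀ n → ∑ {n} (λ _ → 1) ≡ n
sum-1 zero    = ≡.refl
sum-1 (suc n) = ≡.cong suc (sum-1 n)

sum-single : ∀ {n} (f : Fin n → ℕ) c → (∀ i → i ≢ c → f i ≡ 0) → ∑ f ≡ f c
sum-single {suc n} f zero e =
  ≡.trans (≡.cong (f zero ℕ.+_) (sum-0 (f ∘ suc) λ i → e (suc i) λ ())) (ℕₚ.+-identityʳ _)
sum-single {suc n} f (suc c) e = ≡.cong₂ ℕ._+_ (e zero λ ())
  (sum-single (f ∘ suc) c λ i ne → e (suc i) (ne ∘ Finₚ.suc-injective))

sum≢0 : ∀ {n} (f : Fin n → ℕ) → ∑ f ≢ 0 → ∃ λ i → f i ≢ 0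
sum≢0 {zero}  f ne = contradiction ≡.refl ne
sum≢0 {suc n} f ne with f zero ℕₚ.≟ 0
... | no  ne₀ = zero , ne₀
... | yes e with sum≢0 (f ∘ suc) (λ e′ → ne (≡.cong₂ ℕ._+_ e e′))
...   | i , ne′ = suc i , ne′

sum≡0 : ∀ {n} (f : Fin n → ℕ) → ∑ f ≡ 0 → ∀ i → f i ≡ 0
sum≡0 f e zero    = ℕₚ.m+n≡0⇒m≡0 (f zero) e
sum≡0 f e (suc i) = sum≡0 (f ∘ suc) (ℕₚ.m+n≡0⇒n≡0 (f zero) e) i

-- Counting the monic polynomials that avoid given irreducible factors

module Sieve {c ℓ} (F : Field c ℓ) (q : ℕ) (size : HasSize F q)
             (_≈?_ : ∀ x y → Dec (Field._≈_ F x y)) where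
  open Field F hiding (zero)
  open Polynomial commutativeRing
  open Irreducibility F _≈?_
  open Inverse size using (to; from; to-cong; strictlyInverseˡ; strictlyInverseʳ)

  monicPoly : ∀ {d} → (Fin d → Carrier) → Poly
  monicPoly {zero}  c = one
  monicPoly {suc d} c = c zero ∷ monicPoly (c ∘ suc)

  monicPoly-monic : ∀ {d} (c : Fin d → Carrier) → Monic d (monicPoly c)
  monicPoly-monic {zero}  c = Monic-one
  monicPoly-monic {suc d} c with monicPoly-monic (c ∘ suc)
  ... | df , l = Deg<-shift (c zero) (monicPoly (c ∘ suc)) df , l

  coeff-monicPoly : ∀ {d} (c : Fin d → Carrier) j → coeff (monicPoly c) (toℕ j) ≈ c j
  coeff-monicPoly c zero    = refl
  coeff-monicPoly c (suc j) = coeff-monicPoly (c ∘ suc) j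

  monicPoly~ : ∀ {d} (c : Fin d → Carrier) f → Monic d f →
    (∀ j → c j ≈ coeff f (toℕ j)) → monicPoly c ~ f
  monicPoly~ {zero}  c f       mf         e = ~-sym (Monic0~one mf)
  monicPoly~ {suc d} c []      (_ , l)    e = contradiction l 0≉1
  monicPoly~ {suc d} c (a ∷ f) (df , l)   e =
    ∷-cong (e zero) (monicPoly~ (c ∘ suc) f ((λ i le → df (suc i) (s≤s le)) , l) (e ∘ suc))

  decode : ∀ d → Fin (q ℕ.^ d) → Poly
  decode d i = monicPoly (λ j → from (finToFun {q} {d} i j))

  encode : ∀ d → Poly → Fin (q ℕ.^ d)
  encode d f = funToFin (λ (j : Fin d) → to (coeff f (toℕ j)))

  decode-monic : ∀ d i → Monic d (decode d i)
  decode-monic d i = monicPoly-monic {d} _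

  decode-encode : ∀ d f → Monic d f → decode d (encode d f) ~ f
  decode-encode d f mf = monicPoly~ _ f mf λ j →
    trans (reflexive (≡.cong from (Finₚ.finToFun-funToFin {d} {q} _ j))) (strictlyInverseʳ _)

  decode-injective : ∀ d {i j} → decode d i ~ decode d j → i ≡ j
  decode-injective d {i} {j} e = finToFun-injective {d} {q} λ k →
    ≡.trans (≡.sym (strictlyInverseˡ _)) (≡.trans
      (to-cong (trans (sym (coeff-monicPoly {d} _ k)) (trans (at e (toℕ k)) (coeff-monicPoly {d} _ k))))
      (strictlyInverseˡ _))

  record Prime : Set (c ⊔ ℓ) where
    constructor mkPrime
    field
      {degree}    : ℕ
      {poly}      : Poly
      irreducible : Irreducible degree poly
    open Irreducible irreducible public
  open Prime using (degree; poly; irreducible; monic; positive)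

  Survives : List Prime → Poly → Set (c ⊔ ℓ)
  Survives ps f = All (λ P → ¬ poly P ∣ f) ps

  survives? : ∀ ps f → Dec (Survives ps f)
  survives? ps f = All.all? (λ P → ¬? (monic P ∣? f)) ps

  opaque
    count : List Prime → ℕ → ℕ
    count ps d = ∑ {q ℕ.^ d} (λ i → indicator (survives? ps (decode d i)))

    count-def : ∀ ps d → count ps d ≡ ∑ {q ℕ.^ d} (λ i → indicator (survives? ps (decode d i)))
    count-def ps d = ≡.refl

  count-[] : ∀ d → count [] d ≡ q ℕ.^ d
  count-[] d = ≡.trans (count-def [] d) (sum-1 (q ℕ.^ d))

  survives-~ : ∀ ps {f g} → f ~ g → Survives ps f → Survives ps g
  survives-~ ps e = All.map (λ nd d → nd (∣-~ (~-sym e) d))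

  survives-factor : ∀ ps {f g} → g ∣ f → Survives ps f → Survives ps g
  survives-factor ps g∣f = All.map (λ nd d → nd (∣-trans d g∣f))

  survives-product : ∀ ps f g → Survives ps f → Survives ps g → Survives ps (f ⊗ g)
  survives-product []       f g []       []       = []
  survives-product (P ∷ ps) f g (x ∷ xs) (y ∷ ys) =
    (λ d → [ x , y ]′ (euclid (irreducible P) f g d)) ∷ survives-product ps f g xs ys

  -- The top coefficient of p k, in degree d + deg k, is that of k; as p k is monic of degree d + e,
  -- this leaves only deg k = e.
  monic-quotient : ∀ {d e} p k → Monic d p → Monic (d ℕ.+ e) (p ⊗ k) → Monic e k
  monic-quotient {d} {e} p k (dp , lp) (dpk , lpk) with top k
  ... | inj₁ k~[] = contradiction
    (trans (sym (at (~-trans (⊗-congˡ p k~[]) (⊗-zeroʳ p)) (d ℕ.+ e))) lpk) 0≉1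
  ... | inj₂ (e′ , dk , ne) = ≡.subst (λ x → Monic x k) e′≡e
      (dk , trans (sym lead) (trans (reflexive (≡.cong (λ x → coeff (p ⊗ k) (d ℕ.+ x)) e′≡e)) lpk))
    where
    lead : coeff (p ⊗ k) (d ℕ.+ e′) ≈ coeff k e′
    lead = trans (coeff-⊗-top p k dp dk) (trans (*-congʳ lp) (*-identityˡ _))
    e′≤e : e′ ≤ e
    e′≤e = ℕₚ.+-cancelˡ-≤ d e′ e (ℕₚ.≤-pred (Deg<-bound {p ⊗ k} dpk (λ z → ne (trans (sym lead) z))))
    e≤e′ : e ≤ e′
    e≤e′ = ℕₚ.+-cancelˡ-≤ d e e′
      (ℕₚ.≤-pred (Deg<-bound {p ⊗ k} (Deg<-⊗ p k dp dk) (λ z → 0≉1 (trans (sym z) lpk))))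
    e′≡e = ℕₚ.≤-antisym e′≤e e≤e′

  monic-not-small : ∀ {d f} → Monic d f → ¬ f ~ []
  monic-not-small (_ , l) e = 0≉1 (trans (sym (at e _)) l)

  too-big : ∀ P {d f} → Monic d f → d < degree P → ¬ poly P ∣ f
  too-big P {d} {f} mf d<δ p∣f =
    monic-not-small mf (∣-small (monic P) p∣f (Deg<-weaken f d<δ (proj₁ mf)))

  count-small : ∀ P ps d → d < degree P → count (P ∷ ps) d ≡ count ps d
  count-small P ps d d<δ = ≡.trans (count-def (P ∷ ps) d) (≡.trans
    (sum-cong-≗ λ i → indicator-cong (survives? (P ∷ ps) (decode d i)) (survives? ps (decode d i))
      All.tail (λ s → too-big P (decode-monic d i) d<δ ∷ s))
    (≡.sym (count-def ps d)))

  count-0 : ∀ ps → count ps 0 ≡ 1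
  count-0 ps = ≡.trans (count-def ps 0) (≡.trans (ℕₚ.+-identityʳ _)
    (indicator-true (survives? ps (decode 0 zero)) (All.universal (λ P → too-big P Monic-one (positive P)) ps)))

  -- Multiplication by P is a bijection from the survivors of degree e onto the multiples of P among
  -- the survivors of degree deg P + e: products of survivors survive by Euclid's lemma, and factors
  -- of survivors survive. On generating functions, adding P multiplies by 1 - t^(deg P).
  count-step : ∀ P ps e → Survives ps (poly P) →
    count ps (degree P ℕ.+ e) ≡ count (P ∷ ps) (degree P ℕ.+ e) ℕ.+ count ps e
  count-step P ps e coprime = ≡.trans (count-def ps n) (≡.trans
    (sum-cong-≗ split)
    (≡.trans (∑-distrib-+ (λ v → indicator (survives? (P ∷ ps) (decode n v))) (λ v → ∑ (ψ v)))
      (≡.cong₂ ℕ._+_ (≡.sym (count-def (P ∷ ps) n))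
        (≡.trans (∑-comm ψ) (≡.trans (sum-cong-≗ column) (≡.sym (count-def ps e)))))))
    where
    p = poly P
    n = degree P ℕ.+ e
    product : Fin (q ℕ.^ e) → Fin (q ℕ.^ n)
    product w = encode n (p ⊗ decode e w)
    decode-product : ∀ w → decode n (product w) ~ p ⊗ decode e w
    decode-product w = decode-encode n _ (Monic-⊗ p (decode e w) (monic P) (decode-monic e w))
    -- `ψ v w` marks v = P w with w a survivor. The sum over w detects whether v is a surviving
    -- multiple of P; the sum over v is the indicator of w.
    ψ : Fin (q ℕ.^ n) → Fin (q ℕ.^ e) → ℕ
    ψ v w = if does (v Fin.≟ product w) then indicator (survives? ps (decode e w)) else 0
    ψ-off : ∀ v w → v ≢ product w → ψ v w ≡ 0
    ψ-off v w ne rewrite dec-false (v Fin.≟ product w) ne = ≡.refl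
    ψ-on : ∀ v w → v ≡ product w → ψ v w ≡ indicator (survives? ps (decode e w))
    ψ-on v w eq rewrite dec-true (v Fin.≟ product w) eq = ≡.refl
    column : ∀ w → ∑ (λ v → ψ v w) ≡ indicator (survives? ps (decode e w))
    column w = ≡.trans (sum-single (λ v → ψ v w) (product w) (λ v ne → ψ-off v w ne))
      (ψ-on (product w) w ≡.refl)
    split : ∀ v → indicator (survives? ps (decode n v)) ≡
      indicator (survives? (P ∷ ps) (decode n v)) ℕ.+ ∑ (ψ v)
    split v with monic P ∣? decode n v
    ... | no p∤v = ≡.trans
      (indicator-cong (survives? ps (decode n v)) (survives? (P ∷ ps) (decode n v)) (p∤v ∷_) All.tail)
      (≡.sym (≡.trans (≡.cong (indicator (survives? (P ∷ ps) (decode n v)) ℕ.+_)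
        (sum-0 (ψ v) λ w → ψ-off v w λ v≡ → p∤v
          (divides (decode e w) (≡.subst (λ x → decode n x ~ p ⊗ decode e w) (≡.sym v≡) (decode-product w)))))
        (ℕₚ.+-identityʳ _)))
    ... | yes (divides k eq) = ≡.sym (≡.trans
        (≡.cong₂ ℕ._+_ (indicator-false (survives? (P ∷ ps) (decode n v)) (λ { (nd ∷ _) → nd (divides k eq) }))
          (≡.trans (sum-single (ψ v) w₀ others) (ψ-on v w₀ v≡w₀)))
        (indicator-cong (survives? ps (decode e w₀)) (survives? ps (decode n v))
          (λ s → survives-~ ps (~-sym (~-trans eq (⊗-congˡ p (~-sym w₀~k)))) (survives-product ps p _ coprime s))
          (λ s → survives-~ ps (~-sym w₀~k) (survives-factor ps (divides p (~-trans eq (⊗-comm p k))) s))))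
      where
      mk : Monic e k
      mk = monic-quotient p k (monic P) (Monic-~ eq (decode-monic n v))
      w₀ = encode e k
      w₀~k : decode e w₀ ~ k
      w₀~k = decode-encode e k mk
      v≡w₀ : v ≡ product w₀
      v≡w₀ = decode-injective n (~-trans eq (~-trans (⊗-congˡ p (~-sym w₀~k)) (~-sym (decode-product w₀))))
      others : ∀ w → w ≢ w₀ → ψ v w ≡ 0
      others w ne = ψ-off v w λ v≡w → ne (decode-injective e (~-trans
        (cancel (decode e w) k (~-trans (~-sym (decode-product w))
          (~-trans (≡.subst (λ x → decode n (product w) ~ decode n x) (≡.sym v≡w) ~-refl) eq))) (~-sym w₀~k)))
        where
        cancel : ∀ f g → p ⊗ f ~ p ⊗ g → f ~ g
        cancel f g e′ = ~-trans (move f g) (~-trans (⊕-cong ~-refl diff~[]) (⊕-identityʳ g))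
          where
          diff~[] : f ⊕ ⊖ g ~ []
          diff~[] = monic-⊗-small p (f ⊕ ⊖ g) (monic P) (Deg<-~ (~-sym zero~) (λ _ _ → refl))
            where
            zero~ : p ⊗ (f ⊕ ⊖ g) ~ []
            zero~ = ~-trans (⊗-distribˡ p f (⊖ g)) (~-trans
              (⊕-cong e′ (⊗-⊙ (- 1#) p g)) (⊖-inverse (p ⊗ g)))
          move : ∀ f g → f ~ g ⊕ (f ⊕ ⊖ g)
          move f g = ~-sym (~-trans (⊕-comm g _) (~-trans (⊕-assoc f _ g)
            (~-trans (⊕-cong ~-refl (~-trans (⊕-comm _ g) (⊖-inverse g))) (⊕-identityʳ f))))

-- Integer power series and the logarithmic derivative of the sieve product

module PowerSeries where
  open import Data.Integer using (ℤ; +_; _+_; _-_; _*_)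
  open import Relation.Binary.PropositionalEquality
  open ℤSolver using (solve-∀)

  Series : Set
  Series = ℕ → ℤ

  -- The Cauchy product, peeling off the first coefficient of the left factor so that the recursion
  -- is structural in the degree.
  conv : Series → Series → Series
  conv a f zero    = a 0 * f 0
  conv a f (suc d) = a 0 * f (suc d) + conv (a ∘ suc) f d

  -- Multiplication by t^δ.
  down : ℕ → Series → Series
  down zero    f d       = f d
  down (suc δ) f zero    = + 0
  down (suc δ) f (suc d) = down δ f d

  down-cong : ∀ δ {f g : Series} → f ≗ g → down δ f ≗ down δ g
  down-cong zero    e d       = e d
  down-cong (suc δ) e zero    = refl
  down-cong (suc δ) e (suc d) = down-cong δ e d

  down-small : ∀ δ f d → d < δ → down δ f d ≡ + 0
  down-small (suc δ) f zero    lt       = refl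
  down-small (suc δ) f (suc d) (s≤s lt) = down-small δ f d lt

  down-+ : ∀ δ f e → down δ f (δ ℕ.+ e) ≡ f e
  down-+ zero    f e = refl
  down-+ (suc δ) f e = down-+ δ f e

  conv-congˡ : ∀ {a b : Series} f → a ≗ b → conv a f ≗ conv b f
  conv-congˡ f e zero    = cong (_* f 0) (e 0)
  conv-congˡ f e (suc d) = cong₂ (λ x y → x * f (suc d) + y) (e 0) (conv-congˡ f (e ∘ suc) d)

  conv-congʳ : ∀ a {f g : Series} → f ≗ g → conv a f ≗ conv a g
  conv-congʳ a e zero    = cong (a 0 *_) (e 0)
  conv-congʳ a e (suc d) = cong₂ (λ x y → a 0 * x + y) (e (suc d)) (conv-congʳ (a ∘ suc) e d)

  conv-subʳ : ∀ a f g d → conv a (λ i → f i - g i) d ≡ conv a f d - conv a g d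
  conv-subʳ a f g zero    = lem (a 0) (f 0) (g 0)
    where lem : ∀ x y z → x * (y - z) ≡ x * y - x * z
          lem = solve-∀
  conv-subʳ a f g (suc d) = trans (cong (λ z → a 0 * (f (suc d) - g (suc d)) + z) (conv-subʳ (a ∘ suc) f g d))
    (lem (a 0) (f (suc d)) (g (suc d)) (conv (a ∘ suc) f d) (conv (a ∘ suc) g d))
    where lem : ∀ x y z u v → x * (y - z) + (u - v) ≡ (x * y + u) - (x * z + v)
          lem = solve-∀

  conv-subˡ : ∀ a b f d → conv (λ i → a i - b i) f d ≡ conv a f d - conv b f d
  conv-subˡ a b f zero    = lem (a 0) (b 0) (f 0)
    where lem : ∀ x y z → (x - y) * z ≡ x * z - y * z
          lem = solve-∀
  conv-subˡ a b f (suc d) = trans (cong (λ z → (a 0 - b 0) * f (suc d) + z) (conv-subˡ (a ∘ suc) (b ∘ suc) f d))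
    (lem (a 0) (b 0) (f (suc d)) (conv (a ∘ suc) f d) (conv (b ∘ suc) f d))
    where lem : ∀ x y z u v → (x - y) * z + (u - v) ≡ (x * z + u) - (y * z + v)
          lem = solve-∀

  conv-scaleˡ : ∀ c a f d → conv (λ i → c * a i) f d ≡ c * conv a f d
  conv-scaleˡ c a f zero    = ℤₚ.*-assoc c (a 0) (f 0)
  conv-scaleˡ c a f (suc d) = trans (cong (λ z → c * a 0 * f (suc d) + z) (conv-scaleˡ c (a ∘ suc) f d))
    (lem c (a 0) (f (suc d)) (conv (a ∘ suc) f d))
    where lem : ∀ c x z u → c * x * z + c * u ≡ c * (x * z + u)
          lem = solve-∀

  conv-downʳ : ∀ δ a f d → conv a (down δ f) d ≡ down δ (conv a f) d
  conv-downʳ zero    a f d = refl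
  conv-downʳ (suc δ) a f d = trans (conv-congʳ a peel d) (trans (step a (down δ f) d) (lift d))
    where
    peel : down (suc δ) f ≗ down 1 (down δ f)
    peel zero    = refl
    peel (suc d) = refl
    step : ∀ a g d → conv a (down 1 g) d ≡ down 1 (conv a g) d
    step a g zero          = ℤₚ.*-zeroʳ (a 0)
    step a g (suc zero)    = trans (cong (λ z → a 0 * g 0 + z) (ℤₚ.*-zeroʳ (a 1))) (ℤₚ.+-identityʳ _)
    step a g (suc (suc d)) = cong (λ z → a 0 * g (suc d) + z) (step (a ∘ suc) g (suc d))
    lift : ∀ d → down 1 (conv a (down δ f)) d ≡ down (suc δ) (conv a f) d
    lift zero    = refl
    lift (suc d) = conv-downʳ δ a f d

  conv-downˡ : ∀ δ a f d → conv (down δ a) f d ≡ down δ (conv a f) d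
  conv-downˡ zero    a f d       = refl
  conv-downˡ (suc δ) a f zero    = refl
  conv-downˡ (suc δ) a f (suc d) = trans (ℤₚ.+-identityˡ _) (conv-downˡ δ a f d)

  unit : Series
  unit zero    = + 1
  unit (suc _) = + 0

  conv-zeroˡ : ∀ f d → conv (λ _ → + 0) f d ≡ + 0
  conv-zeroˡ f zero    = refl
  conv-zeroˡ f (suc d) = trans (ℤₚ.+-identityˡ _) (conv-zeroˡ f d)

  conv-unitˡ : ∀ f d → conv unit f d ≡ f d
  conv-unitˡ f zero    = ℤₚ.*-identityˡ _
  conv-unitˡ f (suc d) = trans (cong (λ z → + 1 * f (suc d) + z) (conv-zeroˡ f d))
    (trans (ℤₚ.+-identityʳ _) (ℤₚ.*-identityˡ _))

  conv-addˡ : ∀ a b f d → conv (λ i → a i + b i) f d ≡ conv a f d + conv b f d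
  conv-addˡ a b f zero    = ℤₚ.*-distribʳ-+ (f 0) (a 0) (b 0)
  conv-addˡ a b f (suc d) = trans (cong (λ z → (a 0 + b 0) * f (suc d) + z) (conv-addˡ (a ∘ suc) (b ∘ suc) f d))
    (lem (a 0) (b 0) (f (suc d)) (conv (a ∘ suc) f d) (conv (b ∘ suc) f d))
    where lem : ∀ x y z u v → (x + y) * z + (u + v) ≡ (x * z + u) + (y * z + v)
          lem = solve-∀

  conv-concentrated : ∀ a f d → (∀ i → 1 ≤ i → i ≤ d → f i ≡ + 0) → conv a f d ≡ a d * f 0
  conv-concentrated a f zero    z = refl
  conv-concentrated a f (suc d) z = trans
    (cong₂ _+_ (trans (cong (a 0 *_) (z (suc d) (s≤s z≤n) ℕₚ.≤-refl)) (ℤₚ.*-zeroʳ (a 0)))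
      (conv-concentrated (a ∘ suc) f d (λ i 1≤i i≤d → z i 1≤i (ℕₚ.m≤n⇒m≤1+n i≤d))))
    (ℤₚ.+-identityˡ _)

  -- The coefficients of t^δ / (1 - t^δ); the constant term is 0 although δ divides 0.
  multiples : ℕ → ℕ → ℕ
  multiples δ zero    = 0
  multiples δ (suc e) = indicator (δ ∣ₙ.∣? suc e)

  multiples-self : ∀ δ → 1 ≤ δ → multiples δ δ ≡ 1
  multiples-self (suc δ) _ = indicator-true (suc δ ∣ₙ.∣? suc δ) ∣ₙ.∣-refl

  multiples≤1 : ∀ δ e → multiples δ e ≤ 1
  multiples≤1 δ zero    = z≤n
  multiples≤1 δ (suc e) with δ ∣ₙ.∣? suc e
  ... | yes _ = ℕₚ.≤-refl
  ... | no  _ = z≤n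

  multiples-small : ∀ δ e → e < δ → multiples δ e ≡ 0
  multiples-small δ zero    lt = refl
  multiples-small δ (suc e) lt = indicator-false (δ ∣ₙ.∣? suc e) (∣ₙ.>⇒∤ lt)

  multiples-+ : ∀ δ e → 1 ≤ δ → + multiples δ (δ ℕ.+ e) ≡ unit e + + multiples δ e
  multiples-+ (suc δ) zero    _ = cong +_ (trans (cong (multiples (suc δ)) (ℕₚ.+-identityʳ (suc δ)))
    (multiples-self (suc δ) (s≤s z≤n)))
  multiples-+ (suc δ) (suc e) _ = trans (cong +_ (indicator-cong
      (suc δ ∣ₙ.∣? (suc δ ℕ.+ suc e)) (suc δ ∣ₙ.∣? suc e)
      (λ d → ∣ₙ.∣m+n∣m⇒∣n d ∣ₙ.∣-refl) (∣ₙ.∣m∣n⇒∣m+n ∣ₙ.∣-refl)))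
    (sym (ℤₚ.+-identityˡ _))

  -- The functional equation s = t^δ (1 + s), which takes the place of a division by 1 - t^δ.
  multiples-down : ∀ δ → 1 ≤ δ → ∀ e →
    + multiples δ e ≡ down δ (λ i → unit i + + multiples δ i) e
  multiples-down δ 1≤δ e with e ℕₚ.<? δ
  ... | yes e<δ = trans (cong +_ (multiples-small δ e e<δ)) (sym (down-small δ _ e e<δ))
  ... | no  e≮δ with ℕₚ.m≤n⇒∃[o]m+o≡n (ℕₚ.≮⇒≥ e≮δ)
  ...   | i , refl = trans (multiples-+ δ i 1≤δ) (sym (down-+ δ _ i))

  -- Since δ ≥ 1, the equation x = t^δ (h + x) determines each coefficient from a lower one; `n`
  -- bounds the descent.
  down-unique : ∀ δ → 1 ≤ δ → ∀ (h x y : Series) →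
    (∀ d → x d ≡ down δ (λ i → h i + x i) d) → (∀ d → y d ≡ down δ (λ i → h i + y i) d) →
    ∀ n d → d < n → x d ≡ y d
  down-unique δ 1≤δ h x y ex ey (suc n) d (s≤s d≤n) with d ℕₚ.<? δ
  ... | yes d<δ = trans (ex d) (trans (down-small δ _ d d<δ) (sym (trans (ey d) (down-small δ _ d d<δ))))
  ... | no  d≮δ with ℕₚ.m≤n⇒∃[o]m+o≡n (ℕₚ.≮⇒≥ d≮δ)
  ...   | i , refl = trans (ex d) (trans (down-+ δ _ i) (trans
      (cong (λ z → h i + z) (down-unique δ 1≤δ h x y ex ey n i (ℕₚ.<-≤-trans (ℕₚ.m<n+m i 1≤δ) d≤n)))
      (sym (trans (ey d) (down-+ δ _ i)))))

  -- The product rule for t d/dt applied to t^δ f.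
  down-weighted : ∀ δ f d → + d * down δ f d ≡ down δ (λ e → + e * f e) d + + δ * down δ f d
  down-weighted zero    f d       = sym (ℤₚ.+-identityʳ _)
  down-weighted (suc δ) f zero    = sym (trans (ℤₚ.+-identityˡ _) (ℤₚ.*-zeroʳ (+ suc δ)))
  down-weighted (suc δ) f (suc d) = trans (lem (+ d) x) (trans (cong (λ z → x + z) (down-weighted δ f d))
      (lem′ (+ δ) x (down δ (λ e → + e * f e) d)))
    where
    x = down δ f d
    lem : ∀ d x → (+ 1 + d) * x ≡ x + d * x
    lem = solve-∀
    lem′ : ∀ δ x y → x + (y + δ * x) ≡ y + (+ 1 + δ) * x
    lem′ = solve-∀

  -- Coefficients of ∏ (1 − t^δ) / (1 − q t).
  module Product (q : ℕ) where

    G : List ℕ → Series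
    G []       d = + (q ℕ.^ d)
    G (δ ∷ ds) d = G ds d - down δ (G ds) d

    -- For e ≥ 1 the sum of those δ in the list that divide e: the coefficient of t^e in - t d/dt
    -- log ∏ (1 - t^δ).
    σ : List ℕ → ℕ → ℕ
    σ []       e = 0
    σ (δ ∷ ds) e = δ ℕ.* multiples δ e ℕ.+ σ ds e

    -- The coefficients of q t / (1 - q t) = t d/dt log (1 / (1 - q t)).
    powers : Series
    powers zero    = + 0
    powers (suc e) = + (q ℕ.^ suc e)

    -- `x` is generalised because `conv` passes from x q^e to (x q) q^e when it drops a coefficient.
    conv-geometric : ∀ x d → conv (λ e → + (x ℕ.* q ℕ.^ e)) (λ d → + (q ℕ.^ d)) d ≡ + (suc d ℕ.* (x ℕ.* q ℕ.^ d))
    conv-geometric x zero    = trans (sym (ℤₚ.pos-* (x ℕ.* 1) 1))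
      (cong +_ (trans (ℕₚ.*-identityʳ _) (sym (ℕₚ.*-identityˡ (x ℕ.* 1)))))
    conv-geometric x (suc d) = trans (cong₂ _+_
        (trans (sym (ℤₚ.pos-* (x ℕ.* 1) (q ℕ.^ suc d))) (cong (λ z → + (z ℕ.* q ℕ.^ suc d)) (ℕₚ.*-identityʳ x)))
        (trans (conv-congˡ _ (λ e → cong +_ (sym (ℕₚ.*-assoc x q (q ℕ.^ e)))) d) (conv-geometric (x ℕ.* q) d)))
      (trans (sym (ℤₚ.pos-+ (x ℕ.* q ℕ.^ suc d) _))
        (cong (λ z → + (x ℕ.* q ℕ.^ suc d ℕ.+ suc d ℕ.* z)) (ℕₚ.*-assoc x q (q ℕ.^ d))))

    -- Logarithmic derivative of the product.
    newton : ∀ ds → All (1 ≤_) ds → ∀ d →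
      + d * G ds d ≡ conv (λ e → powers e - + σ ds e) (G ds) d
    newton [] [] d = trans (base d) (conv-congˡ _ (λ e → sym (ℤₚ.+-identityʳ (powers e))) d)
      where
      base : ∀ d → + d * + (q ℕ.^ d) ≡ conv powers (λ d → + (q ℕ.^ d)) d
      base zero    = refl
      base (suc d) = sym (trans (ℤₚ.+-identityˡ _) (trans (conv-geometric q d) (ℤₚ.pos-* (suc d) (q ℕ.^ suc d))))
    newton (δ ∷ ds) (1≤δ ∷ pos) d = begin
      + d * (g d - down δ g d)
        ≡⟨ expand (+ d) (g d) (down δ g d) ⟩
      + d * g d - + d * down δ g d
        ≡⟨ cong₂ _-_ (newton ds pos d) (trans (down-weighted δ g d) (cong₂ _+_ (trans (down-cong δ (newton ds pos) d) (sym (conv-downʳ δ a g d))) (cong (+ δ *_) (sym (fix d))))) ⟩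
      conv a g d - (conv a (down δ g) d + + δ * conv s h d)
        ≡⟨ regroup (conv a g d) (conv a (down δ g) d) _ ⟩
      (conv a g d - conv a (down δ g) d) - + δ * conv s h d
        ≡⟨ cong₂ _-_ (sym (conv-subʳ a g (down δ g) d)) (sym (conv-scaleˡ (+ δ) s h d)) ⟩
      conv a h d - conv (λ e → + δ * s e) h d
        ≡⟨ sym (conv-subˡ a (λ e → + δ * s e) h d) ⟩
      conv (λ e → a e - + δ * s e) h d
        ≡⟨ conv-congˡ h pointwise d ⟩
      conv (λ e → powers e - + σ (δ ∷ ds) e) h d ∎
      where
      open ≡-Reasoning
      g = G ds
      h = G (δ ∷ ds)
      a s : Series
      a e = powers e - + σ ds e
      s e = + multiples δ e
      expand : ∀ d x y → d * (x - y) ≡ d * x - d * y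
      expand = solve-∀
      regroup : ∀ x y z → x - (y + z) ≡ (x - y) - z
      regroup = solve-∀
      pointwise : ∀ e → a e - + δ * s e ≡ powers e - + σ (δ ∷ ds) e
      pointwise e = trans (regroup′ (powers e) (+ σ ds e) (+ δ * s e))
        (cong (powers e -_) (trans (cong (_+ + σ ds e) (sym (ℤₚ.pos-* δ (multiples δ e))))
          (sym (ℤₚ.pos-+ (δ ℕ.* multiples δ e) (σ ds e)))))
        where regroup′ : ∀ x y z → (x - y) - z ≡ x - (z + y)
              regroup′ = solve-∀
      -- Both series solve x = t^δ (h + x): the left one because s = t^δ (1 + s), the right one
      -- because g = h + t^δ g.
      fix : ∀ d → conv s h d ≡ down δ g d
      fix d = down-unique δ 1≤δ h (conv s h) (down δ g)
        (λ e → trans (conv-congˡ h (multiples-down δ 1≤δ) e) (trans (conv-downˡ δ _ h e)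
          (down-cong δ (λ i → trans (conv-addˡ unit s h i) (cong (_+ conv s h i) (conv-unitˡ h i))) e)))
        (λ e → down-cong δ (λ i → sym (recombine (g i) (down δ g i))) e)
        (suc d) d ℕₚ.≤-refl
        where recombine : ∀ x y → (x - y) + y ≡ x
              recombine = solve-∀

  sumTo : (ℕ → ℕ) → ℕ → ℕ
  sumTo f zero    = 0
  sumTo f (suc k) = sumTo f k ℕ.+ f (suc k)

  sumTo-cong : ∀ {f g : ℕ → ℕ} k → (∀ e → 1 ≤ e → e ≤ k → f e ≡ g e) → sumTo f k ≡ sumTo g k
  sumTo-cong zero    e = refl
  sumTo-cong (suc k) e = cong₂ ℕ._+_ (sumTo-cong k λ i 1≤i i≤k → e i 1≤i (ℕₚ.m≤n⇒m≤1+n i≤k)) (e (suc k) (s≤s z≤n) ℕₚ.≤-refl)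

  sumTo-+ : ∀ f g k → sumTo (λ e → f e ℕ.+ g e) k ≡ sumTo f k ℕ.+ sumTo g k
  sumTo-+ f g zero    = refl
  sumTo-+ f g (suc k) = trans (cong (ℕ._+ (f (suc k) ℕ.+ g (suc k))) (sumTo-+ f g k))
    (interchange (sumTo f k) (sumTo g k) (f (suc k)) (g (suc k)))
    where open import Algebra.Properties.CommutativeSemigroup ℕₚ.+-commutativeSemigroup using (interchange)

  term≤sumTo : ∀ f k e → 1 ≤ e → e ≤ k → f e ≤ sumTo f k
  term≤sumTo f zero    (suc e) 1≤e ()
  term≤sumTo f (suc k) e 1≤e e≤1+k with ℕₚ.m≤n⇒m<n∨m≡n e≤1+k
  ... | inj₁ (s≤s e≤k) = ℕₚ.≤-trans (term≤sumTo f k e 1≤e e≤k) (ℕₚ.m≤m+n _ _)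
  ... | inj₂ refl = ℕₚ.m≤n+m _ _

  sumTo-powers< : ∀ q → 2 ≤ q → ∀ k → sumTo (q ℕ.^_) k < q ℕ.^ suc k
  sumTo-powers< q 2≤q zero    = ℕₚ.≤-trans (ℕₚ.≤-trans (s≤s z≤n) 2≤q) (ℕₚ.≤-reflexive (sym (ℕₚ.*-identityʳ q)))
  sumTo-powers< q 2≤q (suc k) = begin-strict
    sumTo (q ℕ.^_) k ℕ.+ q ℕ.^ suc k   <⟨ ℕₚ.+-monoˡ-< (q ℕ.^ suc k) (sumTo-powers< q 2≤q k) ⟩
    q ℕ.^ suc k ℕ.+ q ℕ.^ suc k        ≡⟨ cong (q ℕ.^ suc k ℕ.+_) (sym (ℕₚ.+-identityʳ _)) ⟩
    2 ℕ.* q ℕ.^ suc k                  ≤⟨ ℕₚ.*-monoˡ-≤ (q ℕ.^ suc k) 2≤q ⟩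
    q ℕ.^ suc (suc k)                  ∎
    where open ℕₚ.≤-Reasoning

  -- If the product vanished in all degrees 1, …, k, the identity σ(e) = q^e would hold there; but every
  -- δ contributes to σ(δ) already, so that σ(k) ≤ q + … + q^(k-1) < q^k.
  product-coefficient≢0 : ∀ q → 2 ≤ q → ∀ ds k → All (λ δ → 1 ≤ δ × δ ≤ k) ds →
    let open Product q in
    G ds 0 ≡ + 1 → (∀ e → 1 ≤ e → e ≤ k → G ds e ≡ + 0) → ¬ G ds (suc k) ≡ + 0
  product-coefficient≢0 q 2≤q ds k range G0 vanish Gk = ℕₚ.<-irrefl (σ≡ (suc k) (s≤s z≤n) ℕₚ.≤-refl)
    (ℕₚ.≤-<-trans (ℕₚ.≤-trans (σ≤sum ds (suc k)) (sum≤ ds range))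
      (subst (_< q ℕ.^ suc k) (sym (sumTo-cong k (λ e 1≤e e≤k → σ≡ e 1≤e (ℕₚ.m≤n⇒m≤1+n e≤k)))) (sumTo-powers< q 2≤q k)))
    where
    open Product q
    all-vanish : ∀ e → 1 ≤ e → e ≤ suc k → G ds e ≡ + 0
    all-vanish e 1≤e e≤1+k with ℕₚ.m≤n⇒m<n∨m≡n e≤1+k
    ... | inj₁ (s≤s e≤k) = vanish e 1≤e e≤k
    ... | inj₂ refl = Gk
    positives : ∀ {es} → All (λ δ → 1 ≤ δ × δ ≤ k) es → All (1 ≤_) es
    positives []              = []
    positives ((1≤δ , _) ∷ r) = 1≤δ ∷ positives r
    -- With `G ds` concentrated in degree 0 on this range, the derivative identity reads 0 = q^e -
    -- σ(e).
    σ≡ : ∀ e → 1 ≤ e → e ≤ suc k → σ ds e ≡ q ℕ.^ e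
    σ≡ (suc e) 1≤e e≤k = sym (ℤₚ.+-injective (ℤₚ.i-j≡0⇒i≡j _ _ (begin
      powers (suc e) - + σ ds (suc e)              ≡⟨ sym (ℤₚ.*-identityʳ _) ⟩
      (powers (suc e) - + σ ds (suc e)) * + 1      ≡⟨ cong ((powers (suc e) - + σ ds (suc e)) *_) (sym G0) ⟩
      (powers (suc e) - + σ ds (suc e)) * G ds 0
        ≡⟨ sym (conv-concentrated (λ i → powers i - + σ ds i) (G ds) (suc e) (λ i 1≤i i≤e → all-vanish i 1≤i (ℕₚ.≤-trans i≤e e≤k))) ⟩
      conv (λ i → powers i - + σ ds i) (G ds) (suc e)   ≡⟨ sym (newton ds (positives range) (suc e)) ⟩
      + suc e * G ds (suc e)                       ≡⟨ cong (+ suc e *_) (all-vanish (suc e) 1≤e e≤k) ⟩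
      + suc e * + 0                                ≡⟨ ℤₚ.*-zeroʳ (+ suc e) ⟩
      + 0                                          ∎)))
      where open ≡-Reasoning
    σ≤sum : ∀ es e → σ es e ≤ ListAction.sum es
    σ≤sum []       e = z≤n
    σ≤sum (δ ∷ es) e = ℕₚ.+-mono-≤
      (ℕₚ.≤-trans (ℕₚ.*-monoʳ-≤ δ (multiples≤1 δ e)) (ℕₚ.≤-reflexive (ℕₚ.*-identityʳ δ))) (σ≤sum es e)
    sum≤ : ∀ es → All (λ δ → 1 ≤ δ × δ ≤ k) es → ListAction.sum es ≤ sumTo (σ es) k
    sum≤ []       []                = z≤n
    sum≤ (δ ∷ es) ((1≤δ , δ≤k) ∷ r) = ℕₚ.≤-trans
      (ℕₚ.+-mono-≤ (ℕₚ.≤-trans (ℕₚ.≤-reflexive (sym (trans (cong (δ ℕ.*_) (multiples-self δ 1≤δ)) (ℕₚ.*-identityʳ δ))))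
        (term≤sumTo (λ e → δ ℕ.* multiples δ e) k δ 1≤δ δ≤k)) (sum≤ es r))
      (ℕₚ.≤-reflexive (sym (sumTo-+ (λ e → δ ℕ.* multiples δ e) (σ es) k)))

-- Irreducible polynomials of every positive degree

module Existence {c ℓ} (F : Field c ℓ) (q : ℕ) (size : HasSize F q)
                 (_≈?_ : ∀ x y → Dec (Field._≈_ F x y)) (2≤q : 2 ≤ q) where
  open ℤSolver using (solve-∀)
  open Field F using (commutativeRing)
  open Polynomial commutativeRing
  open Irreducibility F _≈?_
  open Sieve F q size _≈?_
  open Prime using (degree; poly)
  open PowerSeries using (down; down-small; down-+; product-coefficient≢0; module Product)
  open Product q using (G)

  -- A prime put in front must be divisible by no prime already listed; this is the hypothesis of
  -- `count-step`.
  data Coprime : List Prime → Set (c ⊔ ℓ) where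
    []  : Coprime []
    _∷_ : ∀ {P ps} → Survives ps (poly P) → Coprime ps → Coprime (P ∷ ps)

  -- Below deg P and from there on, `count-small` and `count-step` are the two cases of
  -- multiplication by 1 - t^(deg P).
  count≡G : ∀ {ps} → Coprime ps → ∀ d → ℤ.+ count ps d ≡ G (map degree ps) d
  count≡G []                       d = ≡.cong ℤ.+_ (count-[] d)
  count≡G (_∷_ {P} {ps} coprime cs) d with d ℕₚ.<? degree P
  ... | yes d<δ = ≡.trans (≡.cong ℤ.+_ (count-small P ps d d<δ)) (≡.trans (count≡G cs d)
        (≡.sym (≡.trans (≡.cong (λ z → G (map degree ps) d ℤ.- z) (down-small (degree P) _ d d<δ)) (ℤₚ.+-identityʳ _))))
  ... | no  d≮δ with ℕₚ.m≤n⇒∃[o]m+o≡n (ℕₚ.≮⇒≥ d≮δ)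
  ...   | e , ≡.refl = ≡.trans (isolate (ℤ.+ count (P ∷ ps) (degree P ℕ.+ e)) (ℤ.+ count ps e))
          (≡.cong₂ ℤ._-_
            (≡.trans (≡.sym (ℤₚ.pos-+ (count (P ∷ ps) (degree P ℕ.+ e)) (count ps e))) (≡.trans (≡.cong ℤ.+_ (≡.sym (count-step P ps e coprime))) (count≡G cs _)))
            (≡.trans (count≡G cs e) (≡.sym (down-+ (degree P) _ e))))
    where isolate : ∀ x y → x ≡ (x ℤ.+ y) ℤ.- y
          isolate = solve-∀

  -- The only monic multiple of P in its own degree is P itself, the case e = 0 of `count-step`.
  count-remove : ∀ P ps {d} → degree P ≡ d → Survives ps (poly P) → count ps d ≡ suc (count (P ∷ ps) d)
  count-remove P ps {d} ≡.refl s = begin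
    count ps d                                 ≡⟨ ≡.cong (count ps) (≡.sym (ℕₚ.+-identityʳ d)) ⟩
    count ps (d ℕ.+ 0)                         ≡⟨ count-step P ps 0 s ⟩
    count (P ∷ ps) (d ℕ.+ 0) ℕ.+ count ps 0    ≡⟨ ≡.cong₂ (λ x y → count (P ∷ ps) x ℕ.+ y) (ℕₚ.+-identityʳ d) (count-0 ps) ⟩
    count (P ∷ ps) d ℕ.+ 1                     ≡⟨ ℕₚ.+-comm (count (P ∷ ps) d) 1 ⟩
    suc (count (P ∷ ps) d)                     ∎
    where open ≡.≡-Reasoning

  survivor⇒1≤count : ∀ ps d f → Monic d f → Survives ps f → count ps d ≢ 0
  survivor⇒1≤count ps d f mf s count≡0 = contradiction
    (≡.trans (≡.sym (sum≡0 _ (≡.trans (≡.sym (count-def ps d)) count≡0) (encode d f)))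
      (indicator-true (survives? ps (decode d (encode d f)))
        (survives-~ ps (~-sym (decode-encode d f mf)) s))) λ ()

  find-survivor : ∀ ps d → count ps d ≢ 0 → ∃ λ f → Monic d f × Survives ps f
  find-survivor ps d ne with sum≢0 _ (λ e → ne (≡.trans (count-def ps d) e))
  ... | i , ind≢0 with survives? ps (decode d i)
  ...   | yes s = decode d i , decode-monic d i , s
  ...   | no ¬s = contradiction ≡.refl ind≢0

  -- A proper monic factor of a survivor would be a survivor of lower positive degree, where none is
  -- left.
  survivor-irreducible : ∀ ps d {f} → (∀ e → 1 ≤ e → e ≤ d → count ps e ≡ 0) →
    Monic (suc d) f → Survives ps f → Irreducible (suc d) f
  survivor-irreducible ps d vanish mf s = record
    { monic = mf ; positive = s≤s z≤n
    ; no-factor = λ {e} {g} 1≤e e<d mg g∣f →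
        survivor⇒1≤count ps e g mg (survives-factor ps g∣f s) (vanish e 1≤e (ℕₚ.≤-pred e<d)) }

  -- Zero counts in the degrees 1, ..., d express that the list is complete up to degree d: every
  -- monic polynomial of such a degree has a factor in it.
  record Stage (d : ℕ) : Set (c ⊔ ℓ) where
    field
      primes  : List Prime
      coprime : Coprime primes
      bounded : All (λ P → degree P ≤ d) primes
      vanish  : ∀ e → 1 ≤ e → e ≤ d → count primes e ≡ 0

  -- Each new irreducible of degree d + 1 removes exactly itself from the survivors of that degree.
  exhaust : ∀ d n ps → Coprime ps → All (λ P → degree P ≤ suc d) ps →
    (∀ e → 1 ≤ e → e ≤ d → count ps e ≡ 0) → count ps (suc d) ≡ n → Stage (suc d)
  exhaust d zero ps cs bs vanish eq = record
    { primes = ps ; coprime = cs ; bounded = bs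
    ; vanish = λ e 1≤e e≤1+d → [ (λ e<1+d → vanish e 1≤e (ℕₚ.≤-pred e<1+d))
                               , (λ { ≡.refl → eq }) ]′ (ℕₚ.m≤n⇒m<n∨m≡n e≤1+d) }
  exhaust d (suc n) ps cs bs vanish eq = add (find-survivor ps (suc d) (λ e → contradiction (≡.trans (≡.sym eq) e) λ ()))
    where
    add : (∃ λ f → Monic (suc d) f × Survives ps f) → Stage (suc d)
    add (f , mf , s) = exhaust d n (P ∷ ps) (s ∷ cs) (ℕₚ.≤-refl ∷ bs)
      (λ e 1≤e e≤d → ≡.trans (count-small P ps e (s≤s e≤d)) (vanish e 1≤e e≤d))
      (ℕₚ.suc-injective (≡.trans (≡.sym (count-remove P ps ≡.refl s)) eq))
      where
      P : Prime
      P = mkPrime {suc d} {f} (survivor-irreducible ps d vanish mf s)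

  stage : ∀ d → Stage d
  stage zero = record
    { primes = [] ; coprime = [] ; bounded = []
    ; vanish = λ e 1≤e e≤0 → contradiction (ℕₚ.≤-trans 1≤e e≤0) λ () }
  stage (suc d) with stage d
  ... | record { primes = ps ; coprime = cs ; bounded = bs ; vanish = v } =
    exhaust d _ ps cs (All.map ℕₚ.m≤n⇒m≤1+n bs) v ≡.refl

  stage-count≢0 : ∀ {d} (S : Stage d) → count (Stage.primes S) (suc d) ≢ 0
  stage-count≢0 {d} S eq = product-coefficient≢0 q 2≤q (map degree primes) d
    (Allₚ.map⁺ (All.map (λ {P} le → Prime.positive P , le) bounded))
    (≡.trans (≡.sym (count≡G coprime 0)) (≡.cong ℤ.+_ (count-0 primes)))
    (λ e 1≤e e≤d → ≡.trans (≡.sym (count≡G coprime e)) (≡.cong ℤ.+_ (vanish e 1≤e e≤d)))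
    (≡.trans (≡.sym (count≡G coprime (suc d))) (≡.cong ℤ.+_ eq))
    where open Stage S

  irreducible-of-degree : ∀ d → ∃ λ f → Irreducible (suc d) f
  irreducible-of-degree d = f , survivor-irreducible (Stage.primes S) d (Stage.vanish S) mf s
    where
    S = stage d
    survivor = find-survivor (Stage.primes S) (suc d) (stage-count≢0 S)
    f = proj₁ survivor
    mf = proj₁ (proj₂ survivor)
    s = proj₂ (proj₂ survivor)

-- Linear combinations, dependence and dimension

module LinearAlgebra {c ℓ} (F : Field c ℓ) (_≈?_ : ∀ x y → Dec (Field._≈_ F x y)) where
  open Field F hiding (zero)
  open LinAlg F
  open import Algebra.Properties.Ring ring using (-0#≈0#; -‿distribˡ-*; -‿distribʳ-*; -‿+-comm)
  open import Algebra.Properties.CommutativeSemigroup +-commutativeSemigroup using (interchange)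

  sumF-cong : ∀ {k} {f g : Fin k → Carrier} → (∀ i → f i ≈ g i) → sumF f ≈ sumF g
  sumF-cong {zero}  e = refl
  sumF-cong {suc k} e = +-cong (e zero) (sumF-cong (e ∘ suc))

  sumF-0 : ∀ {k} {f : Fin k → Carrier} → (∀ i → f i ≈ 0#) → sumF f ≈ 0#
  sumF-0 {zero}  e = refl
  sumF-0 {suc k} e = trans (+-cong (e zero) (sumF-0 (e ∘ suc))) (+-identityˡ 0#)

  sumF-+ : ∀ {k} (f g : Fin k → Carrier) → sumF (λ i → f i + g i) ≈ sumF f + sumF g
  sumF-+ {zero}  f g = sym (+-identityˡ 0#)
  sumF-+ {suc k} f g = trans (+-congˡ (sumF-+ (f ∘ suc) (g ∘ suc))) (interchange _ _ _ _)

  sumF-*ˡ : ∀ {k} a (f : Fin k → Carrier) → sumF (λ i → a * f i) ≈ a * sumF f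
  sumF-*ˡ {zero}  a f = sym (zeroʳ a)
  sumF-*ˡ {suc k} a f = trans (+-congˡ (sumF-*ˡ a (f ∘ suc))) (sym (distribˡ a _ _))

  sumF-*ʳ : ∀ {k} a (f : Fin k → Carrier) → sumF (λ i → f i * a) ≈ sumF f * a
  sumF-*ʳ a f = trans (sumF-cong (λ i → *-comm (f i) a)) (trans (sumF-*ˡ a f) (*-comm a _))

  sumF-swap : ∀ {k l} (f : Fin k → Fin l → Carrier) →
    sumF (λ i → sumF (f i)) ≈ sumF (λ j → sumF (λ i → f i j))
  sumF-swap {zero} {l} f = sym (sumF-0 {l} (λ _ → refl))
  sumF-swap {suc k} f = trans (+-congˡ (sumF-swap (f ∘ suc))) (sym (sumF-+ (f zero) _))

  sumF-single : ∀ {k} (f : Fin k → Carrier) j → (∀ i → i ≢ j → f i ≈ 0#) → sumF f ≈ f j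
  sumF-single f zero    e = trans (+-congˡ (sumF-0 (λ i → e (suc i) λ ()))) (+-identityʳ _)
  sumF-single f (suc j) e = trans
    (+-cong (e zero λ ()) (sumF-single (f ∘ suc) j λ i ne → e (suc i) (ne ∘ Finₚ.suc-injective))) (+-identityˡ _)

  δ : ∀ {k} → Fin k → Fin k → Carrier
  δ i j with i Fin.≟ j
  ... | yes _ = 1#
  ... | no  _ = 0#

  δ-≡ : ∀ {k} {i j : Fin k} → i ≡ j → δ i j ≈ 1#
  δ-≡ {i = i} {j} e with i Fin.≟ j
  ... | yes _ = refl
  ... | no ne = contradiction e ne

  δ-≢ : ∀ {k} {i j : Fin k} → i ≢ j → δ i j ≈ 0#
  δ-≢ {i = i} {j} ne with i Fin.≟ j
  ... | yes e = contradiction e ne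
  ... | no  _ = refl

  sumF-δ : ∀ {k} (f : Fin k → Carrier) j → sumF (λ i → f i * δ i j) ≈ f j
  sumF-δ f j = trans (sumF-single _ j (λ i ne → trans (*-congˡ (δ-≢ ne)) (zeroʳ _)))
    (trans (*-congˡ (δ-≡ {i = j} ≡.refl)) (*-identityʳ _))

  module _ {I : Set} where

    lincomb-congˡ : ∀ {k} {cs ds : Fin k → Carrier} (b : Fin k → Vect I) →
      (∀ j → cs j ≈ ds j) → lincomb cs b ≈v lincomb ds b
    lincomb-congˡ b e i = sumF-cong (λ j → *-congʳ (e j))

    lincomb-congʳ : ∀ {k} (cs : Fin k → Carrier) {b b′ : Fin k → Vect I} →
      (∀ j → b j ≈v b′ j) → lincomb cs b ≈v lincomb cs b′
    lincomb-congʳ cs e i = sumF-cong (λ j → *-congˡ (e j i))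

    lincomb-lincomb : ∀ {k l} (cs : Fin k → Carrier) (d : Fin k → Fin l → Carrier) (g : Fin l → Vect I) →
      lincomb cs (λ j → lincomb (d j) g) ≈v lincomb (lincomb cs d) g
    lincomb-lincomb {k} {l} cs d g i = begin
      sumF {k} (λ j → cs j * sumF (λ l → d j l * g l i))         ≈⟨ sumF-cong {k} (λ j → sym (sumF-*ˡ {l} (cs j) _)) ⟩
      sumF {k} (λ j → sumF {l} (λ l → cs j * (d j l * g l i)))   ≈⟨ sumF-swap {k} {l} _ ⟩
      sumF {l} (λ l → sumF {k} (λ j → cs j * (d j l * g l i)))
        ≈⟨ sumF-cong {l} (λ l → trans (sumF-cong {k} (λ j → sym (*-assoc _ _ _))) (sumF-*ʳ {k} (g l i) _)) ⟩
      sumF {l} (λ l → sumF {k} (λ j → cs j * d j l) * g l i)     ∎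
      where open SetoidReasoning setoid

    span-lincomb : ∀ {k l} (cs : Fin k → Carrier) (g : Fin l → Vect I) (b : Fin k → Vect I) →
      (∀ j → span g (b j)) → span g (lincomb cs b)
    span-lincomb cs g b b∈ = lincomb cs (λ j → proj₁ (b∈ j)) , λ i → trans
      (lincomb-congʳ cs (λ j → proj₂ (b∈ j)) i) (lincomb-lincomb cs (λ j → proj₁ (b∈ j)) g i)

    generator∈span : ∀ {l} (g : Fin l → Vect I) j → span g (g j)
    generator∈span {l} g j = (λ i → δ i j) , λ x →
      sym (trans (sumF-cong {l} (λ i → *-comm _ _)) (sumF-δ (λ i → g i x) j))

    span-subspace : ∀ {l} (g : Fin l → Vect I) → IsSubspace (span g)
    span-subspace {l} g = record
      { resp  = λ u≈v (cs , e) → cs , λ i → trans (sym (u≈v i)) (e i)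
      ; zero∈ = (λ _ → 0#) , λ i → sym (sumF-0 {l} (λ j → zeroˡ _))
      ; +∈    = λ (cs , e) (ds , d) → (λ j → cs j + ds j) , λ i → trans (+-cong (e i) (d i))
                  (sym (trans (sumF-cong {l} (λ j → distribʳ _ _ _)) (sumF-+ {l} _ _)))
      ; ·∈    = λ a (cs , e) → (λ j → a * cs j) , λ i → trans (*-congˡ (e i))
                  (sym (trans (sumF-cong {l} (λ j → *-assoc _ _ _)) (sumF-*ˡ {l} a _))) }

    span-dim : ∀ {l} (g : Fin l → Vect I) → LinIndep g → HasDim (span g) l
    span-dim g ind = g , generator∈span g , ind , λ v v∈ → v∈

  search : ∀ {k} (v : Fin k → Carrier) → (∀ i → v i ≈ 0#) ⊎ ∃ λ i → ¬ v i ≈ 0#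
  search v with Finₚ.all? (λ i → v i ≈? 0#)
  ... | yes e = inj₁ e
  ... | no ne with Finₚ.¬∀⟶∃¬ _ _ (λ i → v i ≈? 0#) ne
  ...   | i , vi≉0 = inj₂ (i , vi≉0)

  Dependent : ∀ {e} {I : Set} → (Fin e → Vect I) → Set (c ⊔ ℓ)
  Dependent b = ∃ λ cs → (∃ λ j → ¬ cs j ≈ 0#) × lincomb cs b ≈v 0v

  1≉0 : ¬ 1# ≈ 0#
  1≉0 e = 0≉1 (sym e)

  zero-vector-dependent : ∀ {e} {I : Set} (b : Fin (suc e) → Vect I) → b zero ≈v 0v → Dependent b
  zero-vector-dependent {e} b b₀≈0 = cs , (zero , 1≉0) , λ i →
    trans (+-cong (trans (*-identityˡ _) (b₀≈0 i)) (sumF-0 {e} (λ j → zeroˡ _))) (+-identityˡ 0#)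
    where
    cs : _ → Carrier
    cs zero    = 1#
    cs (suc _) = 0#

  eliminated : ∀ {e l} → (Fin (suc e) → Vect (Fin (suc l))) → Fin (suc l) → Carrier → Fin e → Vect (Fin l)
  eliminated b i₀ y j i = b (suc j) (punchIn i₀ i) + - (b (suc j) i₀ * y * b zero (punchIn i₀ i))

  -- Gaussian elimination, one coordinate per step: a nonzero coordinate i₀ of the first vector
  -- clears that coordinate in the others, which then lose it. A dependence of the shortened vectors
  -- extends to the first vector by the coefficient `ds zero`.
  dependent : ∀ e l → l < e → (b : Fin e → Vect (Fin l)) → Dependent b
  dependent (suc e) zero    lt b = zero-vector-dependent b λ ()
  dependent (suc e) (suc l) (s≤s lt) b with search (b zero)
  ... | inj₁ b₀≈0 = zero-vector-dependent b b₀≈0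
  ... | inj₂ (i₀ , ne) with inverse _ ne
  ...   | y , by≈1 with dependent e l lt (eliminated b i₀ y)
  ...     | cs , (j , cj≉0) , eq = ds , (suc j , cj≉0) , vanish
    where
    ratio : Fin e → Carrier
    ratio j = b (suc j) i₀ * y
    ds : Fin (suc e) → Carrier
    ds zero    = - sumF (λ j → cs j * ratio j)
    ds (suc j) = cs j
    eliminate : ∀ i → lincomb ds b i ≈ sumF (λ j → cs j * (b (suc j) i + - (ratio j * b zero i)))
    eliminate i = sym (begin
      sumF {e} (λ j → cs j * (b (suc j) i + - (ratio j * b zero i)))
        ≈⟨ sumF-cong {e} (λ j → trans (distribˡ _ _ _) (+-congˡ (trans (*-congˡ (-‿distribˡ-* (ratio j) (b zero i)))
             (trans (sym (*-assoc _ _ _)) (*-congʳ (sym (-‿distribʳ-* (cs j) (ratio j)))))))) ⟩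
      sumF {e} (λ j → cs j * b (suc j) i + - (cs j * ratio j) * b zero i)
        ≈⟨ sumF-+ {e} _ _ ⟩
      sumF {e} (λ j → cs j * b (suc j) i) + sumF {e} (λ j → - (cs j * ratio j) * b zero i)
        ≈⟨ +-comm _ _ ⟩
      sumF {e} (λ j → - (cs j * ratio j) * b zero i) + sumF {e} (λ j → cs j * b (suc j) i)
        ≈⟨ +-congʳ (trans (sumF-*ʳ {e} (b zero i) _) (*-congʳ (sumF-neg (λ j → cs j * ratio j)))) ⟩
      lincomb ds b i ∎)
      where
      open SetoidReasoning setoid
      sumF-neg : ∀ {k} (f : Fin k → Carrier) → sumF (λ j → - f j) ≈ - sumF f
      sumF-neg {zero}  f = sym -0#≈0#
      sumF-neg {suc k} f = trans (+-congˡ (sumF-neg (f ∘ suc))) (-‿+-comm _ _)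
    pivot : ∀ j → b (suc j) i₀ + - (ratio j * b zero i₀) ≈ 0#
    pivot j = trans (+-congˡ (-‿cong (trans (*-assoc _ _ _)
      (trans (*-congˡ (trans (*-comm _ _) by≈1)) (*-identityʳ _))))) (-‿inverseʳ _)
    vanish : ∀ i → lincomb ds b i ≈ 0#
    vanish i with i₀ Fin.≟ i
    ... | yes ≡.refl = trans (eliminate i) (sumF-0 {e} (λ j → trans (*-congˡ (pivot j)) (zeroʳ _)))
    ... | no ne′ = ≡.subst (λ x → lincomb ds b x ≈ 0#) (Finₚ.punchIn-punchOut ne′)
      (trans (eliminate (punchIn i₀ (punchOut ne′))) (eq (punchOut ne′)))

  module _ {I : Set} where

    -- Steinitz's bound: more than l coefficient vectors in F^l are dependent, and the dependence
    -- carries over to `b`.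
    independent-in-span : ∀ {e l} (b : Fin e → Vect I) (g : Fin l → Vect I) →
      LinIndep b → (∀ j → span g (b j)) → e ≤ l
    independent-in-span {e} {l} b g ind b∈ with e ℕₚ.≤? l
    ... | yes le = le
    ... | no  nle with dependent e l (ℕₚ.≰⇒> nle) (λ j → proj₁ (b∈ j))
    ...   | cs , (j , cj≉0) , eq = contradiction (ind cs vanish j) cj≉0
      where
      vanish : lincomb cs b ≈v 0v
      vanish i = trans (lincomb-congʳ cs (λ j → proj₂ (b∈ j)) i)
        (trans (lincomb-lincomb cs (λ j → proj₁ (b∈ j)) g i)
          (sumF-0 (λ l → trans (*-congʳ (eq l)) (zeroˡ _))))

    -- Intersection of dimension at most 3, said without a basis of the intersection. For two
    -- 5-dimensional spaces this is subspace distance at least 4.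
    Apart : ∀ {k l} → (Fin k → Vect I) → (Fin l → Vect I) → Set (c ⊔ ℓ)
    Apart g g′ = ∀ e (b : Fin e → Vect I) → 4 ≤ e →
      (∀ j → span g (b j)) → (∀ j → span g′ (b j)) → ¬ LinIndep b

    Apart-sym : ∀ {k l} {g : Fin k → Vect I} {g′ : Fin l → Vect I} → Apart g g′ → Apart g′ g
    Apart-sym ap e b 4≤e b∈ b∈′ = ap e b 4≤e b∈′ b∈

    -- The three dimensions come with arbitrary bases; Steinitz gives a, b ≥ 5 and apartness gives e
    -- ≤ 3, so that a + b - 2 e ≥ 4.
    apart⇒distance : ∀ {g g′ : Fin 5 → Vect I} → LinIndep g → LinIndep g′ → Apart g g′ →
      DistAtLeast 4 (span g) (span g′)
    apart⇒distance {g} {g′} ind ind′ ap a b e (u , _ , _ , u-spans) (v , _ , _ , v-spans) (w , w∈ , w-ind , _) =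
      ℕₚ.∸-mono (ℕₚ.+-mono-≤ (independent-in-span g u ind (λ j → u-spans _ (generator∈span g j)))
                              (independent-in-span g′ v ind′ (λ j → v-spans _ (generator∈span g′ j))))
                 (ℕₚ.*-monoʳ-≤ 2 e≤3)
      where
      e≤3 : e ≤ 3
      e≤3 with e ℕₚ.≤? 3
      ... | yes le = le
      ... | no nle = contradiction w-ind (ap e w (ℕₚ.≰⇒> nle) (proj₁ ∘ w∈) (proj₂ ∘ w∈))

  record Linear {I J : Set} (X : Vect I → Vect J) : Set (c ⊔ ℓ) where
    field
      cong  : ∀ {u v} → u ≈v v → X u ≈v X v
      +-hom : ∀ u v → X (u +v v) ≈v (X u +v X v)
      ·-hom : ∀ a v → X (a ·v v) ≈v (a ·v X v)

  -- The sum r₀ + X r₁ + X² r₂ + ... in Horner form.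
  horner : ∀ {k n} → (Vect (Fin k) → Vect (Fin k)) → (Fin n → Vect (Fin k)) → Vect (Fin k)
  horner {n = zero}  X r = 0v
  horner {n = suc n} X r = r zero +v X (horner X (r ∘ suc))

  -- What the codes use of multiplication by x on a field of degree k: a polynomial in X with at
  -- most k coefficients, not all zero, annihilates only the zero vector.
  record Multiplier (k : ℕ) : Set (c ⊔ ℓ) where
    field
      X           : Vect (Fin k) → Vect (Fin k)
      linear      : Linear X
      nonsingular : ∀ {n} → n ≤ k → ∀ (a : Fin n → Carrier) v → horner X (λ j → a j ·v v) ≈v 0v →
                    (∀ j → a j ≈ 0#) ⊎ v ≈v 0v

  -- Multiplication by x modulo an irreducible polynomial

  open Polynomial commutativeRing
  open Irreducibility F _≈?_

  poly : ∀ {k} → (Fin k → Carrier) → Poly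
  poly {zero}  v = []
  poly {suc k} v = v zero ∷ poly (v ∘ suc)

  coeff-poly : ∀ {k} (v : Fin k → Carrier) i → coeff (poly v) (toℕ i) ≈ v i
  coeff-poly v zero    = refl
  coeff-poly v (suc i) = coeff-poly (v ∘ suc) i

  Deg<-poly : ∀ {k} (v : Fin k → Carrier) → Deg< k (poly v)
  Deg<-poly {zero}  v i       le       = refl
  Deg<-poly {suc k} v (suc i) (s≤s le) = Deg<-poly (v ∘ suc) i le

  poly~[] : ∀ {k} (v : Fin k → Carrier) → poly v ~ [] → ∀ i → v i ≈ 0#
  poly~[] v e i = trans (sym (coeff-poly v i)) (at e (toℕ i))

  module Companion {k} (f : Poly) (irr : Irreducible (suc k) f) where
    open Irreducible irr

    -- Coordinates of x v modulo f in the basis 1, x, ..., x^k: the coefficient that reaches x^(k+1)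
    -- is removed by a multiple of the monic f.
    X : Vect (Fin (suc k)) → Vect (Fin (suc k))
    X v zero    = - (v (fromℕ k) * coeff f 0)
    X v (suc i) = v (inject₁ i) + - (v (fromℕ k) * coeff f (suc (toℕ i)))

    X-linear : Linear X
    X-linear = record { cong = X-cong ; +-hom = X-+ ; ·-hom = X-· }
      where
      neg-distrib : ∀ x y z → - ((x + y) * z) ≈ - (x * z) + - (y * z)
      neg-distrib x y z = trans (-‿cong (distribʳ z x y)) (sym (-‿+-comm _ _))
      neg-scale : ∀ a x z → - ((a * x) * z) ≈ a * - (x * z)
      neg-scale a x z = trans (-‿cong (*-assoc a x z)) (-‿distribʳ-* a _)
      X-cong : ∀ {u v} → u ≈v v → X u ≈v X v
      X-cong e zero    = -‿cong (*-congʳ (e _))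
      X-cong e (suc i) = +-cong (e _) (-‿cong (*-congʳ (e _)))
      X-+ : ∀ u v → X (u +v v) ≈v (X u +v X v)
      X-+ u v zero    = neg-distrib _ _ _
      X-+ u v (suc i) = trans (+-congˡ (neg-distrib _ _ _)) (interchange _ _ _ _)
      X-· : ∀ a v → X (a ·v v) ≈v (a ·v X v)
      X-· a v zero    = neg-scale _ _ _
      X-· a v (suc i) = trans (+-congˡ (neg-scale _ _ _)) (sym (distribˡ a _ _))

    -- The coordinate formula for `X` as a polynomial identity x v = X v + l f. The degrees up to k,
    -- the degree k + 1 and those beyond are checked separately, since at k + 1 the leading 1 of f
    -- enters.
    shift-poly : ∀ v → 0# ∷ poly v ~ poly (X v) ⊕ v (fromℕ k) ⊙ f
    shift-poly v .at i = trans (lhs≈ i) (sym (trans (coeff-⊕ (poly (X v)) _ i) (+-congˡ (coeff-⊙ l f i))))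
      where
      l = v (fromℕ k)
      rhs : ℕ → Carrier
      rhs i = coeff (poly (X v)) i + l * coeff f i
      cancel : ∀ x y → x ≈ (x + - y) + y
      cancel x y = sym (trans (+-assoc x _ y) (trans (+-congˡ (-‿inverseˡ y)) (+-identityʳ x)))
      small : ∀ (j : Fin (suc k)) → coeff (0# ∷ poly v) (toℕ j) ≈ rhs (toℕ j)
      small zero    = sym (-‿inverseˡ _)
      small (suc j) = begin
        coeff (poly v) (toℕ j)
          ≈⟨ reflexive (≡.cong (coeff (poly v)) (≡.sym (Finₚ.toℕ-inject₁ j))) ⟩
        coeff (poly v) (toℕ (inject₁ j))     ≈⟨ coeff-poly v (inject₁ j) ⟩
        v (inject₁ j)                        ≈⟨ cancel _ _ ⟩
        X v (suc j) + l * coeff f (toℕ (Fin.suc j))   ≈⟨ +-congʳ (sym (coeff-poly (X v) (suc j))) ⟩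
        rhs (toℕ (Fin.suc j))                ∎
        where open SetoidReasoning setoid
      large : ∀ i → suc k ≤ i → coeff (0# ∷ poly v) i ≈ rhs i
      large (suc i) (s≤s k≤i) with ℕₚ.m≤n⇒m<n∨m≡n k≤i
      ... | inj₁ k<i = trans (Deg<-poly v i k<i)
        (sym (trans (+-cong (Deg<-poly (X v) (suc i) (s≤s k≤i)) (trans (*-congˡ (proj₁ monic (suc i) (s≤s k<i))) (zeroʳ l))) (+-identityˡ 0#)))
      ... | inj₂ ≡.refl = trans
        (trans (reflexive (≡.cong (coeff (poly v)) (≡.sym (Finₚ.toℕ-fromℕ k)))) (coeff-poly v (fromℕ k)))
        (sym (trans (+-cong (Deg<-poly (X v) (suc k) ℕₚ.≤-refl) (trans (*-congˡ (proj₂ monic)) (*-identityʳ l))) (+-identityˡ l)))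
      lhs≈ : ∀ i → coeff (0# ∷ poly v) i ≈ rhs i
      lhs≈ i with i ℕₚ.<? suc k
      ... | yes lt = ≡.subst (λ x → coeff (0# ∷ poly v) x ≈ rhs x) (Finₚ.toℕ-fromℕ< lt) (small (fromℕ< lt))
      ... | no nlt = large i (ℕₚ.≮⇒≥ nlt)

    poly-+v : ∀ {k} (u v : Vect (Fin k)) → poly (u +v v) ~ poly u ⊕ poly v
    poly-+v {zero}  u v = ~-sym (⊕-identityˡ [])
    poly-+v {suc k} u v = ~-trans (shift-cong (poly-+v (u ∘ suc) (v ∘ suc))) (~-sym (∷-⊕ _ _ _ _))

    poly-·v : ∀ {k} a (v : Vect (Fin k)) → poly (a ·v v) ~ a ⊙ poly v
    poly-·v {zero}  a v = ~-sym (⊙-[] a)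
    poly-·v {suc k} a v = ~-trans (shift-cong (poly-·v a (v ∘ suc))) (~-sym (∷-⊙ a _ _))

    -- Each Horner step reduces once modulo f; the quotient `h` collects the top coefficients that
    -- are cut off.
    reduce : ∀ {n} (a : Fin n → Carrier) v → ∃ λ h →
      poly a ⊗ poly v ~ poly (horner X (λ j → a j ·v v)) ⊕ f ⊗ h
    reduce {zero}  a v = [] , ~-trans ([]-⊗ _) (~-sym (~-trans
      (⊕-cong (zeros (suc k)) (⊗-zeroʳ f)) (⊕-identityʳ [])))
      where
      zeros : ∀ k → poly {k} 0v ~ []
      zeros zero    = ~-refl
      zeros (suc k) = ~-trans (shift-cong (zeros k)) 0∷[]
    reduce {suc n} a v with reduce (a ∘ suc) v
    ... | h , e = l ∷ h , (begin
      poly a ⊗ V                                             ≈⟨ ∷-⊗ (a zero) _ V ⟩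
      a zero ⊙ V ⊕ (0# ∷ (poly (a ∘ suc) ⊗ V))               ≈⟨ ⊕-cong ~-refl (~-trans (shift-cong e) (shift-⊕ _ _)) ⟩
      a zero ⊙ V ⊕ ((0# ∷ poly w) ⊕ (0# ∷ (f ⊗ h)))          ≈⟨ ⊕-cong ~-refl (⊕-cong (shift-poly w) ~-refl) ⟩
      a zero ⊙ V ⊕ ((poly (X w) ⊕ l ⊙ f) ⊕ (0# ∷ (f ⊗ h)))   ≈⟨ ⊕-cong ~-refl (⊕-assoc (poly (X w)) _ _) ⟩
      a zero ⊙ V ⊕ (poly (X w) ⊕ (l ⊙ f ⊕ (0# ∷ (f ⊗ h))))   ≈⟨ ~-sym (⊕-assoc (a zero ⊙ V) _ _) ⟩
      (a zero ⊙ V ⊕ poly (X w)) ⊕ (l ⊙ f ⊕ (0# ∷ (f ⊗ h)))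
        ≈⟨ ⊕-cong (~-sym (~-trans (poly-+v (a zero ·v v) (X w)) (⊕-cong (poly-·v (a zero) v) ~-refl))) (~-sym (⊗-∷ʳ f l h)) ⟩
      poly ((a zero ·v v) +v X w) ⊕ f ⊗ (l ∷ h) ∎)
      where
      open ~R
      V = poly v
      w = horner X (λ j → a (suc j) ·v v)
      l = w (fromℕ k)

    -- If the Horner sum is zero, f divides a(x) v(x), hence one of the factors, and both have
    -- degree below that of f.
    nonsingular : ∀ {n} → n ≤ suc k → ∀ (a : Fin n → Carrier) v → horner X (λ j → a j ·v v) ≈v 0v →
      (∀ j → a j ≈ 0#) ⊎ v ≈v 0v
    nonsingular n≤k a v e with reduce a v
    ... | h , eq = [ (λ d → inj₁ (poly~[] a (∣-small monic d (Deg<-weaken (poly a) n≤k (Deg<-poly a)))))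
                   , (λ d → inj₂ (poly~[] v (∣-small monic d (Deg<-poly v)))) ]′
        (euclid irr (poly a) (poly v) (divides h (~-trans eq (~-trans (⊕-cong zero~ ~-refl) (⊕-identityˡ _)))))
      where
      zero~ : poly (horner X (λ j → a j ·v v)) ~ []
      zero~ .at i with i ℕₚ.<? suc k
      ... | yes lt = ≡.subst (λ x → coeff (poly w) x ≈ 0#) (Finₚ.toℕ-fromℕ< lt) (trans (coeff-poly w (fromℕ< lt)) (e (fromℕ< lt)))
        where w = horner X (λ j → a j ·v v)
      ... | no nlt = Deg<-poly (horner X (λ j → a j ·v v)) i (ℕₚ.≮⇒≥ nlt)

    multiplier : Multiplier (suc k)
    multiplier = record { X = X ; linear = X-linear ; nonsingular = nonsingular }

-- Matrices in echelon form with pivot columns p j: the entries outside the pivot columns live in the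
-- columns ι x; row 0 may occupy all of them, row j + 1 only the columns ι (pos j y). The free entries
-- of the rows 1, …, 4 are read off a single parameter vector indexed by Fin W.
record Frame (n : ℕ) : Set where
  field
    p   : Fin 5 → Fin n
    k   : ℕ
    ι   : Fin k → Fin n
    w   : Fin 4 → ℕ
    pos : ∀ j → Fin (w j) → Fin k
    W   : ℕ
    emb : ∀ j → Fin (w j) → Fin W

record IsFrame {n} (fr : Frame n) : Set where
  open Frame fr
  field
    p-injective   : Injective _≡_ _≡_ p
    ι-injective   : Injective _≡_ _≡_ ι
    pos-injective : ∀ j → Injective _≡_ _≡_ (pos j)
    p≢ι           : ∀ j x → p j ≢ ι x
    p₀<ι          : ∀ x → p zero Fin.< ι x
    p<pos         : ∀ j y → p (suc j) Fin.< ι (pos j y)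
    emb-covers    : ∀ x → ∃₂ λ j y → emb j y ≡ x
    5≤k           : 5 ≤ k

-- Generators in echelon form and the code of a frame

module EchelonCodes {c ℓ} (F : Field c ℓ) (_≈?_ : ∀ x y → Dec (Field._≈_ F x y)) where
  open Field F hiding (zero)
  open LinAlg F
  open LinearAlgebra F _≈?_
  open import Algebra.Properties.Ring ring using (-‿distribˡ-*; -1*x≈-x)
  open import Algebra.Properties.Group +-group using (∙-cancelʳ)
  open import Algebra.Properties.CommutativeSemigroup +-commutativeSemigroup using (interchange)
  open import Algebra.Properties.CommutativeSemigroup *-commutativeSemigroup using (x∙yz≈y∙xz)
  open Linear

  Linear-id : ∀ {I : Set} → Linear {I} id
  Linear-id = record { cong = id ; +-hom = λ _ _ _ → refl ; ·-hom = λ _ _ _ → refl }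

  Linear-∘ : ∀ {I J K : Set} {L : Vect J → Vect K} {M : Vect I → Vect J} → Linear L → Linear M → Linear (L ∘ M)
  Linear-∘ l m = record
    { cong = cong l ∘ cong m
    ; +-hom = λ u v i → trans (cong l (+-hom m u v) i) (+-hom l _ _ i)
    ; ·-hom = λ a v i → trans (cong l (·-hom m a v) i) (·-hom l a _ i) }

  Linear-+v : ∀ {I J : Set} {L M : Vect I → Vect J} → Linear L → Linear M → Linear (λ v → L v +v M v)
  Linear-+v l m = record
    { cong = λ e i → +-cong (cong l e i) (cong m e i)
    ; +-hom = λ u v i → trans (+-cong (+-hom l u v i) (+-hom m u v i)) (interchange _ _ _ _)
    ; ·-hom = λ a v i → trans (+-cong (·-hom l a v i) (·-hom m a v i)) (sym (distribˡ a _ _)) }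

  Linear-·v : ∀ {I : Set} a → Linear {I} (a ·v_)
  Linear-·v a = record
    { cong = λ e i → *-congˡ (e i)
    ; +-hom = λ u v i → distribˡ a _ _
    ; ·-hom = λ b v i → x∙yz≈y∙xz a b _ }

  Linear-0v : ∀ {I J : Set} → Linear {I} {J} (λ _ → 0v)
  Linear-0v = record
    { cong = λ _ _ → refl ; +-hom = λ _ _ _ → sym (+-identityˡ 0#) ; ·-hom = λ a _ _ → sym (zeroʳ a) }

  Linear-lincomb : ∀ {I J : Set} {L : Vect I → Vect J} → Linear L → ∀ {k} cs (b : Fin k → Vect I) →
    L (lincomb cs b) ≈v lincomb cs (L ∘ b)
  Linear-lincomb {L = L} l {zero}  cs b i = begin
    L 0v i             ≈⟨ cong l (λ _ → sym (zeroˡ 0#)) i ⟩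
    L (0# ·v 0v) i     ≈⟨ ·-hom l 0# 0v i ⟩
    0# * L 0v i        ≈⟨ zeroˡ _ ⟩
    0#                 ∎
    where open SetoidReasoning setoid
  Linear-lincomb {L = L} l {suc k} cs b i =
    trans (+-hom l (cs zero ·v b zero) (lincomb (cs ∘ suc) (b ∘ suc)) i)
      (+-cong (·-hom l (cs zero) (b zero) i) (Linear-lincomb l (cs ∘ suc) (b ∘ suc) i))

  Linear-horner : ∀ {I : Set} {k n} {X : Vect (Fin k) → Vect (Fin k)} → Linear X →
    (L : Fin n → Vect I → Vect (Fin k)) → (∀ j → Linear (L j)) → Linear (λ v → horner X (λ j → L j v))
  Linear-horner {n = zero}  x L l = Linear-0v
  Linear-horner {n = suc n} x L l = Linear-+v (l zero) (Linear-∘ x (Linear-horner x (L ∘ suc) (l ∘ suc)))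

  horner-cong : ∀ {k n} {X : Vect (Fin k) → Vect (Fin k)} → Linear X → {r s : Fin n → Vect (Fin k)} →
    (∀ j → r j ≈v s j) → horner X r ≈v horner X s
  horner-cong {n = zero}  x e i = refl
  horner-cong {n = suc n} x e i = +-cong (e zero i) (cong x (horner-cong x (e ∘ suc)) i)

  -- Extension by zero along `f`, with preimages found by search; on the image it returns the
  -- intended values when `f` is injective.
  push : ∀ {a b} → (Fin a → Fin b) → Vect (Fin a) → Vect (Fin b)
  push f s x with Finₚ.any? (λ y → f y Fin.≟ x)
  ... | yes (y , _) = s y
  ... | no  _       = 0#

  push-image : ∀ {a b} {f : Fin a → Fin b} → Injective _≡_ _≡_ f → ∀ s y → push f s (f y) ≈ s y
  push-image {f = f} inj s y with Finₚ.any? (λ z → f z Fin.≟ f y)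
  ... | yes (z , e) = reflexive (≡.cong s (inj e))
  ... | no  ne      = contradiction (y , ≡.refl) ne

  push-off : ∀ {a b} (f : Fin a → Fin b) s x → (∀ y → f y ≢ x) → push f s x ≈ 0#
  push-off f s x off with Finₚ.any? (λ z → f z Fin.≟ x)
  ... | yes (z , e) = contradiction e (off z)
  ... | no  ne      = refl

  Linear-push : ∀ {a b} (f : Fin a → Fin b) → Linear (push f)
  Linear-push f = record { cong = push-cong ; +-hom = push-+ ; ·-hom = push-· }
    where
    push-cong : ∀ {s t} → s ≈v t → push f s ≈v push f t
    push-cong e x with Finₚ.any? (λ z → f z Fin.≟ x)
    ... | yes (z , _) = e z
    ... | no  _       = refl
    push-+ : ∀ s t → push f (s +v t) ≈v (push f s +v push f t)
    push-+ s t x with Finₚ.any? (λ z → f z Fin.≟ x)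
    ... | yes (z , _) = refl
    ... | no  _       = sym (+-identityˡ 0#)
    push-· : ∀ a s → push f (a ·v s) ≈v (a ·v push f s)
    push-· a s x with Finₚ.any? (λ z → f z Fin.≟ x)
    ... | yes (z , _) = refl
    ... | no  _       = sym (zeroʳ a)

  no-zero-divisor : ∀ {a b} → a * b ≈ 0# → ¬ b ≈ 0# → a ≈ 0#
  no-zero-divisor {a} {b} ab≈0 b≉0 with inverse b b≉0
  ... | y , by≈1 = begin
    a              ≈⟨ sym (*-identityʳ a) ⟩
    a * 1#         ≈⟨ *-congˡ (sym by≈1) ⟩
    a * (b * y)    ≈⟨ sym (*-assoc a b y) ⟩
    (a * b) * y    ≈⟨ *-congʳ ab≈0 ⟩
    0# * y         ≈⟨ zeroˡ y ⟩
    0#             ∎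
    where open SetoidReasoning setoid

  infix 8 _∙_
  _∙_ : ∀ {k} → Vect (Fin k) → Vect (Fin k) → Carrier
  u ∙ v = sumF (λ l → u l * v l)

  lincomb-∙ : ∀ {e k} (cs : Fin e → Carrier) (b : Fin e → Vect (Fin k)) z →
    lincomb cs b ∙ z ≈ sumF (λ j → cs j * b j ∙ z)
  lincomb-∙ {e} {k} cs b z = begin
    sumF {k} (λ l → sumF {e} (λ j → cs j * b j l) * z l)     ≈⟨ sumF-cong {k} (λ l → sym (sumF-*ʳ {e} (z l) _)) ⟩
    sumF {k} (λ l → sumF {e} (λ j → cs j * b j l * z l))     ≈⟨ sumF-swap {k} {e} _ ⟩
    sumF {e} (λ j → sumF {k} (λ l → cs j * b j l * z l))
      ≈⟨ sumF-cong {e} (λ j → trans (sumF-cong {k} (λ l → *-assoc _ _ _)) (sumF-*ˡ {k} (cs j) _)) ⟩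
    sumF {e} (λ j → cs j * b j ∙ z)                          ∎
    where open SetoidReasoning setoid

  δ-∙ : ∀ {k} (p : Fin k) z → δ p ∙ z ≈ z p
  δ-∙ {k} p z = trans (sumF-single {k} _ p (λ i ne → trans (*-congʳ (δ-≢ (ne ∘ ≡.sym))) (zeroˡ _)))
    (trans (*-congʳ (δ-≡ {i = p} ≡.refl)) (*-identityˡ _))

  ∙-combine : ∀ {k} (u v w : Vect (Fin k)) a → u ∙ (λ l → v l + a * w l) ≈ u ∙ v + a * u ∙ w
  ∙-combine {k} u v w a = trans
    (sumF-cong {k} (λ l → trans (distribˡ (u l) (v l) (a * w l)) (+-congˡ (x∙yz≈y∙xz (u l) a (w l)))))
    (trans (sumF-+ {k} _ _) (+-congˡ (sumF-*ˡ {k} a _)))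

  with-units : ∀ {e k} → Fin k → Fin k → (Fin e → Vect (Fin k)) → Fin (suc (suc e)) → Vect (Fin k)
  with-units p s C zero          = δ p
  with-units p s C (suc zero)    = δ s
  with-units p s C (suc (suc j)) = C j

  -- If z p = 0 ≠ z s and x p ≠ 0, then the unit vectors at p and s together with four independent
  -- vectors orthogonal to x and z would be six independent vectors in F⁵.
  orthogonal-proportional : ∀ {e} (C : Fin e → Vect (Fin 5)) → 4 ≤ e → LinIndep C →
    ∀ x z p → (∀ j → C j ∙ x ≈ 0#) → (∀ j → C j ∙ z ≈ 0#) → ¬ x p ≈ 0# → z p ≈ 0# → ∀ s → z s ≈ 0#
  orthogonal-proportional {e} C 4≤e ind x z p x⊥ z⊥ xp≉0 zp≈0 s with z s ≈? 0#
  ... | yes zs≈0 = zs≈0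
  ... | no  zs≉0 with dependent (suc (suc e)) 5 (s≤s (s≤s 4≤e)) (with-units p s C)
  ... | cs , (j , cj≉0) , eq = contradiction (all-zero j) cj≉0
    where
    family : Fin (suc (suc e)) → Vect (Fin 5)
    family = with-units p s C
    paired : ∀ v → (∀ j → C j ∙ v ≈ 0#) → cs zero * v p + cs (suc zero) * v s ≈ 0#
    paired v v⊥ = begin
      cs zero * v p + cs (suc zero) * v s
        ≈⟨ +-cong (*-congˡ (sym (δ-∙ p v))) (trans (*-congˡ (sym (δ-∙ s v)))
             (sym (trans (+-congˡ (sumF-0 {e} (λ j → trans (*-congˡ (v⊥ j)) (zeroʳ _)))) (+-identityʳ _)))) ⟩
      sumF (λ j → cs j * family j ∙ v)   ≈⟨ sym (lincomb-∙ cs family v) ⟩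
      lincomb cs family ∙ v              ≈⟨ sumF-0 {5} (λ l → trans (*-congʳ (eq l)) (zeroˡ (v l))) ⟩
      0#                                 ∎
      where open SetoidReasoning setoid
    c₁≈0 : cs (suc zero) ≈ 0#
    c₁≈0 = no-zero-divisor (trans (sym (trans (+-congʳ (trans (*-congˡ zp≈0) (zeroʳ _))) (+-identityˡ _))) (paired z z⊥)) zs≉0
    c₀≈0 : cs zero ≈ 0#
    c₀≈0 = no-zero-divisor (trans (sym (trans (+-congˡ (trans (*-congʳ c₁≈0) (zeroˡ _))) (+-identityʳ _))) (paired x x⊥)) xp≉0
    all-zero : ∀ j → cs j ≈ 0#
    all-zero zero          = c₀≈0
    all-zero (suc zero)    = c₁≈0
    all-zero (suc (suc j)) = ind (λ j → cs (suc (suc j))) (λ l → begin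
      lincomb (λ j → cs (suc (suc j))) C l
        ≈⟨ sym (trans (+-cong (trans (*-congʳ c₀≈0) (zeroˡ _)) (trans (+-congʳ (trans (*-congʳ c₁≈0) (zeroˡ _))) (+-identityˡ _))) (+-identityˡ _)) ⟩
      lincomb cs family l                    ≈⟨ eq l ⟩
      0#                                     ∎) j
      where open SetoidReasoning setoid

  record Echelon {n} (p : Fin 5 → Fin n) (g : Fin 5 → Vect (Fin n)) : Set ℓ where
    field
      pivot : ∀ j l → g j (p l) ≈ δ j l
      below : ∀ j i → i Fin.< p j → g j i ≈ 0#

    coordinate : ∀ cs l → lincomb cs g (p l) ≈ cs l
    coordinate cs l = trans (sumF-cong {5} (λ j → *-congˡ {cs j} (pivot j l))) (sumF-δ cs l)

    independent : LinIndep g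
    independent cs e l = trans (sym (coordinate cs l)) (e (p l))

  -- Four independent common vectors have a nontrivial combination u that vanishes in the at most
  -- three shared pivot columns. From left to right u then vanishes everywhere: a column that is not
  -- a pivot of one of the spaces receives, in that space, rows with a pivot further left, whose
  -- coefficients are earlier entries of u, and rows with a pivot further right, which are still
  -- zero there.
  echelon-apart : ∀ {n} {p p′ : Fin 5 → Fin n} {g g′} → Echelon p g → Echelon p′ g′ →
    ∀ {r} (s : Fin r → Fin n) → r ≤ 3 → (∀ j j′ → p j ≡ p′ j′ → ∃ λ x → s x ≡ p j) → Apart g g′
  echelon-apart {n} {p} {p′} {g} {g′} ech ech′ {r} s r≤3 covers e b 4≤e b∈ b∈′ ind
    with dependent e r (ℕₚ.≤-trans (s≤s r≤3) 4≤e) (λ j x → b j (s x))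
  ... | cs , (j , cj≉0) , eq = contradiction (ind cs (λ i → u≈0 n i (Finₚ.toℕ<n i)) j) cj≉0
    where
    open Echelon
    u = lincomb cs b
    side : ∀ {q h} → Echelon q h → span h u → ∀ i → (∀ i′ → i′ Fin.< i → u i′ ≈ 0#) → (∀ j → q j ≢ i) → u i ≈ 0#
    side {q} {h} ec (ds , e) i IH i∉q = trans (e i) (sumF-0 {5} term)
      where
      term : ∀ j → ds j * h j i ≈ 0#
      term j with Finₚ.<-cmp i (q j)
      ... | tri< i<q _ _ = trans (*-congˡ (below ec j i i<q)) (zeroʳ _)
      ... | tri≈ _ i≡q _ = contradiction (≡.sym i≡q) (i∉q j)
      ... | tri> _ _ q<i = trans (*-congʳ (trans (sym (coordinate ec ds j)) (trans (sym (e (q j))) (IH (q j) q<i)))) (zeroˡ _)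
    u≈0 : ∀ m i → toℕ i < m → u i ≈ 0#
    u≈0 (suc m) i (s≤s i≤m) with Finₚ.any? (λ j → p j Fin.≟ i) | Finₚ.any? (λ j → p′ j Fin.≟ i)
    ... | yes (j , ≡.refl) | yes (j′ , e′) with covers j j′ (≡.sym e′)
    ...   | x , sx≡pj = ≡.subst (λ i → u i ≈ 0#) sx≡pj (eq x)
    u≈0 (suc m) i (s≤s i≤m) | no i∉p | _ = side ech (span-lincomb cs g b b∈) i
      (λ i′ lt → u≈0 m i′ (ℕₚ.<-≤-trans lt i≤m)) (λ j e → i∉p (j , e))
    u≈0 (suc m) i (s≤s i≤m) | yes _ | no i∉p′ = side ech′ (span-lincomb cs g′ b b∈′) i
      (λ i′ lt → u≈0 m i′ (ℕₚ.<-≤-trans lt i≤m)) (λ j e → i∉p′ (j , e))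

  module FrameCode {n} (fr : Frame n) (isFr : IsFrame fr) (mult : Multiplier (Frame.k fr)) where
    open Frame fr
    open IsFrame isFr
    open Multiplier mult

    tail : Vect (Fin W) → Fin 4 → Vect (Fin k)
    tail cs j = push (pos j) (cs ∘ emb j)

    -- Row 0 is chosen such that the matrix lies in the kernel of r ↦ r₀ + X r₁ + … + X⁴ r₄,
    -- which contains no matrix of rank one.
    matrix : Vect (Fin W) → Fin 5 → Vect (Fin k)
    matrix cs zero    = (- 1#) ·v X (horner X (tail cs))
    matrix cs (suc j) = tail cs j

    gen : Vect (Fin W) → Fin 5 → Vect (Fin n)
    gen cs j i = δ (p j) i + push ι (matrix cs j) i

    Linear-matrix : ∀ j → Linear (λ cs → matrix cs j)
    Linear-matrix (suc j) = Linear-∘ (Linear-push (pos j)) (record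
      { cong = λ e y → e (emb j y) ; +-hom = λ _ _ _ → refl ; ·-hom = λ _ _ _ → refl })
    Linear-matrix zero    = Linear-∘ (Linear-·v (- 1#)) (Linear-∘ linear
      (Linear-horner linear (λ j cs → tail cs j) (λ j → Linear-matrix (suc j))))

    horner-matrix : ∀ cs → horner X (matrix cs) ≈v 0v
    horner-matrix cs x = trans (+-congʳ (-1*x≈-x _)) (-‿inverseˡ _)

    gen-ι : ∀ cs j x → gen cs j (ι x) ≈ matrix cs j x
    gen-ι cs j x = trans (+-cong (δ-≢ (p≢ι j x)) (push-image ι-injective (matrix cs j) x)) (+-identityˡ _)

    tail-pos : ∀ cs j y → tail cs j (pos j y) ≈ cs (emb j y)
    tail-pos cs j y = push-image (pos-injective j) (cs ∘ emb j) y

    gen-echelon : ∀ cs → Echelon p (gen cs)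
    gen-echelon cs = record { pivot = pivot ; below = below }
      where
      pivot : ∀ j l → gen cs j (p l) ≈ δ j l
      pivot j l = trans (+-congˡ (push-off ι (matrix cs j) (p l) (λ x e → p≢ι l x (≡.sym e)))) (trans (+-identityʳ _) (δ-p j l))
        where
        δ-p : ∀ j l → δ (p j) (p l) ≈ δ j l
        δ-p j l with j Fin.≟ l
        ... | yes j≡l = δ-≡ (≡.cong p j≡l)
        ... | no  j≢l = δ-≢ (j≢l ∘ p-injective)
      row : ∀ j x → ι x Fin.< p j → matrix cs j x ≈ 0#
      row zero    x lt = contradiction lt (ℕₚ.<-asym (p₀<ι x))
      row (suc j) x lt = push-off (pos j) _ x (λ { y ≡.refl → ℕₚ.<-asym lt (p<pos j y) })
      below : ∀ j i → i Fin.< p j → gen cs j i ≈ 0#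
      below j i lt with Finₚ.any? (λ x → ι x Fin.≟ i)
      ... | yes (x , ≡.refl) = trans (+-cong (δ-≢ (p≢ι j x)) (row j x lt)) (+-identityˡ 0#)
      ... | no  off = trans (+-congʳ (δ-≢ {i = p j} {i} (λ e → ℕₚ.<-irrefl (≡.cong toℕ (≡.sym e)) lt))) (+-identityˡ 0#)

    -- For a matrix with rows a_j v the defining relation reads (a₀ + a₁ X + ... + a₄ X⁴) v = 0, so
    -- `nonsingular` forces a = 0 or v = 0.
    rank-one-zero : ∀ cs (a : Fin 5 → Carrier) v → (∀ j → matrix cs j ≈v (a j ·v v)) → ∀ j → matrix cs j ≈v 0v
    rank-one-zero cs a v e j x with nonsingular 5≤k a v
      (λ i → trans (sym (horner-cong linear e i)) (horner-matrix cs i))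
    ... | inj₁ a≈0 = trans (e j x) (trans (*-congʳ (a≈0 j)) (zeroˡ _))
    ... | inj₂ v≈0 = trans (e j x) (trans (*-congˡ (v≈0 x)) (zeroʳ _))

    matrix-injective : ∀ cs → (∀ j → matrix cs j ≈v 0v) → cs ≈v 0v
    matrix-injective cs e x with emb-covers x
    ... | j , y , ≡.refl = trans (sym (tail-pos cs j y)) (e (suc j) (pos j y))

    -- The coordinates of a common vector are its pivot entries, hence the same vector of `C` for
    -- both generator matrices. So the columns of the difference `matrix d` are orthogonal to four
    -- independent vectors of F⁵; it has rank at most one and is zero, contrary to the parameter at
    -- x.
    gen-apart : ∀ cs cs′ x → ¬ cs x ≈ cs′ x → Apart (gen cs) (gen cs′)
    gen-apart cs cs′ x ne e b 4≤e b∈ b∈′ ind with emb-covers x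
    ... | j₀ , y₀ , ≡.refl = pivot≉0 (rank-one-zero d a v proportional (suc j₀) (pos j₀ y₀))
      where
      open Echelon
      d : Vect (Fin W)
      d = cs +v ((- 1#) ·v cs′)
      C : Fin e → Vect (Fin 5)
      C j l = b j (p l)
      via : ∀ {ds} → (∀ j → span (gen ds) (b j)) → ∀ j → b j ≈v lincomb (C j) (gen ds)
      via {ds} m j i = trans (proj₂ (m j) i) (lincomb-congˡ (gen ds)
        (λ l → trans (sym (coordinate (gen-echelon ds) (proj₁ (m j)) l)) (sym (proj₂ (m j) (p l)))) i)
      C-ind : LinIndep C
      C-ind ds z = ind ds (λ i → trans (lincomb-congʳ ds (via {cs} b∈) i) (trans (lincomb-lincomb ds C (gen cs) i)
        (sumF-0 {5} (λ l → trans (*-congʳ (z l)) (zeroˡ (gen cs l i))))))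
      column : Fin k → Vect (Fin 5)
      column y l = matrix d l y
      difference : ∀ l y → matrix d l y ≈ gen cs l (ι y) + (- 1#) * gen cs′ l (ι y)
      difference l y = trans (+-hom (Linear-matrix l) cs ((- 1#) ·v cs′) y)
        (+-cong (sym (gen-ι cs l y)) (trans (·-hom (Linear-matrix l) (- 1#) cs′ y) (*-congˡ (sym (gen-ι cs′ l y)))))
      ⊥column : ∀ y j → C j ∙ column y ≈ 0#
      ⊥column y j = begin
        C j ∙ column y
          ≈⟨ sumF-cong {5} (λ l → *-congˡ {C j l} (difference l y)) ⟩
        C j ∙ (λ l → gen cs l (ι y) + (- 1#) * gen cs′ l (ι y))
          ≈⟨ ∙-combine (C j) (λ l → gen cs l (ι y)) (λ l → gen cs′ l (ι y)) (- 1#) ⟩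
        lincomb (C j) (gen cs) (ι y) + (- 1#) * lincomb (C j) (gen cs′) (ι y)
          ≈⟨ +-cong (sym (via {cs} b∈ j (ι y))) (trans (-1*x≈-x _) (-‿cong (sym (via {cs′} b∈′ j (ι y))))) ⟩
        b j (ι y) + - b j (ι y)     ≈⟨ -‿inverseʳ _ ⟩
        0#                          ∎
        where open SetoidReasoning setoid
      pivot≉0 : ¬ matrix d (suc j₀) (pos j₀ y₀) ≈ 0#
      pivot≉0 z = ne (∙-cancelʳ (- cs′ (emb j₀ y₀)) _ _ (trans (+-congˡ (sym (-1*x≈-x _)))
        (trans (sym (tail-pos d j₀ y₀)) (trans z (sym (-‿inverseʳ _))))))
      x₀ = pos j₀ y₀
      inv : Carrier
      inv = proj₁ (inverse (column x₀ (suc j₀)) pivot≉0)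
      a : Fin 5 → Carrier
      a l = column x₀ l * inv
      v : Vect (Fin k)
      v y = matrix d (suc j₀) y
      a-pivot : a (suc j₀) ≈ 1#
      a-pivot = proj₂ (inverse (column x₀ (suc j₀)) pivot≉0)
      -- Column y minus the multiple of column x₀ that clears coordinate `suc j₀`. It is orthogonal
      -- to `C` as well, hence zero, and this exhibits the difference as the outer product of `a`
      -- and `v`.
      residual : Fin k → Vect (Fin 5)
      residual y l = column y l + - (v y * inv) * column x₀ l
      ⊥residual : ∀ y j → C j ∙ residual y ≈ 0#
      ⊥residual y j = begin
        C j ∙ residual y
          ≈⟨ ∙-combine (C j) (column y) (column x₀) (- (v y * inv)) ⟩
        C j ∙ column y + - (v y * inv) * C j ∙ column x₀
          ≈⟨ +-cong (⊥column y j) (trans (*-congˡ (⊥column x₀ j)) (zeroʳ _)) ⟩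
        0# + 0#   ≈⟨ +-identityˡ 0# ⟩
        0#        ∎
        where open SetoidReasoning setoid
      rearrange : ∀ y l → - (v y * inv) * column x₀ l ≈ - (a l * v y)
      rearrange y l = trans (sym (-‿distribˡ-* _ _)) (-‿cong
        (trans (*-assoc _ _ _) (trans (*-comm _ _) (*-congʳ (*-comm _ _)))))
      residual-pivot : ∀ y → residual y (suc j₀) ≈ 0#
      residual-pivot y = trans (+-congˡ (trans (rearrange y (suc j₀)) (-‿cong (trans (*-congʳ a-pivot) (*-identityˡ _))))) (-‿inverseʳ _)
      proportional : ∀ l → matrix d l ≈v (a l ·v v)
      proportional l y = ∙-cancelʳ (- (a l * v y)) _ _ (trans (+-congˡ (sym (rearrange y l)))
        (trans (orthogonal-proportional C 4≤e C-ind (column x₀) (residual y) (suc j₀)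
          (⊥column x₀) (⊥residual y) pivot≉0 (residual-pivot y) l) (sym (-‿inverseʳ _))))

-- The pivot sets and their frames

module PivotFrames where
  open import Relation.Binary.PropositionalEquality

  lookup-injective : ∀ {A : Set} {xs : List A} → Unique xs → Injective _≡_ _≡_ (List.lookup xs)
  lookup-injective (x∉ ∷ u) {zero}  {zero}  e = refl
  lookup-injective (x∉ ∷ u) {zero}  {suc j} e = contradiction e (All.lookup x∉ (∈-lookup j))
  lookup-injective (x∉ ∷ u) {suc i} {zero}  e = contradiction (sym e) (All.lookup x∉ (∈-lookup i))
  lookup-injective (x∉ ∷ u) {suc i} {suc j} e = cong suc (lookup-injective u e)

  AllPairs-lookup : ∀ {a r} {A : Set a} {R : A → A → Set r} → Symmetric R → ∀ {xs} → AllPairs R xs →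
    ∀ i j → i ≢ j → R (List.lookup xs i) (List.lookup xs j)
  AllPairs-lookup s (x ∷ xs) zero    zero    ne = contradiction refl ne
  AllPairs-lookup s (x ∷ xs) zero    (suc j) ne = All.lookup x (∈-lookup j)
  AllPairs-lookup s (x ∷ xs) (suc i) zero    ne = s (All.lookup x (∈-lookup i))
  AllPairs-lookup s (x ∷ xs) (suc i) (suc j) ne = AllPairs-lookup s xs i j (ne ∘ cong suc)

  ↑ˡ<↑ʳ : ∀ {a t} (i : Fin a) (j : Fin t) → (i ↑ˡ t) Fin.< (a ↑ʳ j)
  ↑ˡ<↑ʳ {a} {t} i j = subst₂ _<_ (sym (Finₚ.toℕ-↑ˡ i t)) (sym (Finₚ.toℕ-↑ʳ a j))
    (ℕₚ.<-≤-trans (Finₚ.toℕ<n i) (ℕₚ.m≤m+n a (toℕ j)))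

  ↑ˡ-mono-< : ∀ {a} t {i j : Fin a} → i Fin.< j → (i ↑ˡ t) Fin.< (j ↑ˡ t)
  ↑ˡ-mono-< t {i} {j} = subst₂ _<_ (sym (Finₚ.toℕ-↑ˡ i t)) (sym (Finₚ.toℕ-↑ˡ j t))

  ↑ˡ≢↑ʳ : ∀ {a t} (i : Fin a) (j : Fin t) → i ↑ˡ t ≢ a ↑ʳ j
  ↑ˡ≢↑ʳ i j e = ℕₚ.<-irrefl (cong toℕ e) (↑ˡ<↑ʳ i j)

  module _ {a b : ℕ} (t : ℕ) (f : Fin a → Fin b) where

    extend : Fin (a ℕ.+ t) → Fin (b ℕ.+ t)
    extend i = [ (λ x → f x ↑ˡ t) , (b ↑ʳ_) ]′ (splitAt a i)

    -- Separates the old indices from the t appended ones once, so that later proofs can match on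
    -- it.
    data ExtendView : Fin (a ℕ.+ t) → Fin (b ℕ.+ t) → Set where
      old : ∀ x → ExtendView (x ↑ˡ t) (f x ↑ˡ t)
      new : ∀ y → ExtendView (a ↑ʳ y) (b ↑ʳ y)

    extendView : ∀ i → ExtendView i (extend i)
    extendView i with splitAt a i in eq
    ... | inj₁ x = subst (λ i → ExtendView i (f x ↑ˡ t)) (Finₚ.splitAt⁻¹-↑ˡ eq) (old x)
    ... | inj₂ y = subst (λ i → ExtendView i (b ↑ʳ y)) (Finₚ.splitAt⁻¹-↑ʳ {a} eq) (new y)

    extend-injective : Injective _≡_ _≡_ f → Injective _≡_ _≡_ extend
    extend-injective inj {i} {j} e = go (extendView i) (extendView j) e
      where
      go : ∀ {i j u v} → ExtendView i u → ExtendView j v → u ≡ v → i ≡ j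
      go (old x) (old y) e = cong (_↑ˡ t) (inj (Finₚ.↑ˡ-injective t _ _ e))
      go (old x) (new y) e = contradiction e (↑ˡ≢↑ʳ (f x) y)
      go (new x) (old y) e = contradiction (sym e) (↑ˡ≢↑ʳ (f y) x)
      go (new x) (new y) e = cong (a ↑ʳ_) (Finₚ.↑ʳ-injective b _ _ e)

  total : ∀ {n} → (Fin n → ℕ) → ℕ
  total {zero}  w = 0
  total {suc n} w = w zero ℕ.+ total (w ∘ suc)

  inject : ∀ {n} (w : Fin n → ℕ) j → Fin (w j) → Fin (total w)
  inject w zero    y = y ↑ˡ total (w ∘ suc)
  inject w (suc j) y = w zero ↑ʳ inject (w ∘ suc) j y

  inject-covers : ∀ {n} (w : Fin n → ℕ) x → ∃₂ λ j y → inject w j y ≡ x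
  inject-covers {suc n} w x with splitAt (w zero) x in eq
  ... | inj₁ y = zero , y , Finₚ.splitAt⁻¹-↑ˡ eq
  ... | inj₂ z with inject-covers (w ∘ suc) z
  ...   | j , y , e = suc j , y , trans (cong (w zero ↑ʳ_) e) (Finₚ.splitAt⁻¹-↑ʳ {w zero} eq)

  -- All pivots lie in the first eleven columns for every n; n enters only through the t columns
  -- appended on the right.
  Pivots : Set
  Pivots = Vec (Fin 11) 5

  Free : Pivots → Fin 11 → Set
  Free v i = Vec.lookup v zero Fin.< i × ¬ ∃ λ j → Vec.lookup v j ≡ i

  free? : ∀ v i → Dec (Free v i)
  free? v i = (Vec.lookup v zero Finₚ.<? i) ×-dec ¬? (Finₚ.any? λ j → Vec.lookup v j Fin.≟ i)

  free : (v : Pivots) → List (Fin 11)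
  free v = filter (free? v) (allFin 11)

  available? : ∀ v (j : Fin 4) x → Dec (Vec.lookup v (suc j) Fin.< List.lookup (free v) x)
  available? v j x = Vec.lookup v (suc j) Finₚ.<? List.lookup (free v) x

  available : (v : Pivots) → Fin 4 → List (Fin (length (free v)))
  available v j = filter (available? v j) (allFin _)

  Common : Pivots → Pivots → Fin 11 → Set
  Common u v i = (∃ λ j → Vec.lookup u j ≡ i) × (∃ λ j → Vec.lookup v j ≡ i)

  common? : ∀ u v i → Dec (Common u v i)
  common? u v i = (Finₚ.any? λ j → Vec.lookup u j Fin.≟ i) ×-dec (Finₚ.any? λ j → Vec.lookup v j Fin.≟ i)

  common : Pivots → Pivots → List (Fin 11)
  common u v = filter (common? u v) (allFin 11)

  Separated : Pivots → Pivots → Set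
  Separated u v = length (common u v) ≤ 3

  -- Four free columns to the right of the first pivot, as for the pivots 2, 3, 4 followed by two of
  -- the next six, become five with t ≥ 1, which is what `5≤k` asks for.
  Valid : Pivots → Set
  Valid v = (∀ j l → Vec.lookup v j ≡ Vec.lookup v l → j ≡ l) × 4 ≤ length (free v)

  valid? : ∀ v → Dec (Valid v)
  valid? v = (Finₚ.all? λ j → Finₚ.all? λ l → (Vec.lookup v j Fin.≟ Vec.lookup v l) →-dec (j Fin.≟ l)) ×-dec (4 ℕ.≤? length (free v))

  basePivots : Pivots
  basePivots = # 0 ∷ # 1 ∷ # 2 ∷ # 3 ∷ # 4 ∷ []

  -- Two 3-subsets in the same class meet in one point, two 2-subsets in the same class are disjoint, and
  -- no subset occurs in two classes.
  classes : List (List (Vec (Fin 5) 3) × List (Vec (Fin 6) 2))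
  classes =
      (((# 0 ∷ # 1 ∷ # 2 ∷ []) ∷ (# 0 ∷ # 3 ∷ # 4 ∷ []) ∷ []) , (# 0 ∷ # 1 ∷ []) ∷ (# 2 ∷ # 3 ∷ []) ∷ (# 4 ∷ # 5 ∷ []) ∷ [])
    ∷ (((# 0 ∷ # 1 ∷ # 3 ∷ []) ∷ (# 1 ∷ # 2 ∷ # 4 ∷ []) ∷ []) , (# 0 ∷ # 2 ∷ []) ∷ (# 1 ∷ # 3 ∷ []) ∷ [])
    ∷ (((# 1 ∷ # 2 ∷ # 3 ∷ []) ∷ (# 0 ∷ # 2 ∷ # 4 ∷ []) ∷ []) , (# 0 ∷ # 3 ∷ []) ∷ (# 1 ∷ # 2 ∷ []) ∷ [])
    ∷ (((# 0 ∷ # 1 ∷ # 4 ∷ []) ∷ (# 2 ∷ # 3 ∷ # 4 ∷ []) ∷ []) , (# 0 ∷ # 4 ∷ []) ∷ (# 1 ∷ # 5 ∷ []) ∷ [])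
    ∷ (((# 0 ∷ # 2 ∷ # 3 ∷ []) ∷ (# 1 ∷ # 3 ∷ # 4 ∷ []) ∷ []) , (# 0 ∷ # 5 ∷ []) ∷ (# 1 ∷ # 4 ∷ []) ∷ [])
    ∷ []

  -- Each pivot set joins a 3-subset and a 2-subset of one class. Within a class two sets share 3 +
  -- 0, 1 + 2 or 1 + 0 pivots, across classes at most 2 + 1, and each shares exactly 3 with
  -- `basePivots`. The classes give 6 + 4 · 4 = 22 sets.
  pivots : List Pivots
  pivots = List.concatMap (λ (As , Bs) → cartesianProductWith (λ A B → Vec.map (_↑ˡ 6) A Vec.++ Vec.map (5 ↑ʳ_) B) As Bs) classes

  opaque
    pivots-valid : All Valid pivots
    pivots-valid = from-yes (All.all? valid? pivots)

  separated? : ∀ u v → Dec (Separated u v)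
  separated? u v = length (common u v) ℕ.≤? 3

  -- All 253 pairs are decided here once; opacity keeps the evaluation from being repeated at each
  -- use.
  opaque
    pivots-separated : AllPairs Separated (basePivots ∷ pivots)
    pivots-separated = from-yes (allPairs? separated? (basePivots ∷ pivots))

  -- Free entries of the rows 1 to 4 within the first eleven columns; the t further columns add 4 t.
  freedom : Pivots → ℕ
  freedom v = total (length ∘ available v)

  pivotFrame : ∀ t → Pivots → Frame (11 ℕ.+ t)
  pivotFrame t v = record
    { p = λ j → Vec.lookup v j ↑ˡ t
    ; k = length (free v) ℕ.+ t
    ; ι = extend t (List.lookup (free v))
    ; w = λ j → length (available v j) ℕ.+ t
    ; pos = λ j → extend t (List.lookup (available v j))
    ; W = total (λ j → length (available v j) ℕ.+ t)
    ; emb = inject _ }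

  pivotFrame-isFrame : ∀ t v → 1 ≤ t → Valid v → IsFrame (pivotFrame t v)
  pivotFrame-isFrame t v 1≤t (distinct , 4≤k₀) = record
    { p-injective = λ e → distinct _ _ (Finₚ.↑ˡ-injective t _ _ e)
    ; ι-injective = extend-injective t _ (lookup-injective (filter⁺ (free? v) (allFin⁺ 11)))
    ; pos-injective = λ j → extend-injective t _ (lookup-injective (filter⁺ (available? v j) (allFin⁺ _)))
    ; p≢ι = λ j x → p≢ j (extendView t (List.lookup (free v)) x)
    ; p₀<ι = λ x → p₀< (extendView t (List.lookup (free v)) x)
    ; p<pos = λ j y → p< j (extendView t (List.lookup (available v j)) y)
    ; emb-covers = inject-covers _
    ; 5≤k = ℕₚ.+-mono-≤ 4≤k₀ 1≤t }
    where
    inFree : ∀ x → Free v (List.lookup (free v) x)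
    inFree x = proj₂ (∈-filter⁻ (free? v) {xs = allFin 11} (∈-lookup x))
    p≢ : ∀ j {x i} → ExtendView t (List.lookup (free v)) x i → Vec.lookup v j ↑ˡ t ≢ i
    p≢ j (old x) e = proj₂ (inFree x) (j , Finₚ.↑ˡ-injective t _ _ e)
    p≢ j (new y) e = ↑ˡ≢↑ʳ (Vec.lookup v j) y e
    p₀< : ∀ {x i} → ExtendView t (List.lookup (free v)) x i → (Vec.lookup v zero ↑ˡ t) Fin.< i
    p₀< (old x) = ↑ˡ-mono-< t (proj₁ (inFree x))
    p₀< (new y) = ↑ˡ<↑ʳ _ y
    p< : ∀ j {y x} → ExtendView t (List.lookup (available v j)) y x → (Vec.lookup v (suc j) ↑ˡ t) Fin.< extend t (List.lookup (free v)) x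
    p< j (old y) = subst (λ s → (Vec.lookup v (suc j) ↑ˡ t) Fin.< [ (λ x → List.lookup (free v) x ↑ˡ t) , (11 ↑ʳ_) ]′ s)
      (sym (Finₚ.splitAt-↑ˡ _ (List.lookup (available v j) y) t))
      (↑ˡ-mono-< t (proj₂ (∈-filter⁻ (available? v j) {xs = allFin _} (∈-lookup y))))
    p< j (new y) = subst (λ s → (Vec.lookup v (suc j) ↑ˡ t) Fin.< [ (λ x → List.lookup (free v) x ↑ˡ t) , (11 ↑ʳ_) ]′ s)
      (sym (Finₚ.splitAt-↑ʳ (length (free v)) t y)) (↑ˡ<↑ʳ _ y)

  -- Defined apart from `pivotFrame` so that the free columns are literally the last 6 + t and `W`
  -- is literally the dimension of the MRD code.
  baseFrame : ∀ t → Frame (11 ℕ.+ t)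
  baseFrame t = record
    { p = λ j → Vec.lookup basePivots j ↑ˡ t
    ; k = 6 ℕ.+ t
    ; ι = 5 ↑ʳ_
    ; w = λ _ → 6 ℕ.+ t
    ; pos = λ _ → id
    ; W = (6 ℕ.+ t) ℕ.* 4
    ; emb = λ j y → combine y j }

  base-pivot : ∀ t j → Vec.lookup basePivots j ↑ˡ t ≡ j ↑ˡ (6 ℕ.+ t)
  base-pivot t zero                         = refl
  base-pivot t (suc zero)                   = refl
  base-pivot t (suc (suc zero))             = refl
  base-pivot t (suc (suc (suc zero)))       = refl
  base-pivot t (suc (suc (suc (suc zero)))) = refl

  baseFrame-isFrame : ∀ t → IsFrame (baseFrame t)
  baseFrame-isFrame t = record
    { p-injective = λ {j} {l} e → Finₚ.↑ˡ-injective (6 ℕ.+ t) j l (trans (sym (base-pivot t j)) (trans e (base-pivot t l)))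
    ; ι-injective = λ {x} {y} → Finₚ.↑ʳ-injective 5 x y
    ; pos-injective = λ _ → id
    ; p≢ι = λ j x e → ↑ˡ≢↑ʳ j x (trans (sym (base-pivot t j)) e)
    ; p₀<ι = λ x → below zero x
    ; p<pos = λ j y → below (suc j) y
    ; emb-covers = λ x → let (y , j , e) = Finₚ.combine-surjective {6 ℕ.+ t} {4} x in j , y , e
    ; 5≤k = ℕₚ.m≤m+n 5 (suc t) }
    where
    below : ∀ j x → (Vec.lookup basePivots j ↑ˡ t) Fin.< (5 ↑ʳ x)
    below j x = subst (Fin._< (5 ↑ʳ x)) (sym (base-pivot t j)) (↑ˡ<↑ʳ j x)

  separated-cover : ∀ u v t j j′ → Vec.lookup u j ↑ˡ t ≡ Vec.lookup v j′ ↑ˡ t →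
    ∃ λ x → List.lookup (common u v) x ↑ˡ t ≡ Vec.lookup u j ↑ˡ t
  separated-cover u v t j j′ e = Any.index i∈ , cong (_↑ˡ t) (sym (lookup-index i∈))
    where
    i∈ : Vec.lookup u j ∈ common u v
    i∈ = ∈-filter⁺ (common? u v) (∈-allFin _)
      ((j , refl) , (j′ , sym (Finₚ.↑ˡ-injective t _ _ e)))

-- The whole code over a finite field and its lifted MRD subcode

module FiniteField {c ℓ} (q : ℕ) (F : Field c ℓ) (size : HasSize F q) where
  open PivotFrames
  open Field F hiding (zero)
  open Inverse size using (to; from; to-cong; strictlyInverseˡ; strictlyInverseʳ)

  to-injective : ∀ {x y} → to x ≡ to y → x ≈ y
  to-injective {x} {y} e = trans (sym (strictlyInverseʳ x)) (trans (reflexive (≡.cong from e)) (strictlyInverseʳ y))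

  _≈?_ : ∀ x y → Dec (x ≈ y)
  x ≈? y = map′ to-injective to-cong (to x Fin.≟ to y)

  2≤q : 2 ≤ q
  2≤q with 2 ℕₚ.≤? q
  ... | yes le = le
  ... | no nle = contradiction (to-injective (Fin≤1 (ℕₚ.≤-pred (ℕₚ.≰⇒> nle)) (to 0#) (to 1#))) 0≉1
    where
    Fin≤1 : ∀ {n} → n ≤ 1 → (i j : Fin n) → i ≡ j
    Fin≤1 (s≤s z≤n) zero zero = ≡.refl

  open LinAlg F
  open LinearAlgebra F _≈?_
  open EchelonCodes F _≈?_

  opaque
    multiplier : ∀ k → Multiplier k
    -- In dimension 0 every vector is zero.
    multiplier zero    = record
      { X = id ; linear = Linear-id ; nonsingular = λ _ _ _ _ → inj₂ λ () }
    multiplier (suc k) = let (f , irr) = Existence.irreducible-of-degree F q size _≈?_ 2≤q k in Companion.multiplier f irr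

  parameters : ∀ {W} → Fin (q ℕ.^ W) → Vect (Fin W)
  parameters {W} i x = from (finToFun {q} {W} i x)

  parameters-injective : ∀ {W} {i j : Fin (q ℕ.^ W)} → i ≢ j → ∃ λ x → ¬ parameters i x ≈ parameters j x
  parameters-injective {W} {i} {j} i≢j with Finₚ.all? (λ x → finToFun {q} {W} i x Fin.≟ finToFun j x)
  ... | yes e = contradiction (finToFun-injective {W} {q} e) i≢j
  ... | no ne with Finₚ.¬∀⟶∃¬ W _ (λ x → finToFun {q} {W} i x Fin.≟ finToFun j x) ne
  ...   | x , d = x , λ e → d (≡.trans (≡.sym (strictlyInverseˡ _)) (≡.trans (to-cong e) (strictlyInverseˡ _)))

  parameters-surjective : ∀ {W} (cs : Vect (Fin W)) → parameters (funToFin (to ∘ cs)) ≈v cs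
  parameters-surjective {W} cs x = trans (reflexive (≡.cong from (Finₚ.finToFun-funToFin {W} {q} (to ∘ cs) x))) (strictlyInverseʳ (cs x))

  Generators : ℕ → Set c
  Generators n = Fin 5 → Vect (Fin n)

  span-cong : ∀ {I : Set} {k} {g h : Fin k → Vect I} → (∀ j → g j ≈v h j) → SameSpace (span g) (span h)
  span-cong e v = (λ (cs , p) → cs , λ i → trans (p i) (lincomb-congʳ cs e i))
                , (λ (cs , p) → cs , λ i → trans (p i) (sym (lincomb-congʳ cs e i)))

  module _ {n} (fr : Frame n) (isFr : IsFrame fr) where
    open Frame fr using (k; W; p)
    open FrameCode fr isFr (multiplier k)

    code : List (Generators n)
    code = List.tabulate {n = q ℕ.^ W} (gen ∘ parameters)

    code-length : length code ≡ q ℕ.^ W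
    code-length = Listₚ.length-tabulate _

    code-apart : AllPairs Apart code
    code-apart = AllPairsₚ.tabulate⁺ λ {i} {j} i≢j →
      let (x , ne) = parameters-injective {W} i≢j in gen-apart (parameters i) (parameters j) x ne

    code-echelon : All (Echelon p) code
    code-echelon = Allₚ.tabulate⁺ λ i → gen-echelon (parameters i)

  module _ (t : ℕ) where

    place : Pivots → Fin 5 → Fin (11 ℕ.+ t)
    place v j = Vec.lookup v j ↑ˡ t

    record Block (v : Pivots) : Set (c ⊔ ℓ) where
      field
        words   : List (Generators (11 ℕ.+ t))
        apart   : AllPairs Apart words
        echelon : All (Echelon (place v)) words

    blocks-apart : ∀ {u v} → Separated u v → (B : Block u) (C : Block v) →
      All (λ g → All (Apart g) (Block.words C)) (Block.words B)
    blocks-apart {u} {v} sep B C = All.map (λ ech → All.map (λ ech′ →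
      echelon-apart ech ech′ (λ x → List.lookup (common u v) x ↑ˡ t) sep (separated-cover u v t)) (Block.echelon C)) (Block.echelon B)

    pivotBlock : 1 ≤ t → ∀ {v} → Valid v → Block v
    pivotBlock 1≤t {v} valid = record
      { words = code (pivotFrame t v) isFr ; apart = code-apart (pivotFrame t v) isFr ; echelon = code-echelon (pivotFrame t v) isFr }
      where isFr = pivotFrame-isFrame t v 1≤t valid

    baseBlock : Block basePivots
    baseBlock = record
      { words = code (baseFrame t) isFr ; apart = code-apart (baseFrame t) isFr ; echelon = code-echelon (baseFrame t) isFr }
      where isFr = baseFrame-isFrame t

    union : ∀ {vs} → All Block vs → List (Generators (11 ℕ.+ t))
    union []       = []
    union (B ∷ Bs) = Block.words B ++ union Bs

    union-apart-from : ∀ {v vs} (B : Block v) (Bs : All Block vs) → All (Separated v) vs →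
      All (λ g → All (Apart g) (union Bs)) (Block.words B)
    union-apart-from B []       []       = All.universal (λ _ → []) (Block.words B)
    union-apart-from B (C ∷ Bs) (s ∷ ss) = All.zipWith (λ (x , y) → Allₚ.++⁺ x y)
      (blocks-apart s B C , union-apart-from B Bs ss)

    union-apart : ∀ {vs} (Bs : All Block vs) → AllPairs Separated vs → AllPairs Apart (union Bs)
    union-apart []       []       = []
    union-apart (B ∷ Bs) (s ∷ ss) = AllPairsₚ.++⁺ (Block.apart B) (union-apart Bs ss) (union-apart-from B Bs s)

    union-independent : ∀ {vs} (Bs : All Block vs) → All LinIndep (union Bs)
    union-independent []       = []
    union-independent (B ∷ Bs) = Allₚ.++⁺ (All.map Echelon.independent (Block.echelon B)) (union-independent Bs)

    pivotBlocks : 1 ≤ t → ∀ {vs} → All Valid vs → All Block vs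
    pivotBlocks 1≤t = All.map (pivotBlock 1≤t)

    total-+ : ∀ {n} (w : Fin n → ℕ) → total (λ j → w j ℕ.+ t) ≡ n ℕ.* t ℕ.+ total w
    total-+ {zero}  w = ≡.refl
    total-+ {suc n} w = ≡.trans (≡.cong ((w zero ℕ.+ t) ℕ.+_) (total-+ (w ∘ suc)))
      (≡.trans (≡.cong (ℕ._+ (n ℕ.* t ℕ.+ total (w ∘ suc))) (ℕₚ.+-comm (w zero) t)) (interchange t (w zero) (n ℕ.* t) (total (w ∘ suc))))
      where open import Algebra.Properties.CommutativeSemigroup ℕₚ.+-commutativeSemigroup using (interchange)

    union-length : ∀ (1≤t : 1 ≤ t) {vs} (valid : All Valid vs) →
      length (union (pivotBlocks 1≤t valid)) ≡ ListAction.sum (List.map (λ e → q ℕ.^ (4 ℕ.* t ℕ.+ e)) (List.map freedom vs))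
    union-length 1≤t []                 = ≡.refl
    union-length 1≤t (_∷_ {v} val vals) = ≡.trans (Listₚ.length-++ (code (pivotFrame t v) _))
      (≡.cong₂ ℕ._+_ (≡.trans (code-length (pivotFrame t v) (pivotFrame-isFrame t v 1≤t val))
        (≡.cong (q ℕ.^_) (total-+ (length ∘ available v)))) (union-length 1≤t vals))

    module Base = FrameCode (baseFrame t) (baseFrame-isFrame t) (multiplier (6 ℕ.+ t))

    m : ℕ
    m = 6 ℕ.+ t

    asMatrix : Vect (Fin (m ℕ.* 4)) → Mat 5 m
    asMatrix cs (i , x) = Base.matrix cs i x

    Linear-asMatrix : Linear asMatrix
    Linear-asMatrix = record
      { cong = λ e (i , x) → Linear.cong (Base.Linear-matrix i) e x
      ; +-hom = λ u v (i , x) → Linear.+-hom (Base.Linear-matrix i) u v x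
      ; ·-hom = λ a v (i , x) → Linear.·-hom (Base.Linear-matrix i) a v x }

    basis : Fin (m ℕ.* 4) → Mat 5 m
    basis j = asMatrix (λ x → δ j x)

    lincomb-basis : ∀ cs → lincomb cs basis ≈v asMatrix cs
    lincomb-basis cs ix = trans (sym (Linear-lincomb Linear-asMatrix cs δ ix))
      (Linear.cong Linear-asMatrix (λ x → sumF-δ cs x) ix)

    -- If a single vector `b zero` spans the row space of A, all rows are multiples of it and
    -- `rank-one-zero` applies.
    isMRD : IsMRD 5 m 2 (span basis)
    isMRD = record
      { subspace = span-subspace basis
      -- As m = 6 + t exceeds 5, the dimension required by `IsMRD` computes to m · 4.
      ; dim = span-dim basis λ cs e → Base.matrix-injective cs λ i x → trans (sym (lincomb-basis cs (i , x))) (e (i , x))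
      ; rank = rank }
      where
      rank : ∀ A → span basis A → ¬ (A ≈v 0v) → RankAtLeast 2 A
      rank A (cs , A≈) A≉0 r (b , _ , _ , spans) = go r b spans
        where
        A≈′ : ∀ i x → A (i , x) ≈ Base.matrix cs i x
        A≈′ i x = trans (A≈ (i , x)) (lincomb-basis cs (i , x))
        go : ∀ r (b : Fin r → Vect (Fin m)) → (∀ v → span (rows A) v → ∃ λ cs → v ≈v lincomb cs b) → 2 ≤ r
        go zero          b spans = contradiction (λ (i , x) → proj₂ (spans (rows A i) (generator∈span (rows A) i)) x) A≉0
        go (suc zero)    b spans = contradiction
          (λ (i , x) → trans (A≈′ i x) (Base.rank-one-zero cs a (b zero) multiple i x)) A≉0
          where
          a : Fin 5 → Carrier
          a i = proj₁ (spans (rows A i) (generator∈span (rows A) i)) zero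
          multiple : ∀ i → Base.matrix cs i ≈v (a i ·v b zero)
          multiple i x = trans (sym (A≈′ i x))
            (trans (proj₂ (spans (rows A i) (generator∈span (rows A) i)) x) (+-identityʳ _))
        go (suc (suc r)) b spans = s≤s (s≤s z≤n)

    gen-lifted : ∀ cs A → A ≈v asMatrix cs → ∀ i → Base.gen cs i ≈v liftedRows A i
    gen-lifted cs A e i j with splitAt 5 {m} j in eq
    ... | inj₁ l = ≡.subst (λ j → Base.gen cs i j ≈ (if ⌊ i Fin.≟ l ⌋ then 1# else 0#))
        (≡.trans (base-pivot t l) (Finₚ.splitAt⁻¹-↑ˡ eq)) (trans (Echelon.pivot (Base.gen-echelon cs) i l) (δ-if i l))
      where
      δ-if : ∀ (i l : Fin 5) → δ i l ≈ (if ⌊ i Fin.≟ l ⌋ then 1# else 0#)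
      δ-if i l with i Fin.≟ l
      ... | yes _ = refl
      ... | no  _ = refl
    ... | inj₂ x = ≡.subst (λ j → Base.gen cs i j ≈ A (i , x)) (Finₚ.splitAt⁻¹-↑ʳ {5} eq)
        (trans (Base.gen-ι cs i x) (sym (e (i , x))))

    base-contains : ∀ A → span basis A → ∃ λ g → g ∈ Block.words baseBlock × SameSpace (span g) (span (liftedRows A))
    base-contains A (cs , A≈) = Base.gen (parameters i) , ∈-tabulate⁺ {f = Base.gen ∘ parameters} i ,
      span-cong (gen-lifted (parameters i) A λ ix → trans (A≈ ix) (trans (lincomb-basis cs ix)
        (Linear.cong Linear-asMatrix (λ x → sym (parameters-surjective cs x)) ix)))
      where i = funToFin (to ∘ cs)

    cardinality : List Pivots → ℕ
    cardinality vs = q ℕ.^ ((6 ℕ.+ t) ℕ.* 4) ℕ.+ ListAction.sum (List.map (λ e → q ℕ.^ (4 ℕ.* t ℕ.+ e)) (List.map freedom vs))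

    construction : 1 ≤ t → ∀ {vs} → All Valid vs → AllPairs Separated (basePivots ∷ vs) →
      ∀ N → N ℚ.≤ ℤ.+ cardinality vs ℚ./ 1 → AbarAtLeast 5 m 4 2 N
    construction 1≤t {vs} valid separated N N≤ =
        words
      , All.map (λ {g} → span-dim g) ind
      , (λ i j i≢j → apart⇒distance {g = List.lookup words i} {List.lookup words j} (All.lookup ind (∈-lookup {xs = words} i)) (All.lookup ind (∈-lookup {xs = words} j))
          (AllPairs-lookup (λ {g} {h} → Apart-sym {g = g} {h}) apart i j i≢j))
      , (span basis , isMRD , contains)
      , ≡.subst (λ L → N ℚ.≤ ℤ.+ L ℚ./ 1) (≡.sym words-length) N≤
      where
      Bs : All Block vs
      Bs = pivotBlocks 1≤t valid
      words : List (Generators (11 ℕ.+ t))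
      words = union (baseBlock ∷ Bs)
      ind : All LinIndep words
      ind = union-independent (baseBlock ∷ Bs)
      apart : AllPairs Apart words
      apart = union-apart (baseBlock ∷ Bs) separated
      words-length : length words ≡ cardinality vs
      words-length = ≡.trans (Listₚ.length-++ (Block.words baseBlock))
        (≡.cong₂ ℕ._+_ (code-length (baseFrame t) (baseFrame-isFrame t)) (union-length 1≤t valid))
      contains : ∀ A → span basis A → ∃ λ i → SameSpace (span (List.lookup words i)) (span (liftedRows A))
      contains A A∈ = locate (base-contains A A∈)
        where
        locate : (∃ λ g → g ∈ Block.words baseBlock × SameSpace (span g) (span (liftedRows A))) →
          ∃ λ i → SameSpace (span (List.lookup words i)) (span (liftedRows A))
        locate (g , g∈ , same) = Any.index g∈′ , ≡.subst (λ h → SameSpace (span h) (span (liftedRows A))) (lookup-index g∈′) same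
          where
          g∈′ : g ∈ words
          g∈′ = ∈-++⁺ˡ {xs = Block.words baseBlock} {union Bs} g∈

-- Bounding rationals by natural numbers

module RationalEstimates where
  open import Data.Integer using (ℤ; +_; -[1+_])
  open import Data.Nat using (_⊓_)
  open import Data.Rational using (ℚ; 0ℚ; _+_; _*_; _-_; _/_) renaming (_≤_ to _≤ℚ_)
  open import Relation.Binary.PropositionalEquality hiding (J)
  open ListAction using (sum)
  open ℕSolver using (solve-∀)
  open PivotFrames using (freedom; pivots)

  mutual
    -- The unnamed loop inside sumRange; its only possible value is found by unification in sumRange-loop.
    loop : ℕ → ℕ → (ℕ → ℚ) → ℕ → ℕ → ℚ
    loop = _

    unrolled : ℕ → ℕ → (ℕ → ℚ) → ℕ → ℚ
    unrolled a b f zero    = 0ℚ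
    unrolled a b f (suc w) = f a + loop a b f w (suc a)

    sumRange-loop : ∀ a b f → sumRange a b f ≡ unrolled a b f (suc b ∸ a)
    sumRange-loop a b f with suc b ∸ a
    ... | zero = refl
    -- Naming `suc a` turns the arguments of the loop into variables, as unification needs in order
    -- to solve for `loop`.
    ... | suc w with suc a
    ...   | i = refl

  sumFrom : (ℕ → ℚ) → ℕ → ℕ → ℚ
  sumFrom f zero    i = 0ℚ
  sumFrom f (suc n) i = f i + sumFrom f n (suc i)

  sumRange≡sumFrom : ∀ a b f → sumRange a b f ≡ sumFrom f (suc b ∸ a) a
  sumRange≡sumFrom a b f = trans (sumRange-loop a b f) (step (suc b ∸ a))
    where
    loop≡ : ∀ n i → loop a b f n i ≡ sumFrom f n i
    loop≡ zero    i = refl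
    loop≡ (suc n) i = cong (λ z → f i + z) (loop≡ n (suc i))
    step : ∀ n → unrolled a b f n ≡ sumFrom f n a
    step zero    = refl
    step (suc n) = cong (λ z → f a + z) (loop≡ n (suc a))

  ⟪_⟫ : ℕ → ℚ
  ⟪ n ⟫ = + n / 1

  fraction-≤ : ∀ a d b e → a ℕ.* suc e ≤ b ℕ.* suc d → + a / suc d ≤ℚ + b / suc e
  fraction-≤ a d b e le = ℚₚ.toℚᵘ-cancel-≤
    (ℚᵘₚ.≤-respˡ-≃ (ℚᵘₚ.≃-sym (ℚₚ.toℚᵘ-fromℚᵘ (ℚᵘ.mkℚᵘ (+ a) d)))
      (ℚᵘₚ.≤-respʳ-≃ (ℚᵘₚ.≃-sym (ℚₚ.toℚᵘ-fromℚᵘ (ℚᵘ.mkℚᵘ (+ b) e)))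
        (ℚᵘ.*≤* (subst₂ ℤ._≤_ (ℤₚ.pos-* a (suc e)) (ℤₚ.pos-* b (suc d)) (ℤ.+≤+ le)))))

  ⟪⟫-mono : ∀ {a b} → a ≤ b → ⟪ a ⟫ ≤ℚ ⟪ b ⟫
  ⟪⟫-mono {a} {b} le = fraction-≤ a 0 b 0 (ℕₚ.*-monoˡ-≤ 1 le)

  ⟪⟫-+ : ∀ a b → ⟪ a ⟫ + ⟪ b ⟫ ≡ ⟪ a ℕ.+ b ⟫
  ⟪⟫-+ a b = ℚₚ.toℚᵘ-injective (begin
    ℚ.toℚᵘ (⟪ a ⟫ + ⟪ b ⟫)                          ≈⟨ ℚₚ.toℚᵘ-homo-+ ⟪ a ⟫ ⟪ b ⟫ ⟩
    ℚ.toℚᵘ ⟪ a ⟫ ℚᵘ.+ ℚ.toℚᵘ ⟪ b ⟫                  ≈⟨ ℚᵘₚ.+-cong (ℚₚ.toℚᵘ-fromℚᵘ (ℚᵘ.mkℚᵘ (+ a) 0)) (ℚₚ.toℚᵘ-fromℚᵘ (ℚᵘ.mkℚᵘ (+ b) 0)) ⟩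
    ℚᵘ.mkℚᵘ (+ a) 0 ℚᵘ.+ ℚᵘ.mkℚᵘ (+ b) 0            ≈⟨ ℚᵘ.*≡* (cong (ℤ._* + 1) (cong₂ ℤ._+_ (ℤₚ.*-identityʳ (+ a)) (ℤₚ.*-identityʳ (+ b)))) ⟩
    ℚᵘ.mkℚᵘ (+ (a ℕ.+ b)) 0                         ≈⟨ ℚᵘₚ.≃-sym (ℚₚ.toℚᵘ-fromℚᵘ (ℚᵘ.mkℚᵘ (+ (a ℕ.+ b)) 0)) ⟩
    ℚ.toℚᵘ ⟪ a ℕ.+ b ⟫                              ∎)
    where open ℚᵘₚ.≃-Reasoning

  ⟪⟫-* : ∀ a b → ⟪ a ⟫ * ⟪ b ⟫ ≡ ⟪ a ℕ.* b ⟫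
  ⟪⟫-* a b = ℚₚ.toℚᵘ-injective (begin
    ℚ.toℚᵘ (⟪ a ⟫ * ⟪ b ⟫)                          ≈⟨ ℚₚ.toℚᵘ-homo-* ⟪ a ⟫ ⟪ b ⟫ ⟩
    ℚ.toℚᵘ ⟪ a ⟫ ℚᵘ.* ℚ.toℚᵘ ⟪ b ⟫                  ≈⟨ ℚᵘₚ.*-cong (ℚₚ.toℚᵘ-fromℚᵘ (ℚᵘ.mkℚᵘ (+ a) 0)) (ℚₚ.toℚᵘ-fromℚᵘ (ℚᵘ.mkℚᵘ (+ b) 0)) ⟩
    ℚᵘ.mkℚᵘ (+ a) 0 ℚᵘ.* ℚᵘ.mkℚᵘ (+ b) 0            ≈⟨ ℚᵘ.*≡* (cong (ℤ._* + 1) (sym (ℤₚ.pos-* a b))) ⟩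
    ℚᵘ.mkℚᵘ (+ (a ℕ.* b)) 0                         ≈⟨ ℚᵘₚ.≃-sym (ℚₚ.toℚᵘ-fromℚᵘ (ℚᵘ.mkℚᵘ (+ (a ℕ.* b)) 0)) ⟩
    ℚ.toℚᵘ ⟪ a ℕ.* b ⟫                              ∎)
    where open ℚᵘₚ.≃-Reasoning

  0≤⟪⟫ : ∀ n → 0ℚ ≤ℚ ⟪ n ⟫
  0≤⟪⟫ n = ⟪⟫-mono {0} {n} z≤n

  infix 4 _≲_
  -- The halves, differences and negative powers in M are bounded above only, so each rational
  -- carries a natural bound and all further arithmetic takes place in ℕ.
  record _≲_ (x : ℚ) (n : ℕ) : Set where
    constructor mk≲
    field un≲ : x ≤ℚ ⟪ n ⟫
  open _≲_

  ≲-trans : ∀ {x a b} → x ≲ a → a ≤ b → x ≲ b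
  ≲-trans (mk≲ x≤a) a≤b = mk≲ (ℚₚ.≤-trans x≤a (⟪⟫-mono a≤b))

  +-≲ : ∀ {x y a b} → x ≲ a → y ≲ b → x + y ≲ a ℕ.+ b
  +-≲ {a = a} {b} (mk≲ x≤a) (mk≲ y≤b) = mk≲ (ℚₚ.≤-trans (ℚₚ.+-mono-≤ x≤a y≤b) (ℚₚ.≤-reflexive (⟪⟫-+ a b)))

  *-≲ : ∀ {x y a b} → 0ℚ ≤ℚ x → x ≲ a → y ≲ b → x * y ≲ a ℕ.* b
  *-≲ {x} {y} {a} {b} 0≤x (mk≲ x≤a) (mk≲ y≤b) = mk≲ (begin
    x * y            ≤⟨ ℚₚ.*-monoˡ-≤-nonNeg x {{ℚ.nonNegative 0≤x}} y≤b ⟩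
    x * ⟪ b ⟫        ≤⟨ ℚₚ.*-monoʳ-≤-nonNeg ⟪ b ⟫ {{ℚ.nonNegative (0≤⟪⟫ b)}} x≤a ⟩
    ⟪ a ⟫ * ⟪ b ⟫    ≡⟨ ⟪⟫-* a b ⟩
    ⟪ a ℕ.* b ⟫      ∎)
    where open ℚₚ.≤-Reasoning

  *-≲′ : ∀ {x y a b} → 0ℚ ≤ℚ y → x ≲ a → y ≲ b → x * y ≲ a ℕ.* b
  *-≲′ {x} {y} {a} {b} 0≤y x≤a y≤b =
    subst₂ _≲_ (ℚₚ.*-comm y x) (ℕₚ.*-comm b a) (*-≲ 0≤y y≤b x≤a)

  0≤+ : ∀ {x y} → 0ℚ ≤ℚ x → 0ℚ ≤ℚ y → 0ℚ ≤ℚ x + y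
  0≤+ 0≤x 0≤y = ℚₚ.+-mono-≤ 0≤x 0≤y

  half-≲ : ∀ z C → z ≤ 2 ℕ.* C → half (+ z) ≲ C
  half-≲ z C le = mk≲ (fraction-≤ z 1 C 0 (subst₂ _≤_ (sym (ℕₚ.*-identityʳ z)) (ℕₚ.*-comm 2 C) le))

  minus-≤ : ∀ x i → x - ⟪ i ⟫ ≤ℚ x
  minus-≤ x i = subst (x - ⟪ i ⟫ ≤ℚ_) (ℚₚ.+-identityʳ x) (ℚₚ.+-monoʳ-≤ x (ℚₚ.neg-antimono-≤ (0≤⟪⟫ i)))

  half-minus-≲1 : ∀ z i → z ≤ 2 ℕ.* i ℕ.+ 2 → half (+ z) - ⟪ i ⟫ ≲ 1
  half-minus-≲1 z i le = mk≲ (begin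
    half (+ z) - ⟪ i ⟫          ≤⟨ ℚₚ.+-monoˡ-≤ (ℚ.- ⟪ i ⟫) (un≲ (half-≲ z (1 ℕ.+ i) (ℕₚ.≤-trans le (ℕₚ.≤-reflexive (ring i))))) ⟩
    ⟪ 1 ℕ.+ i ⟫ - ⟪ i ⟫         ≡⟨ cong (_- ⟪ i ⟫) (sym (⟪⟫-+ 1 i)) ⟩
    (⟪ 1 ⟫ + ⟪ i ⟫) - ⟪ i ⟫     ≡⟨ ℚₚ.+-assoc ⟪ 1 ⟫ ⟪ i ⟫ (ℚ.- ⟪ i ⟫) ⟩
    ⟪ 1 ⟫ + (⟪ i ⟫ - ⟪ i ⟫)     ≡⟨ cong (λ z → ⟪ 1 ⟫ + z) (ℚₚ.+-inverseʳ ⟪ i ⟫) ⟩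
    ⟪ 1 ⟫ + 0ℚ                  ≡⟨ ℚₚ.+-identityʳ ⟪ 1 ⟫ ⟩
    ⟪ 1 ⟫                       ∎)
    where
    open ℚₚ.≤-Reasoning
    ring : ∀ i → 2 ℕ.* i ℕ.+ 2 ≡ 2 ℕ.* (1 ℕ.+ i)
    ring = solve-∀

  reciprocal-bounds : ∀ d .{{_ : ℕ.NonZero d}} → 0ℚ ≤ℚ + 1 / d × + 1 / d ≤ℚ ⟪ 1 ⟫
  reciprocal-bounds (suc d) = fraction-≤ 0 0 1 d z≤n , fraction-≤ 1 d 1 0 (s≤s z≤n)

  0≤powZ : ∀ q e → 0ℚ ≤ℚ powZ q e
  0≤powZ q       (+ e)    = 0≤⟪⟫ (q ℕ.^ e)
  0≤powZ zero    -[1+ e ] = ℚₚ.≤-refl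
  0≤powZ (suc q) -[1+ e ] = proj₁ (reciprocal-bounds (suc q ℕ.^ suc e) {{ℕₚ.m^n≢0 (suc q) (suc e)}})

  powZ-≡ : ∀ q {e} A B k → e ≡ + A ℤ.- + B → B ℕ.+ k ≡ A → powZ q e ≡ ⟪ q ℕ.^ k ⟫
  powZ-≡ q {e} A B k eq refl = cong (powZ q) (trans eq (trans (ℤₚ.[+m]-[+n]≡m⊖n (B ℕ.+ k) B)
    (trans (ℤₚ.⊖-≥ (ℕₚ.m≤m+n B k)) (cong +_ (ℕₚ.m+n∸m≡n B k)))))

  -- Truncated subtraction covers negative exponents too: there the right side is q⁰ = 1, and the
  -- power is at most 1.
  powZ-≲ : ∀ q {e} A B → 1 ≤ q → e ≡ + A ℤ.- + B → powZ q e ≲ q ℕ.^ (A ∸ B)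
  powZ-≲ q {e} A B 1≤q eq with B ℕₚ.≤? A
  ... | yes B≤A = mk≲ (ℚₚ.≤-reflexive (powZ-≡ q A B (A ∸ B) eq (ℕₚ.m+[n∸m]≡n B≤A)))
  ... | no  B≰A = subst (λ e → powZ q e ≲ q ℕ.^ (A ∸ B)) (sym (trans eq negative))
      (≲-trans (≲1 q 1≤q (B ∸ suc A)) (ℕₚ.m^n>0 q {{ℕ.>-nonZero 1≤q}} (A ∸ B)))
    where
    A<B = ℕₚ.≰⇒> B≰A
    negative : + A ℤ.- + B ≡ -[1+ B ∸ suc A ]
    negative = trans (ℤₚ.[+m]-[+n]≡m⊖n A B) (trans (ℤₚ.⊖-< A<B)
      (cong (λ k → ℤ.- (+ k)) (ℕₚ.+-∸-assoc 1 A<B)))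
    ≲1 : ∀ q → 1 ≤ q → ∀ e → powZ q -[1+ e ] ≲ 1
    ≲1 (suc q) _ e = mk≲ (proj₂ (reciprocal-bounds (suc q ℕ.^ suc e) {{ℕₚ.m^n≢0 (suc q) (suc e)}}))

  -- `h i` majorises the tail of the sum from i on. The last term is treated alone, since `step`
  -- says nothing about `h` beyond b.
  sumFrom-≲ : ∀ (f : ℕ → ℚ) (g h : ℕ → ℕ) a b →
    (∀ i → a ≤ i → i ≤ b → f i ≲ g i) →
    (∀ i → a ≤ i → i ≤ b → g i ≤ h i) →
    (∀ i → a ≤ i → suc i ≤ b → g i ℕ.+ h (suc i) ≤ h i) →
    ∀ n i → a ≤ i → i ℕ.+ n ≤ suc b → sumFrom f n i ≲ h i
  sumFrom-≲ f g h a b f≲g g≤h step zero          i a≤i le = mk≲ (0≤⟪⟫ (h i))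
  sumFrom-≲ f g h a b f≲g g≤h step (suc zero)    i a≤i le =
    subst (_≲ h i) (sym (ℚₚ.+-identityʳ (f i))) (≲-trans (f≲g i a≤i i≤b) (g≤h i a≤i i≤b))
    where i≤b = ℕₚ.≤-pred (subst (_≤ suc b) (ℕₚ.+-comm i 1) le)
  sumFrom-≲ f g h a b f≲g g≤h step (suc (suc n)) i a≤i le =
    ≲-trans (+-≲ (f≲g i a≤i (ℕₚ.≤-trans (ℕₚ.n≤1+n i) i<b))
      (sumFrom-≲ f g h a b f≲g g≤h step (suc n) (suc i) (ℕₚ.m≤n⇒m≤1+n a≤i) le′)) (step i a≤i i<b)
    where
    le′ : suc i ℕ.+ suc n ≤ suc b
    le′ = subst (_≤ suc b) (ℕₚ.+-suc i (suc n)) le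
    i<b : suc i ≤ b
    i<b = ℕₚ.≤-trans (s≤s (ℕₚ.m≤m+n i n)) (ℕₚ.≤-pred (subst (_≤ suc b) (cong suc (ℕₚ.+-suc i n)) le′))

  sumRange-≲ : ∀ (f : ℕ → ℚ) (g h : ℕ → ℕ) a b →
    (∀ i → a ≤ i → i ≤ b → f i ≲ g i) →
    (∀ i → a ≤ i → i ≤ b → g i ≤ h i) →
    (∀ i → a ≤ i → suc i ≤ b → g i ℕ.+ h (suc i) ≤ h i) →
    sumRange a b f ≲ h a
  sumRange-≲ f g h a b f≲g g≤h step with a ℕₚ.≤? suc b
  ... | yes a≤1+b = subst (_≲ h a) (sym (sumRange≡sumFrom a b f))
    (sumFrom-≲ f g h a b f≲g g≤h step (suc b ∸ a) a ℕₚ.≤-refl (ℕₚ.≤-reflexive (ℕₚ.m+[n∸m]≡n a≤1+b)))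
  ... | no  a≰1+b = subst (_≲ h a) (sym (trans (sumRange≡sumFrom a b f)
      (cong (λ n → sumFrom f n a) (ℕₚ.m≤n⇒m∸n≡0 (ℕₚ.<⇒≤ (ℕₚ.≰⇒> a≰1+b)))))) (mk≲ (0≤⟪⟫ (h a)))

  ≲-resp : ∀ {x a b} → a ≡ b → x ≲ a → x ≲ b
  ≲-resp refl x≲a = x≲a

  -- Estimates for the single terms of M

  module Bounds (q : ℕ) (2≤q : 2 ≤ q) where

    1≤q : 1 ≤ q
    1≤q = ℕₚ.≤-trans (s≤s z≤n) 2≤q

    instance
      q≢0 : ℕ.NonZero q
      q≢0 = ℕ.>-nonZero 1≤q

    1+n≤q^n : ∀ n → suc n ≤ q ℕ.^ n
    1+n≤q^n zero    = ℕₚ.≤-refl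
    1+n≤q^n (suc n) = begin
      suc (suc n)         ≤⟨ ℕₚ.m≤m+n (suc (suc n)) n ⟩
      suc (suc n) ℕ.+ n   ≡⟨ ring n ⟩
      2 ℕ.* suc n         ≤⟨ ℕₚ.*-mono-≤ 2≤q (1+n≤q^n n) ⟩
      q ℕ.* q ℕ.^ n       ∎
      where
      open ℕₚ.≤-Reasoning
      ring : ∀ n → suc (suc n) ℕ.+ n ≡ 2 ℕ.* suc n
      ring = solve-∀

    -- Turns the linear factors (x - c) / 2 of M into powers of q.
    ≤2q^ : ∀ z D → z ≤ 2 ℕ.* suc D → z ≤ 2 ℕ.* q ℕ.^ D
    ≤2q^ z D le = ℕₚ.≤-trans le (ℕₚ.*-monoʳ-≤ 2 (1+n≤q^n D))

    -- If the exponent A - 2 i is nonnegative, the coefficient is bounded by z / 2 alone. Otherwise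
    -- the power of q is at most 1, and z ≤ A + 3 with A < 2 i makes the coefficient at most 1.
    minus-half-≲ : ∀ z i A D E {y e} → y ≡ + z → e ≡ + A ℤ.- + (2 ℕ.* i) →
      z ≤ 2 ℕ.* q ℕ.^ D → z ≤ A ℕ.+ 3 → D ℕ.+ A ≤ E ℕ.+ 2 ℕ.* i →
      (half y - ⟪ i ⟫) * powZ q e ≲ q ℕ.^ E
    minus-half-≲ z i A D E {y} {e} refl eq z≤ z≤A D+A≤ with 2 ℕ.* i ℕₚ.≤? A
    ... | yes 2i≤A = ≲-trans
        (*-≲′ {a = q ℕ.^ D} (0≤powZ q e) (mk≲ (ℚₚ.≤-trans (minus-≤ (half (+ z)) i) (_≲_.un≲ (half-≲ z (q ℕ.^ D) z≤)))) (powZ-≲ q A (2 ℕ.* i) 1≤q eq))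
        (ℕₚ.≤-trans (ℕₚ.≤-reflexive (sym (ℕₚ.^-distribˡ-+-* q D (A ∸ 2 ℕ.* i)))) (ℕₚ.^-monoʳ-≤ q
          (ℕₚ.+-cancelʳ-≤ (2 ℕ.* i) (D ℕ.+ (A ∸ 2 ℕ.* i)) E (subst (_≤ E ℕ.+ 2 ℕ.* i)
            (trans (cong (D ℕ.+_) (sym (ℕₚ.m∸n+n≡m 2i≤A))) (sym (ℕₚ.+-assoc D (A ∸ 2 ℕ.* i) (2 ℕ.* i)))) D+A≤))))
    ... | no  2i≰A = ≲-trans
        (*-≲′ (0≤powZ q e) (half-minus-≲1 z i (ℕₚ.≤-trans z≤A A+3≤)) (powZ-≲ q A (2 ℕ.* i) 1≤q eq))
        (ℕₚ.≤-trans (ℕₚ.≤-reflexive (trans (ℕₚ.*-identityˡ _) (cong (q ℕ.^_) (ℕₚ.m≤n⇒m∸n≡0 (ℕₚ.<⇒≤ A<2i))))) (ℕₚ.m^n>0 q E))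
      where
      A<2i = ℕₚ.≰⇒> 2i≰A
      A+3≤ : A ℕ.+ 3 ≤ 2 ℕ.* i ℕ.+ 2
      A+3≤ = ℕₚ.≤-trans (ℕₚ.≤-reflexive (ℕₚ.+-suc A 2)) (ℕₚ.+-monoˡ-≤ 2 A<2i)

    module At (t : ℕ) (1≤t : 1 ≤ t) where

      -- The unit of measure: every bracket of M is at most T times a polynomial in q that does not
      -- depend on t.
      T : ℕ
      T = q ℕ.^ (2 ℕ.* t)

      double : + 2 ℤ.* + (11 ℕ.+ t) ≡ + (22 ℕ.+ 2 ℕ.* t)
      double = trans (sym (ℤₚ.pos-* 2 (11 ℕ.+ t))) (cong +_ (ring t))
        where ring : ∀ t → 2 ℕ.* (11 ℕ.+ t) ≡ 22 ℕ.+ 2 ℕ.* t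
              ring = solve-∀

      pow2x : ∀ d k → d ℕ.+ k ≡ 22 → powZ q (+ 2 ℤ.* + (11 ℕ.+ t) ℤ.- + d) ≡ ⟪ T ℕ.* q ℕ.^ k ⟫
      pow2x d k e = trans (powZ-≡ q (22 ℕ.+ 2 ℕ.* t) d (2 ℕ.* t ℕ.+ k) (cong (ℤ._- + d) double)
          (trans (ring d k (2 ℕ.* t)) (cong (ℕ._+ 2 ℕ.* t) e)))
        (cong ⟪_⟫ (ℕₚ.^-distribˡ-+-* q (2 ℕ.* t) k))
        where ring : ∀ d k s → d ℕ.+ (s ℕ.+ k) ≡ d ℕ.+ k ℕ.+ s
              ring = solve-∀

      pow2x-≲ : ∀ d k → d ℕ.+ k ≡ 22 → powZ q (+ 2 ℤ.* + (11 ℕ.+ t) ℤ.- + d) ≲ T ℕ.* q ℕ.^ k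
      pow2x-≲ d k e = mk≲ (ℚₚ.≤-reflexive (pow2x d k e))

      x-minus : ∀ d k → d ℕ.+ k ≡ 11 → + (11 ℕ.+ t) ℤ.- + d ≡ + (k ℕ.+ t)
      x-minus d k e = trans (cong (λ n → + (n ℕ.+ t) ℤ.- + d) (sym e)) (trans (ℤₚ.[+m]-[+n]≡m⊖n (d ℕ.+ k ℕ.+ t) d)
        (trans (ℤₚ.⊖-≥ (ℕₚ.≤-trans (ℕₚ.m≤m+n d k) (ℕₚ.m≤m+n (d ℕ.+ k) t)))
          (cong +_ (trans (cong (_∸ d) (ℕₚ.+-assoc d k t)) (ℕₚ.m+n∸m≡n d (k ℕ.+ t))))))

      powx-≲ : ∀ d k → d ℕ.+ k ≡ 11 → powZ q (+ (11 ℕ.+ t) ℤ.- + d) ≲ q ℕ.^ (k ℕ.+ t)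
      powx-≲ d k e = mk≲ (ℚₚ.≤-reflexive (cong (powZ q) (x-minus d k e)))

      halfx-≲ : ∀ d k D → d ℕ.+ k ≡ 11 → k ℕ.+ t ≤ 2 ℕ.* suc D → half (+ (11 ℕ.+ t) ℤ.- + d) ≲ q ℕ.^ D
      halfx-≲ d k D e le = subst (λ y → half y ≲ q ℕ.^ D) (sym (x-minus d k e)) (half-≲ (k ℕ.+ t) (q ℕ.^ D) (≤2q^ (k ℕ.+ t) D le))

      halfpow-≲ : ∀ d k d′ k′ D E → d ℕ.+ k ≡ 11 → d′ ℕ.+ k′ ≡ 11 → k ℕ.+ t ≤ 2 ℕ.* suc D →
        D ℕ.+ (k′ ℕ.+ t) ≡ 2 ℕ.* t ℕ.+ E →
        half (+ (11 ℕ.+ t) ℤ.- + d) * powZ q (+ (11 ℕ.+ t) ℤ.- + d′) ≲ T ℕ.* q ℕ.^ E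
      halfpow-≲ d k d′ k′ D E e e′ le eq = ≲-resp
        (trans (sym (ℕₚ.^-distribˡ-+-* q D (k′ ℕ.+ t))) (trans (cong (q ℕ.^_) eq) (ℕₚ.^-distribˡ-+-* q (2 ℕ.* t) E)))
        (*-≲′ (0≤powZ q (+ (11 ℕ.+ t) ℤ.- + d′)) (halfx-≲ d k D e le) (powx-≲ d′ k′ e′))

      E₁ E₂ : ℕ → ℕ
      E₁ i = (6 ℕ.+ 2 ℕ.* t) ∸ 2 ℕ.* i
      E₂ i = (5 ℕ.+ 2 ℕ.* t) ∸ 2 ℕ.* i

      -- One majorant for both parities of x: the main term is i q⁴ q^E, since 2x - 2i - 12 = 4 + E₁
      -- and 2x - 2i - 13 = 4 + E₂, and the 2 stands for the one (even x) or two (odd x) smaller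
      -- terms.
      g₁ g₂ : ℕ → ℕ
      g₁ i = (i ℕ.* q ℕ.^ 4 ℕ.+ 2) ℕ.* q ℕ.^ E₁ i
      g₂ i = (i ℕ.* q ℕ.^ 4 ℕ.+ 2) ℕ.* q ℕ.^ E₂ i

      toQ-pow-≲ : ∀ c d i → c ℕ.+ d ≡ 18 → 2 ℕ.* i ≤ c ℕ.+ 2 ℕ.* t →
        toQ (+ i) * powZ q (+ 2 ℤ.* + (11 ℕ.+ t) ℤ.- + (2 ℕ.* i) ℤ.- + d) ≲
        i ℕ.* q ℕ.^ 4 ℕ.* q ℕ.^ (c ℕ.+ 2 ℕ.* t ∸ 2 ℕ.* i)
      toQ-pow-≲ c d i c+d le = ≲-resp
        (trans (cong (i ℕ.*_) (trans (ℕₚ.^-distribˡ-+-* q 4 E) refl)) (sym (ℕₚ.*-assoc i (q ℕ.^ 4) (q ℕ.^ E))))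
        (*-≲ {a = i} {q ℕ.^ (4 ℕ.+ E)} (0≤⟪⟫ i) (mk≲ ℚₚ.≤-refl) (mk≲ (ℚₚ.≤-reflexive (powZ-≡ q (22 ℕ.+ 2 ℕ.* t) (2 ℕ.* i ℕ.+ d) (4 ℕ.+ E) exponent total))))
        where
        E = c ℕ.+ 2 ℕ.* t ∸ 2 ℕ.* i
        exponent : + 2 ℤ.* + (11 ℕ.+ t) ℤ.- + (2 ℕ.* i) ℤ.- + d ≡ + (22 ℕ.+ 2 ℕ.* t) ℤ.- + (2 ℕ.* i ℕ.+ d)
        exponent = trans (cong (λ z → z ℤ.- + (2 ℕ.* i) ℤ.- + d) double) (trans (ring (+ (22 ℕ.+ 2 ℕ.* t)) (+ (2 ℕ.* i)) (+ d))
          (cong (λ z → + (22 ℕ.+ 2 ℕ.* t) ℤ.- z) (sym (ℤₚ.pos-+ (2 ℕ.* i) d))))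
          where ring : ∀ a b c → a ℤ.- b ℤ.- c ≡ a ℤ.- (b ℤ.+ c)
                ring = ℤSolver.solve-∀
        total : 2 ℕ.* i ℕ.+ d ℕ.+ (4 ℕ.+ E) ≡ 22 ℕ.+ 2 ℕ.* t
        total = trans (ring₁ (2 ℕ.* i) d E) (trans (cong (λ z → 4 ℕ.+ d ℕ.+ z) (ℕₚ.m+[n∸m]≡n le))
          (trans (ring₂ c d (2 ℕ.* t)) (cong (λ z → 4 ℕ.+ z ℕ.+ 2 ℕ.* t) c+d)))
          where ring₁ : ∀ a d e → a ℕ.+ d ℕ.+ (4 ℕ.+ e) ≡ 4 ℕ.+ d ℕ.+ (a ℕ.+ e)
                ring₁ = solve-∀
                ring₂ : ∀ c d s → 4 ℕ.+ d ℕ.+ (c ℕ.+ s) ≡ 4 ℕ.+ (c ℕ.+ d) ℕ.+ s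
                ring₂ = solve-∀

      x-minus-i : ∀ d k (b : ℤ) → d ℕ.+ k ≡ 11 → + (11 ℕ.+ t) ℤ.- b ℤ.- + d ≡ + (k ℕ.+ t) ℤ.- b
      x-minus-i d k b e = trans (ring (+ (11 ℕ.+ t)) b (+ d)) (cong (ℤ._- b) (x-minus d k e))
        where ring : ∀ a b c → a ℤ.- b ℤ.- c ≡ a ℤ.- c ℤ.- b
              ring = ℤSolver.solve-∀

      -- 2 i is at most 6 + t, so it may exceed the exponent A = k + t of the second summand,
      -- but then the coefficient z / 2 − i is at most 1.
      coefficient-≲ : ∀ c dz kz d k i D → dz ℕ.+ kz ≡ 11 → d ℕ.+ k ≡ 11 →
        kz ℕ.+ t ≤ 2 ℕ.* suc D → kz ≤ k ℕ.+ 3 → D ℕ.+ (k ℕ.+ t) ≡ c ℕ.+ 2 ℕ.* t →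
        2 ℕ.* i ≤ c ℕ.+ 2 ℕ.* t →
        (half (+ (11 ℕ.+ t) ℤ.- + dz) - toQ (+ i)) * powZ q (+ (11 ℕ.+ t) ℤ.- + (2 ℕ.* i) ℤ.- + d) ≲
        q ℕ.^ (c ℕ.+ 2 ℕ.* t ∸ 2 ℕ.* i)
      coefficient-≲ c dz kz d k i D ez e z≤ kz≤ D+A le = minus-half-≲ (kz ℕ.+ t) i (k ℕ.+ t) D (c ℕ.+ 2 ℕ.* t ∸ 2 ℕ.* i)
        (x-minus dz kz ez) (x-minus-i d k (+ (2 ℕ.* i)) e) (≤2q^ (kz ℕ.+ t) D z≤)
        (ℕₚ.≤-trans (ℕₚ.+-monoˡ-≤ t kz≤) (ℕₚ.≤-reflexive (ring k t)))
        (ℕₚ.≤-reflexive (trans D+A (sym (ℕₚ.m∸n+n≡m le))))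
        where ring : ∀ k t → k ℕ.+ 3 ℕ.+ t ≡ k ℕ.+ t ℕ.+ 3
              ring = solve-∀

      -- What the x-dependent parts of the summation limits say for x = 11 + t.
      Small₁ Small₂ : ℕ → Set
      Small₁ i = 2 ℕ.* i ≤ 6 ℕ.+ t
      Small₂ i = 2 ℕ.* i ≤ 5 ℕ.+ t

      widen : ∀ c {n} → n ≤ c ℕ.+ t → n ≤ c ℕ.+ 2 ℕ.* t
      widen c le = ℕₚ.≤-trans le (ℕₚ.+-monoʳ-≤ c (ℕₚ.m≤m+n t (t ℕ.+ 0)))

      private
        P : ℤ → ℚ
        P = powZ q
        X : ℤ
        X = + (11 ℕ.+ t)

      sum-bound : ∀ i e → i ℕ.* q ℕ.^ 4 ℕ.* q ℕ.^ e ℕ.+ q ℕ.^ e ≤ (i ℕ.* q ℕ.^ 4 ℕ.+ 2) ℕ.* q ℕ.^ e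
      sum-bound i e = ℕₚ.≤-trans (ℕₚ.m≤m+n _ (q ℕ.^ e)) (ℕₚ.≤-reflexive (ring (i ℕ.* q ℕ.^ 4) (q ℕ.^ e)))
        where ring : ∀ a b → a ℕ.* b ℕ.+ b ℕ.+ b ≡ (a ℕ.+ 2) ℕ.* b
              ring = solve-∀

      sum-bound₂ : ∀ i e → i ℕ.* q ℕ.^ 4 ℕ.* q ℕ.^ e ℕ.+ q ℕ.^ e ℕ.+ q ℕ.^ e ≤ (i ℕ.* q ℕ.^ 4 ℕ.+ 2) ℕ.* q ℕ.^ e
      sum-bound₂ i e = ℕₚ.≤-reflexive (ring (i ℕ.* q ℕ.^ 4) (q ℕ.^ e))
        where ring : ∀ a b → a ℕ.* b ℕ.+ b ℕ.+ b ≡ (a ℕ.+ 2) ℕ.* b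
              ring = solve-∀

      ≤2* : ∀ a b c → a ℕ.+ c ≡ 2 ℕ.* b → a ≤ 2 ℕ.* b
      ≤2* a b c e = ℕₚ.≤-trans (ℕₚ.m≤m+n a c) (ℕₚ.≤-reflexive e)

      even₁-≲ : ∀ i → Small₁ i →
        toQ (+ i) * P (+ 2 ℤ.* X ℤ.- + (2 ℕ.* i) ℤ.- + 12) + (half (X ℤ.- + 6) - toQ (+ i)) * P (X ℤ.- + (2 ℕ.* i) ℤ.- + 7) ≲ g₁ i
      even₁-≲ i s = ≲-trans (+-≲ (toQ-pow-≲ 6 12 i refl (widen 6 s))
        (coefficient-≲ 6 6 5 7 4 i (2 ℕ.+ t) refl refl (≤2* (5 ℕ.+ t) (3 ℕ.+ t) (t ℕ.+ 1) (r₁ t)) (ℕₚ.m≤m+n 5 2) (r₂ t) (widen 6 s)))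
        (sum-bound i (E₁ i))
        where r₁ : ∀ t → 5 ℕ.+ t ℕ.+ (t ℕ.+ 1) ≡ 2 ℕ.* suc (2 ℕ.+ t)
              r₁ = solve-∀
              r₂ : ∀ t → 2 ℕ.+ t ℕ.+ (4 ℕ.+ t) ≡ 6 ℕ.+ 2 ℕ.* t
              r₂ = solve-∀

      even₂-≲ : ∀ i → Small₂ i →
        toQ (+ i) * P (+ 2 ℤ.* X ℤ.- + (2 ℕ.* i) ℤ.- + 13) + (half (X ℤ.- + 6) - toQ (+ i)) * P (X ℤ.- + (2 ℕ.* i) ℤ.- + 8) ≲ g₂ i
      even₂-≲ i s = ≲-trans (+-≲ (toQ-pow-≲ 5 13 i refl (widen 5 s))
        (coefficient-≲ 5 6 5 8 3 i (2 ℕ.+ t) refl refl (≤2* (5 ℕ.+ t) (3 ℕ.+ t) (t ℕ.+ 1) (r₁ t)) (ℕₚ.m≤m+n 5 1) (r₂ t) (widen 5 s)))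
        (sum-bound i (E₂ i))
        where r₁ : ∀ t → 5 ℕ.+ t ℕ.+ (t ℕ.+ 1) ≡ 2 ℕ.* suc (2 ℕ.+ t)
              r₁ = solve-∀
              r₂ : ∀ t → 2 ℕ.+ t ℕ.+ (3 ℕ.+ t) ≡ 5 ℕ.+ 2 ℕ.* t
              r₂ = solve-∀

      2*half≤ : ∀ n → 2 ℕ.* (n ℕ./ 2) ≤ n
      2*half≤ n = ℕₚ.≤-trans (ℕₚ.≤-reflexive (ℕₚ.*-comm 2 (n ℕ./ 2))) (DivMod.m/n*n≤m n 2)

      odd₁-≲ : ∀ i → Small₁ i →
        toQ (+ i) * P (+ 2 ℤ.* X ℤ.- + (2 ℕ.* i) ℤ.- + 12) + (half (X ℤ.- + 7) - toQ (+ i)) * P (X ℤ.- + (2 ℕ.* i) ℤ.- + 6)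
          + P (+ ((11 ℕ.+ t ∸ 7) ℕ./ 2) ℤ.- + i) ≲ g₁ i
      odd₁-≲ i s = ≲-trans (+-≲ (+-≲ (toQ-pow-≲ 6 12 i refl (widen 6 s))
          (coefficient-≲ 6 7 4 6 5 i (1 ℕ.+ t) refl refl (≤2* (4 ℕ.+ t) (2 ℕ.+ t) t (r₁ t)) (ℕₚ.m≤m+n 4 4) (r₂ t) (widen 6 s)))
          (≲-trans (powZ-≲ q a i 1≤q refl) (ℕₚ.^-monoʳ-≤ q a-i≤)))
        (sum-bound₂ i (E₁ i))
        where
        a = (4 ℕ.+ t) ℕ./ 2
        r₁ : ∀ t → 4 ℕ.+ t ℕ.+ t ≡ 2 ℕ.* suc (1 ℕ.+ t)
        r₁ = solve-∀
        r₂ : ∀ t → 1 ℕ.+ t ℕ.+ (5 ℕ.+ t) ≡ 6 ℕ.+ 2 ℕ.* t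
        r₂ = solve-∀
        a-i≤ : a ∸ i ≤ E₁ i
        a-i≤ with i ℕₚ.≤? a
        ... | no  i≰a = ℕₚ.≤-trans (ℕₚ.≤-reflexive (ℕₚ.m≤n⇒m∸n≡0 (ℕₚ.<⇒≤ (ℕₚ.≰⇒> i≰a)))) z≤n
        ... | yes i≤a = ℕₚ.+-cancelʳ-≤ (2 ℕ.* i) (a ∸ i) (E₁ i) (begin
          a ∸ i ℕ.+ 2 ℕ.* i      ≡⟨ cong (a ∸ i ℕ.+_) (cong (i ℕ.+_) (ℕₚ.+-identityʳ i)) ⟩
          a ∸ i ℕ.+ (i ℕ.+ i)    ≡⟨ sym (ℕₚ.+-assoc (a ∸ i) i i) ⟩
          a ∸ i ℕ.+ i ℕ.+ i      ≡⟨ cong (ℕ._+ i) (ℕₚ.m∸n+n≡m i≤a) ⟩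
          a ℕ.+ i                  ≤⟨ ℕₚ.+-monoʳ-≤ a i≤a ⟩
          a ℕ.+ a                  ≡⟨ cong (a ℕ.+_) (sym (ℕₚ.+-identityʳ a)) ⟩
          2 ℕ.* a                  ≤⟨ 2*half≤ (4 ℕ.+ t) ⟩
          4 ℕ.+ t                  ≤⟨ widen 4 ℕₚ.≤-refl ⟩
          4 ℕ.+ 2 ℕ.* t            ≤⟨ ℕₚ.m≤n+m _ 2 ⟩
          6 ℕ.+ 2 ℕ.* t            ≡⟨ sym (ℕₚ.m∸n+n≡m (widen 6 s)) ⟩
          E₁ i ℕ.+ 2 ℕ.* i         ∎)
          where open ℕₚ.≤-Reasoning

      -- For t = 1 and i = 3 the last power would exceed q^(E₂ i). Odd x means even t, whence 2 ≤ t.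
      odd₂-≲ : 2 ≤ t → ∀ i → Small₂ i →
        toQ (+ i) * P (+ 2 ℤ.* X ℤ.- + (2 ℕ.* i) ℤ.- + 13) + (half (X ℤ.- + 7) - toQ (+ i)) * P (X ℤ.- + (2 ℕ.* i) ℤ.- + 7)
          + P (X ℤ.- + i ℤ.- + 7) ≲ g₂ i
      odd₂-≲ 2≤t i s = ≲-trans (+-≲ (+-≲ (toQ-pow-≲ 5 13 i refl (widen 5 s))
          (coefficient-≲ 5 7 4 7 4 i (1 ℕ.+ t) refl refl (≤2* (4 ℕ.+ t) (2 ℕ.+ t) t (r₁ t)) (ℕₚ.m≤m+n 4 3) (r₂ t) (widen 5 s)))
          (≲-trans (powZ-≲ q (4 ℕ.+ t) i 1≤q (x-minus-i 7 4 (+ i) refl)) (ℕₚ.^-monoʳ-≤ q bound-i)))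
        (sum-bound₂ i (E₂ i))
        where
        r₁ : ∀ t → 4 ℕ.+ t ℕ.+ t ≡ 2 ℕ.* suc (1 ℕ.+ t)
        r₁ = solve-∀
        r₂ : ∀ t → 1 ℕ.+ t ℕ.+ (4 ℕ.+ t) ≡ 5 ℕ.+ 2 ℕ.* t
        r₂ = solve-∀
        i≤1+t : i ≤ 1 ℕ.+ t
        i≤1+t with i ℕₚ.≤? 1 ℕ.+ t
        ... | yes le = le
        ... | no nle = contradiction (begin
          6 ℕ.+ t                 ≤⟨ ℕₚ.+-monoˡ-≤ t (ℕₚ.+-monoʳ-≤ 4 2≤t) ⟩
          4 ℕ.+ t ℕ.+ t           ≡⟨ r₃ t ⟩
          2 ℕ.* (2 ℕ.+ t)         ≤⟨ ℕₚ.*-monoʳ-≤ 2 (ℕₚ.≰⇒> nle) ⟩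
          2 ℕ.* i                 ≤⟨ s ⟩
          5 ℕ.+ t                 ∎) (ℕₚ.<-irrefl refl)
          where
          open ℕₚ.≤-Reasoning
          r₃ : ∀ t → 4 ℕ.+ t ℕ.+ t ≡ 2 ℕ.* (2 ℕ.+ t)
          r₃ = solve-∀
        bound-i : (4 ℕ.+ t) ∸ i ≤ E₂ i
        bound-i = ℕₚ.+-cancelʳ-≤ (2 ℕ.* i) _ (E₂ i) (begin
          (4 ℕ.+ t) ∸ i ℕ.+ 2 ℕ.* i     ≡⟨ cong ((4 ℕ.+ t) ∸ i ℕ.+_) (cong (i ℕ.+_) (ℕₚ.+-identityʳ i)) ⟩
          (4 ℕ.+ t) ∸ i ℕ.+ (i ℕ.+ i)   ≡⟨ sym (ℕₚ.+-assoc ((4 ℕ.+ t) ∸ i) i i) ⟩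
          (4 ℕ.+ t) ∸ i ℕ.+ i ℕ.+ i     ≡⟨ cong (ℕ._+ i) (ℕₚ.m∸n+n≡m (ℕₚ.≤-trans i≤1+t (ℕₚ.+-monoˡ-≤ t (s≤s z≤n)))) ⟩
          4 ℕ.+ t ℕ.+ i                   ≤⟨ ℕₚ.+-monoʳ-≤ (4 ℕ.+ t) i≤1+t ⟩
          4 ℕ.+ t ℕ.+ (1 ℕ.+ t)           ≡⟨ r₄ t ⟩
          5 ℕ.+ 2 ℕ.* t                   ≡⟨ sym (ℕₚ.m∸n+n≡m (widen 5 s)) ⟩
          E₂ i ℕ.+ 2 ℕ.* i                ∎)
          where
          open ℕₚ.≤-Reasoning
          r₄ : ∀ t → 4 ℕ.+ t ℕ.+ (1 ℕ.+ t) ≡ 5 ℕ.+ 2 ℕ.* t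
          r₄ = solve-∀

  -- Reduction to a polynomial inequality in q

  module Comparison (q : ℕ) (2≤q : 2 ≤ q) where
    open Bounds q 2≤q

    -- A bound for M(11 + t) divided by T² = q^(4t), bracket by bracket, with `s` in place of the
    -- two inner sums divided by T.
    U : ℕ → ℕ
    U s = q ℕ.^ 24 ℕ.+ (q ℕ.^ 12 ℕ.+ q ℕ.^ 8) ℕ.* (q ℕ.^ 8 ℕ.+ q ℕ.^ 2 ℕ.+ 1)
      ℕ.+ (q ℕ.^ 11 ℕ.+ q ℕ.^ 9) ℕ.* (q ℕ.^ 7 ℕ.+ 2 ℕ.* q)
      ℕ.+ (q ℕ.^ 10 ℕ.+ q ℕ.^ 9) ℕ.* (2 ℕ.* q ℕ.^ 6 ℕ.+ 2)
      ℕ.+ (q ℕ.^ 10 ℕ.+ q ℕ.^ 8) ℕ.* s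

    -- The number of codewords divided by q^(4t).
    codeSize : ℕ
    codeSize = q ℕ.^ 24 ℕ.+ sum (List.map (q ℕ.^_) (List.map freedom pivots))

    module AtLength (t : ℕ) (1≤t : 1 ≤ t) where
      open At t 1≤t

      top₁ top₂ : ℕ
      top₁ = ((q ℕ.+ 1) ℕ./ 2 ℕ.+ 2) ⊓ ((6 ℕ.+ t) ℕ./ 2)
      top₂ = (q ℕ./ 2 ℕ.+ 2) ⊓ ((5 ℕ.+ t) ℕ./ 2)

      -- Stated for arbitrary summands below `g₁` and `g₂`, so that both parities of x share it; the
      -- value of `s` depends on q.
      RangeBound : ℕ → Set
      RangeBound s = ∀ f₁ f₂ → (∀ i → Small₁ i → f₁ i ≲ g₁ i) → (∀ i → Small₂ i → f₂ i ≲ g₂ i) →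
        sumRange 3 top₁ f₁ + sumRange 2 top₂ f₂ ≲ T ℕ.* s

      small₁ : ∀ i → i ≤ top₁ → Small₁ i
      small₁ i le = ℕₚ.≤-trans (ℕₚ.*-monoʳ-≤ 2 (ℕₚ.≤-trans le (ℕₚ.m⊓n≤n ((q ℕ.+ 1) ℕ./ 2 ℕ.+ 2) _))) (2*half≤ (6 ℕ.+ t))

      small₂ : ∀ i → i ≤ top₂ → Small₂ i
      small₂ i le = ℕₚ.≤-trans (ℕₚ.*-monoʳ-≤ 2 (ℕₚ.≤-trans le (ℕₚ.m⊓n≤n (q ℕ./ 2 ℕ.+ 2) _))) (2*half≤ (5 ℕ.+ t))

      private
        P : ℤ → ℚ
        P = powZ q
        X : ℤ
        X = + (11 ℕ.+ t)

      0≤P+P : ∀ a b → 0ℚ ≤ℚ P a + P b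
      0≤P+P a b = 0≤+ (0≤powZ q a) (0≤powZ q b)

      pow4x-≲ : P (+ 4 ℤ.* (X ℤ.- + 5)) ≲ T ℕ.* T ℕ.* q ℕ.^ 24
      pow4x-≲ = mk≲ (ℚₚ.≤-reflexive (trans (cong P (trans (cong (λ z → + 4 ℤ.* z) (x-minus 5 6 refl)) (sym (ℤₚ.pos-* 4 (6 ℕ.+ t)))))
        (cong ⟪_⟫ (trans (cong (q ℕ.^_) (ring t)) (trans (ℕₚ.^-distribˡ-+-* q (2 ℕ.* t ℕ.+ 2 ℕ.* t) 24)
          (cong (ℕ._* q ℕ.^ 24) (ℕₚ.^-distribˡ-+-* q (2 ℕ.* t) (2 ℕ.* t))))))))
        where ring : ∀ t → 4 ℕ.* (6 ℕ.+ t) ≡ 2 ℕ.* t ℕ.+ 2 ℕ.* t ℕ.+ 24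
              ring = solve-∀

      factor-≲ : ∀ d d′ k k′ → d ℕ.+ k ≡ 22 → d′ ℕ.+ k′ ≡ 22 →
        P (+ 2 ℤ.* X ℤ.- + d) + P (+ 2 ℤ.* X ℤ.- + d′) ≲ T ℕ.* (q ℕ.^ k ℕ.+ q ℕ.^ k′)
      factor-≲ d d′ k k′ e e′ = ≲-resp (sym (ℕₚ.*-distribˡ-+ T (q ℕ.^ k) (q ℕ.^ k′))) (+-≲ (pow2x-≲ d k e) (pow2x-≲ d′ k′ e′))

      assemble : ∀ {x₁ y₁ x₂ y₂ x₃ y₃ x₄ y₄ z s} → z ≲ T ℕ.* T ℕ.* q ℕ.^ 24 →
        0ℚ ≤ℚ x₁ → x₁ ≲ T ℕ.* (q ℕ.^ 12 ℕ.+ q ℕ.^ 8) → y₁ ≲ T ℕ.* (q ℕ.^ 8 ℕ.+ q ℕ.^ 2 ℕ.+ 1) →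
        0ℚ ≤ℚ x₂ → x₂ ≲ T ℕ.* (q ℕ.^ 11 ℕ.+ q ℕ.^ 9) → y₂ ≲ T ℕ.* (q ℕ.^ 7 ℕ.+ 2 ℕ.* q) →
        0ℚ ≤ℚ x₃ → x₃ ≲ T ℕ.* (q ℕ.^ 10 ℕ.+ q ℕ.^ 9) → y₃ ≲ T ℕ.* (2 ℕ.* q ℕ.^ 6 ℕ.+ 2) →
        0ℚ ≤ℚ x₄ → x₄ ≲ T ℕ.* (q ℕ.^ 10 ℕ.+ q ℕ.^ 8) → y₄ ≲ T ℕ.* s →
        z + x₁ * y₁ + x₂ * y₂ + x₃ * y₃ + x₄ * y₄ ≲ T ℕ.* T ℕ.* U s
      assemble {s = s} hz p₁ a₁ b₁ p₂ a₂ b₂ p₃ a₃ b₃ p₄ a₄ b₄ = ≲-resp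
        (ring T (q ℕ.^ 24) (q ℕ.^ 12 ℕ.+ q ℕ.^ 8) (q ℕ.^ 8 ℕ.+ q ℕ.^ 2 ℕ.+ 1) (q ℕ.^ 11 ℕ.+ q ℕ.^ 9) (q ℕ.^ 7 ℕ.+ 2 ℕ.* q)
          (q ℕ.^ 10 ℕ.+ q ℕ.^ 9) (2 ℕ.* q ℕ.^ 6 ℕ.+ 2) (q ℕ.^ 10 ℕ.+ q ℕ.^ 8) s)
        (+-≲ (+-≲ (+-≲ (+-≲ hz (*-≲ p₁ a₁ b₁)) (*-≲ p₂ a₂ b₂)) (*-≲ p₃ a₃ b₃)) (*-≲ p₄ a₄ b₄))
        where ring : ∀ T z a₁ b₁ a₂ b₂ a₃ b₃ a₄ b₄ →
                T ℕ.* T ℕ.* z ℕ.+ T ℕ.* a₁ ℕ.* (T ℕ.* b₁) ℕ.+ T ℕ.* a₂ ℕ.* (T ℕ.* b₂) ℕ.+ T ℕ.* a₃ ℕ.* (T ℕ.* b₃) ℕ.+ T ℕ.* a₄ ℕ.* (T ℕ.* b₄)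
                ≡ T ℕ.* T ℕ.* (z ℕ.+ a₁ ℕ.* b₁ ℕ.+ a₂ ℕ.* b₂ ℕ.+ a₃ ℕ.* b₃ ℕ.+ a₄ ℕ.* b₄)
              ring = solve-∀

      ≤-slack : ∀ {a b} c → a ℕ.+ c ≡ b → a ≤ b
      ≤-slack {a} c refl = ℕₚ.m≤m+n a c

      -- `U` takes each bracket large enough for both parities; the slack is the room left for the
      -- odd formula.
      Meven-≲ : ∀ s → RangeBound s → Meven q (11 ℕ.+ t) ≲ T ℕ.* T ℕ.* U s
      Meven-≲ s range = assemble pow4x-≲
        (0≤P+P (+ 2 ℤ.* X ℤ.- + 10) (+ 2 ℤ.* X ℤ.- + 14)) (factor-≲ 10 14 12 8 refl refl)
        (≲-trans (+-≲ (pow2x-≲ 14 8 refl) (halfpow-≲ 8 3 9 2 t 2 refl refl 3+t≤ (r₁ t))) (≤-slack T (r₂ T (q ℕ.^ 8) (q ℕ.^ 2))))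
        (0≤P+P (+ 2 ℤ.* X ℤ.- + 11) (+ 2 ℤ.* X ℤ.- + 13)) (factor-≲ 11 13 11 9 refl refl)
        (≲-trans (+-≲ (halfpow-≲ 8 3 10 1 t 1 refl refl 3+t≤ (r₃ t)) (pow2x-≲ 15 7 refl)) (≤-slack (T ℕ.* q) (r₄ T q (q ℕ.^ 7))))
        (0≤P+P (+ 2 ℤ.* X ℤ.- + 12) (+ 2 ℤ.* X ℤ.- + 13)) (factor-≲ 12 13 10 9 refl refl)
        (≲-trans (+-≲ (*-≲ {a = 2} (0≤⟪⟫ 2) (mk≲ ℚₚ.≤-refl) (pow2x-≲ 16 6 refl)) (halfpow-≲ 10 1 11 0 t 0 refl refl 1+t≤ (r₅ t)))
          (≤-slack T (r₆ T (q ℕ.^ 6))))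
        (0≤P+P (+ 2 ℤ.* X ℤ.- + 12) (+ 2 ℤ.* X ℤ.- + 14)) (factor-≲ 12 14 10 8 refl refl)
        (range _ _ even₁-≲ even₂-≲)
        where
        1+t≤ : 1 ℕ.+ t ≤ 2 ℕ.* suc t
        1+t≤ = ℕₚ.m≤m+n (suc t) _
        3+t≤ : 3 ℕ.+ t ≤ 2 ℕ.* suc t
        3+t≤ = ℕₚ.≤-trans (ℕₚ.+-monoˡ-≤ (2 ℕ.+ t) 1≤t) (ℕₚ.≤-reflexive (r₀ t))
          where r₀ : ∀ t → t ℕ.+ (2 ℕ.+ t) ≡ 2 ℕ.* suc t
                r₀ = solve-∀
        r₁ : ∀ t → t ℕ.+ (2 ℕ.+ t) ≡ 2 ℕ.* t ℕ.+ 2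
        r₁ = solve-∀
        r₂ : ∀ T a b → T ℕ.* a ℕ.+ T ℕ.* b ℕ.+ T ≡ T ℕ.* (a ℕ.+ b ℕ.+ 1)
        r₂ = solve-∀
        r₃ : ∀ t → t ℕ.+ (1 ℕ.+ t) ≡ 2 ℕ.* t ℕ.+ 1
        r₃ = solve-∀
        r₄ : ∀ T a b → T ℕ.* (a ℕ.* 1) ℕ.+ T ℕ.* b ℕ.+ T ℕ.* a ≡ T ℕ.* (b ℕ.+ 2 ℕ.* a)
        r₄ = solve-∀
        r₅ : ∀ t → t ℕ.+ t ≡ 2 ℕ.* t ℕ.+ 0
        r₅ = solve-∀
        r₆ : ∀ T a → 2 ℕ.* (T ℕ.* a) ℕ.+ T ℕ.* 1 ℕ.+ T ≡ T ℕ.* (2 ℕ.* a ℕ.+ 2)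
        r₆ = solve-∀

      Modd-≲ : 2 ≤ t → ∀ s → RangeBound s → Modd q (11 ℕ.+ t) ≲ T ℕ.* T ℕ.* U s
      Modd-≲ 2≤t s range = assemble pow4x-≲
        (0≤P+P (+ 2 ℤ.* X ℤ.- + 10) (+ 2 ℤ.* X ℤ.- + 14)) (factor-≲ 10 14 12 8 refl refl)
        (≲-trans (+-≲ (+-≲ (pow2x-≲ 14 8 refl) (halfpow-≲ 9 2 8 3 d 2 refl refl 2+t≤ (shift 3 2 refl)))
            (below-T ((2 ℕ.+ t) ℕ./ 2) (ℕₚ.≤-trans (half≤ (2 ℕ.+ t)) 2+t≤2t)))
          (≤-slack 0 (r₂ T (q ℕ.^ 8) (q ℕ.^ 2))))
        (0≤P+P (+ 2 ℤ.* X ℤ.- + 11) (+ 2 ℤ.* X ℤ.- + 13)) (factor-≲ 11 13 11 9 refl refl)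
        (≲-trans (+-≲ (+-≲ (halfpow-≲ 9 2 9 2 d 1 refl refl 2+t≤ (shift 2 1 refl)) (pow2x-≲ 15 7 refl))
            (≲-trans (powx-≲ 8 3 refl) (ℕₚ.≤-trans (ℕₚ.^-monoʳ-≤ q 3+t≤2t+1) (ℕₚ.≤-reflexive (ℕₚ.^-distribˡ-+-* q (2 ℕ.* t) 1)))))
          (≤-slack 0 (r₄ T q (q ℕ.^ 7))))
        (0≤P+P (+ 2 ℤ.* X ℤ.- + 12) (+ 2 ℤ.* X ℤ.- + 13)) (factor-≲ 12 13 10 9 refl refl)
        (≲-trans (+-≲ (+-≲ (pow2x-≲ 16 6 refl) (halfpow-≲ 11 0 10 1 d 0 refl refl (ℕₚ.≤-trans (ℕₚ.m≤n+m t 2) 2+t≤) (shift 1 0 refl)))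
            (below-T (t ℕ./ 2) (ℕₚ.≤-trans (half≤ t) (widen 0 ℕₚ.≤-refl))))
          (≤-slack (T ℕ.* q ℕ.^ 6) (r₆ T (q ℕ.^ 6))))
        (0≤P+P (+ 2 ℤ.* X ℤ.- + 12) (+ 2 ℤ.* X ℤ.- + 14)) (factor-≲ 12 14 10 8 refl refl)
        (range _ _ odd₁-≲ (odd₂-≲ 2≤t))
        where
        d = ℕ.pred t
        1+d : suc d ≡ t
        1+d = ℕₚ.suc-pred t {{ℕ.>-nonZero 1≤t}}
        2+t≤2t : 2 ℕ.+ t ≤ 2 ℕ.* t
        2+t≤2t = ℕₚ.≤-trans (ℕₚ.+-monoˡ-≤ t 2≤t) (ℕₚ.≤-reflexive (cong (t ℕ.+_) (sym (ℕₚ.+-identityʳ t))))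
        2+t≤ : 2 ℕ.+ t ≤ 2 ℕ.* suc d
        2+t≤ = subst (λ z → 2 ℕ.+ t ≤ 2 ℕ.* z) (sym 1+d) 2+t≤2t
        3+t≤2t+1 : 3 ℕ.+ t ≤ 2 ℕ.* t ℕ.+ 1
        3+t≤2t+1 = ℕₚ.≤-trans (s≤s 2+t≤2t) (ℕₚ.≤-reflexive (ℕₚ.+-comm 1 (2 ℕ.* t)))
        shift : ∀ k e → k ≡ suc e → d ℕ.+ (k ℕ.+ t) ≡ 2 ℕ.* t ℕ.+ e
        shift k e refl = trans (r d e t) (trans (cong (λ z → z ℕ.+ t ℕ.+ e) 1+d) (r′ t e))
          where r : ∀ d e t → d ℕ.+ (suc e ℕ.+ t) ≡ suc d ℕ.+ t ℕ.+ e
                r = solve-∀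
                r′ : ∀ t e → t ℕ.+ t ℕ.+ e ≡ 2 ℕ.* t ℕ.+ e
                r′ = solve-∀
        half≤ : ∀ n → n ℕ./ 2 ≤ n
        half≤ n = DivMod.m/n≤m n 2
        below-T : ∀ e → e ≤ 2 ℕ.* t → P (+ e) ≲ T
        below-T e le = mk≲ (⟪⟫-mono (ℕₚ.^-monoʳ-≤ q le))
        r₂ : ∀ T a b → T ℕ.* a ℕ.+ T ℕ.* b ℕ.+ T ℕ.+ 0 ≡ T ℕ.* (a ℕ.+ b ℕ.+ 1)
        r₂ = solve-∀
        r₄ : ∀ T a b → T ℕ.* (a ℕ.* 1) ℕ.+ T ℕ.* b ℕ.+ T ℕ.* (a ℕ.* 1) ℕ.+ 0 ≡ T ℕ.* (b ℕ.+ 2 ℕ.* a)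
        r₄ = solve-∀
        r₆ : ∀ T a → T ℕ.* a ℕ.+ T ℕ.* 1 ℕ.+ T ℕ.+ T ℕ.* a ≡ T ℕ.* (2 ℕ.* a ℕ.+ 2)
        r₆ = solve-∀

    M-cases : ∀ x → M q x ≡ Meven q x ⊎ (x ℕ.% 2 ≢ 0 × M q x ≡ Modd q x)
    M-cases x with x ℕ.% 2
    ... | zero  = inj₁ refl
    ... | suc _ = inj₂ ((λ ()) , refl)

    module _ (t : ℕ) (1≤t : 1 ≤ t) where
      open At t 1≤t using (T)
      open AtLength t 1≤t

      odd⇒2≤t : (11 ℕ.+ t) ℕ.% 2 ≢ 0 → 2 ≤ t
      odd⇒2≤t ne with ℕₚ.m≤n⇒m<n∨m≡n 1≤t
      ... | inj₁ 2≤t  = 2≤t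
      ... | inj₂ refl = contradiction refl ne

      M-≲ : ∀ s → RangeBound s → M q (11 ℕ.+ t) ≲ T ℕ.* T ℕ.* U s
      M-≲ s range = [ (λ e → subst (_≲ T ℕ.* T ℕ.* U s) (sym e) (Meven-≲ s range))
                    , (λ (ne , e) → subst (_≲ T ℕ.* T ℕ.* U s) (sym e) (Modd-≲ (odd⇒2≤t ne) s range)) ]′ (M-cases (11 ℕ.+ t))

  -- The claim after division by q^(4t): 4 q⁴ pays for the terms with j ≥ 1, and 2 for q⁴ + q³ + q²
  -- + q + 1.
  record Sufficient (q : ℕ) (2≤q : 2 ≤ q) : Set where
    open Comparison q 2≤q
    field
      s          : ℕ
      range      : ∀ t (1≤t : 1 ≤ t) → AtLength.RangeBound t 1≤t s
      polynomial : U s ℕ.+ (4 ℕ.* q ℕ.^ 4 ℕ.+ 2) ≤ codeSize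

  -- The inequality for q = 2

  module Two where
    2≤2 : 2 ≤ 2
    2≤2 = ℕₚ.≤-refl
    open Comparison 2 2≤2
    open Bounds 2 2≤2

    -- The limits are at most 3 here, so at most the terms i = 3 and i = 2, 3 occur, and 143 = 50 +
    -- 34 · 2 + 25. The geometric estimate that serves for q ≥ 3 is too weak: at q = 2 it leaves 845
    -- to be compared with 2 · 2⁸ = 512.
    range : ∀ t (1≤t : 1 ≤ t) → AtLength.RangeBound t 1≤t 143
    range t 1≤t f₁ f₂ f₁≲ f₂≲ = ≲-trans (+-≲
        (sumRange-≲ f₁ g₁ g₁ 3 top₁ (λ i _ le → f₁≲ i (small₁ i le)) (λ _ _ _ → ℕₚ.≤-refl)
          (λ i 3≤i le → contradiction (ℕₚ.≤-trans (s≤s 3≤i) (ℕₚ.≤-trans le (ℕₚ.m⊓n≤m 3 ((6 ℕ.+ t) ℕ./ 2)))) (ℕₚ.<-irrefl refl)))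
        (sumRange-≲ f₂ g₂ h 2 top₂ (λ i _ le → f₂≲ i (small₂ i le)) g≤h
          (λ i 2≤i le → step i 2≤i (ℕₚ.≤-trans le (ℕₚ.m⊓n≤m 3 ((5 ℕ.+ t) ℕ./ 2))))))
      (ℕₚ.≤-reflexive total)
      where
      open At t 1≤t
      open AtLength t 1≤t
      h : ℕ → ℕ
      h 2 = g₂ 2 ℕ.+ g₂ 3
      h i = g₂ i
      g≤h : ∀ i → 2 ≤ i → i ≤ top₂ → g₂ i ≤ h i
      g≤h 1                   (s≤s ()) _
      g≤h 2                   _ _ = ℕₚ.m≤m+n (g₂ 2) (g₂ 3)
      g≤h (suc (suc (suc i))) _ _ = ℕₚ.≤-refl
      step : ∀ i → 2 ≤ i → suc i ≤ 3 → g₂ i ℕ.+ h (suc i) ≤ h i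
      step 1                   (s≤s ()) _
      step 2                   _ _                         = ℕₚ.≤-refl
      step (suc (suc (suc i))) _ (s≤s (s≤s (s≤s ())))
      E = 2 ℕ.* t ∸ 1
      T≡ : T ≡ 2 ℕ.* 2 ℕ.^ E
      T≡ = cong (2 ℕ.^_) (sym (ℕₚ.m+[n∸m]≡n {1} {2 ℕ.* t} (ℕₚ.≤-trans 1≤t (ℕₚ.m≤m+n t _))))
      total : 50 ℕ.* T ℕ.+ (34 ℕ.* (2 ℕ.* T) ℕ.+ 50 ℕ.* 2 ℕ.^ E) ≡ T ℕ.* 143
      total = trans (cong (λ z → 50 ℕ.* z ℕ.+ (34 ℕ.* (2 ℕ.* z) ℕ.+ 50 ℕ.* 2 ℕ.^ E)) T≡)
        (trans (ring (2 ℕ.^ E)) (cong (ℕ._* 143) (sym T≡)))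
        where ring : ∀ e → 50 ℕ.* (2 ℕ.* e) ℕ.+ (34 ℕ.* (2 ℕ.* (2 ℕ.* e)) ℕ.+ 50 ℕ.* e) ≡ 2 ℕ.* e ℕ.* 143
              ring = solve-∀

    sufficient : Sufficient 2 2≤2
    sufficient = record { s = 143 ; range = range ; polynomial = ℕₚ.≤ᵇ⇒≤ _ _ tt }

  -- The inequality for q ≥ 3

  module Large (q : ℕ) (3≤q : 3 ≤ q) where
    2≤q : 2 ≤ q
    2≤q = ℕₚ.≤-trans (ℕₚ.n≤1+n 2) 3≤q
    open Comparison q 2≤q
    open Bounds q 2≤q

    -- The majorant at the first indices, divided by T: i = 3 in the first sum, where the power is
    -- T, and i = 2 in the second, where it is q T.
    s₃ : ℕ
    s₃ = (6 ℕ.* q ℕ.^ 4 ℕ.+ 3) ℕ.+ (4 ℕ.* q ℕ.^ 4 ℕ.+ 3) ℕ.* q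

    -- ∑_{j ≥ i} (j q⁴ + 2) q^(c - 2 j) ≤ (2 i q⁴ + 3) q^(c - 2 i)
    telescope : ∀ i e → 1 ≤ i →
      (i ℕ.* q ℕ.^ 4 ℕ.+ 2) ℕ.* q ℕ.^ (2 ℕ.+ e) ℕ.+ (2 ℕ.* suc i ℕ.* q ℕ.^ 4 ℕ.+ 3) ℕ.* q ℕ.^ e ≤
      (2 ℕ.* i ℕ.* q ℕ.^ 4 ℕ.+ 3) ℕ.* q ℕ.^ (2 ℕ.+ e)
    telescope (suc j) e _ = begin
      (i ℕ.* Q ℕ.+ 2) ℕ.* (q ℕ.* (q ℕ.* z)) ℕ.+ (2 ℕ.* suc i ℕ.* Q ℕ.+ 3) ℕ.* z
        ≤⟨ ℕₚ.+-monoʳ-≤ ((i ℕ.* Q ℕ.+ 2) ℕ.* (q ℕ.* (q ℕ.* z))) (ℕₚ.*-monoˡ-≤ z coefficient) ⟩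
      (i ℕ.* Q ℕ.+ 2) ℕ.* (q ℕ.* (q ℕ.* z)) ℕ.+ (i ℕ.* Q ℕ.+ 1) ℕ.* (q ℕ.* q) ℕ.* z
        ≡⟨ ring₂ i Q q z ⟩
      (2 ℕ.* i ℕ.* Q ℕ.+ 3) ℕ.* (q ℕ.* (q ℕ.* z)) ∎
      where
      open ℕₚ.≤-Reasoning
      i = suc j
      Q = q ℕ.^ 4
      z = q ℕ.^ e
      ring₁ : ∀ j Q → 2 ℕ.* suc (suc j) ℕ.* Q ℕ.+ 3 ℕ.+ (2 ℕ.* j ℕ.* Q ℕ.+ 1) ≡ (suc j ℕ.* Q ℕ.+ 1) ℕ.* (2 ℕ.* 2)
      ring₁ = solve-∀
      ring₂ : ∀ i Q q z → (i ℕ.* Q ℕ.+ 2) ℕ.* (q ℕ.* (q ℕ.* z)) ℕ.+ (i ℕ.* Q ℕ.+ 1) ℕ.* (q ℕ.* q) ℕ.* z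
        ≡ (2 ℕ.* i ℕ.* Q ℕ.+ 3) ℕ.* (q ℕ.* (q ℕ.* z))
      ring₂ = solve-∀
      -- 4 (i Q + 1) exceeds 2 (i + 1) Q + 3 by 2 (i - 1) Q + 1, and q² ≥ 4.
      coefficient : 2 ℕ.* suc i ℕ.* Q ℕ.+ 3 ≤ (i ℕ.* Q ℕ.+ 1) ℕ.* (q ℕ.* q)
      coefficient = ℕₚ.≤-trans (ℕₚ.m≤m+n _ (2 ℕ.* j ℕ.* Q ℕ.+ 1)) (ℕₚ.≤-trans (ℕₚ.≤-reflexive (ring₁ j Q))
        (ℕₚ.*-monoʳ-≤ (i ℕ.* Q ℕ.+ 1) (ℕₚ.*-mono-≤ 2≤q 2≤q)))

    drop-2 : ∀ c i → 2 ℕ.* suc i ≤ c → c ∸ 2 ℕ.* i ≡ 2 ℕ.+ (c ∸ 2 ℕ.* suc i)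
    drop-2 c i le = ℕₚ.+-cancelʳ-≡ (2 ℕ.* i) _ _ (trans (ℕₚ.m∸n+n≡m (ℕₚ.≤-trans (ℕₚ.*-monoʳ-≤ 2 (ℕₚ.n≤1+n i)) le))
      (sym (trans (ring (c ∸ 2 ℕ.* suc i) i) (ℕₚ.m∸n+n≡m le))))
      where ring : ∀ e i → 2 ℕ.+ e ℕ.+ 2 ℕ.* i ≡ e ℕ.+ 2 ℕ.* suc i
            ring = solve-∀

    majorant : ℕ → ℕ → ℕ
    majorant c i = (2 ℕ.* i ℕ.* q ℕ.^ 4 ℕ.+ 3) ℕ.* q ℕ.^ (c ∸ 2 ℕ.* i)

    majorant-step : ∀ c i → 1 ≤ i → 2 ℕ.* suc i ≤ c →
      (i ℕ.* q ℕ.^ 4 ℕ.+ 2) ℕ.* q ℕ.^ (c ∸ 2 ℕ.* i) ℕ.+ majorant c (suc i) ≤ majorant c i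
    majorant-step c i 1≤i le = subst (λ e → (i ℕ.* q ℕ.^ 4 ℕ.+ 2) ℕ.* q ℕ.^ e ℕ.+ majorant c (suc i) ≤ (2 ℕ.* i ℕ.* q ℕ.^ 4 ℕ.+ 3) ℕ.* q ℕ.^ e)
      (sym (drop-2 c i le)) (telescope i (c ∸ 2 ℕ.* suc i) 1≤i)

    below-majorant : ∀ c i → (i ℕ.* q ℕ.^ 4 ℕ.+ 2) ℕ.* q ℕ.^ (c ∸ 2 ℕ.* i) ≤ majorant c i
    below-majorant c i = ℕₚ.*-monoˡ-≤ (q ℕ.^ (c ∸ 2 ℕ.* i))
      (ℕₚ.+-mono-≤ (ℕₚ.*-monoˡ-≤ (q ℕ.^ 4) (ℕₚ.m≤m+n i (i ℕ.+ 0))) (ℕₚ.n≤1+n 2))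

    range : ∀ t (1≤t : 1 ≤ t) → AtLength.RangeBound t 1≤t s₃
    range t 1≤t f₁ f₂ f₁≲ f₂≲ = ≲-trans (+-≲
        (sumRange-≲ f₁ g₁ (majorant (6 ℕ.+ 2 ℕ.* t)) 3 top₁ (λ i _ le → f₁≲ i (small₁ i le))
          (λ i _ _ → below-majorant (6 ℕ.+ 2 ℕ.* t) i)
          (λ i 3≤i le → majorant-step (6 ℕ.+ 2 ℕ.* t) i (ℕₚ.≤-trans (s≤s z≤n) 3≤i) (widen 6 (small₁ (suc i) le))))
        (sumRange-≲ f₂ g₂ (majorant (5 ℕ.+ 2 ℕ.* t)) 2 top₂ (λ i _ le → f₂≲ i (small₂ i le))
          (λ i _ _ → below-majorant (5 ℕ.+ 2 ℕ.* t) i)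
          (λ i 2≤i le → majorant-step (5 ℕ.+ 2 ℕ.* t) i (ℕₚ.≤-trans (s≤s z≤n) 2≤i) (widen 5 (small₂ (suc i) le)))))
      (ℕₚ.≤-reflexive (ring (q ℕ.^ 4) q T))
      where
      open At t 1≤t
      open AtLength t 1≤t
      ring : ∀ Q q T → (6 ℕ.* Q ℕ.+ 3) ℕ.* T ℕ.+ (4 ℕ.* Q ℕ.+ 3) ℕ.* (q ℕ.* T) ≡ T ℕ.* (6 ℕ.* Q ℕ.+ 3 ℕ.+ (4 ℕ.* Q ℕ.+ 3) ℕ.* q)
      ring = solve-∀

    -- `common` is what `U s₃` shares with `codeSize`. Beyond it stand q⁸ `excess`, with `excess` of
    -- degree 7, on one side and 2 q¹⁶ on the other.
    common excess : ℕ
    common = q ℕ.^ 24 ℕ.+ q ℕ.^ 20 ℕ.+ q ℕ.^ 18 ℕ.+ 4 ℕ.* q ℕ.^ 16 ℕ.+ 3 ℕ.* q ℕ.^ 15 ℕ.+ 3 ℕ.* q ℕ.^ 14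
      ℕ.+ 2 ℕ.* q ℕ.^ 13 ℕ.+ 4 ℕ.* q ℕ.^ 12 ℕ.+ q ℕ.^ 11 ℕ.+ q ℕ.^ 8
    excess = 3 ℕ.* q ℕ.^ 7 ℕ.+ 4 ℕ.* q ℕ.^ 6 ℕ.+ 2 ℕ.* q ℕ.^ 5 ℕ.+ 5 ℕ.* q ℕ.^ 4 ℕ.+ 2 ℕ.* q ℕ.^ 3 ℕ.+ 8 ℕ.* q ℕ.^ 2 ℕ.+ 5 ℕ.* q ℕ.+ 3

    open NatSolver.+-*-Solver

    U-expanded : U s₃ ≡ common ℕ.+ q ℕ.^ 8 ℕ.* excess
    U-expanded = solve 1 (λ q → q :^ 24 :+ (q :^ 12 :+ q :^ 8) :* (q :^ 8 :+ q :^ 2 :+ con 1)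
        :+ (q :^ 11 :+ q :^ 9) :* (q :^ 7 :+ con 2 :* q)
        :+ (q :^ 10 :+ q :^ 9) :* (con 2 :* q :^ 6 :+ con 2)
        :+ (q :^ 10 :+ q :^ 8) :* ((con 6 :* q :^ 4 :+ con 3) :+ (con 4 :* q :^ 4 :+ con 3) :* q)
      := (q :^ 24 :+ q :^ 20 :+ q :^ 18 :+ con 4 :* q :^ 16 :+ con 3 :* q :^ 15 :+ con 3 :* q :^ 14
        :+ con 2 :* q :^ 13 :+ con 4 :* q :^ 12 :+ q :^ 11 :+ q :^ 8)
        :+ q :^ 8 :* (con 3 :* q :^ 7 :+ con 4 :* q :^ 6 :+ con 2 :* q :^ 5 :+ con 5 :* q :^ 4 :+ con 2 :* q :^ 3 :+ con 8 :* q :^ 2 :+ con 5 :* q :+ con 3))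
      refl q

    codeSize-expanded : codeSize ≡ common ℕ.+ q ℕ.^ 8 ℕ.* (2 ℕ.* q ℕ.^ 8)
    codeSize-expanded = solve 1 (λ q → q :^ 24 :+ (q :^ 20 :+ (q :^ 16 :+ (q :^ 12 :+ (q :^ 16 :+ (q :^ 12 :+ (q :^ 8
        :+ (q :^ 18 :+ (q :^ 16 :+ (q :^ 16 :+ (q :^ 14 :+ (q :^ 16 :+ (q :^ 16 :+ (q :^ 15 :+ (q :^ 15
        :+ (q :^ 15 :+ (q :^ 13 :+ (q :^ 13 :+ (q :^ 11 :+ (q :^ 14 :+ (q :^ 14 :+ (q :^ 12 :+ (q :^ 12 :+ con 0))))))))))))))))))))))
      := (q :^ 24 :+ q :^ 20 :+ q :^ 18 :+ con 4 :* q :^ 16 :+ con 3 :* q :^ 15 :+ con 3 :* q :^ 14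
        :+ con 2 :* q :^ 13 :+ con 4 :* q :^ 12 :+ q :^ 11 :+ q :^ 8) :+ q :^ 8 :* (con 2 :* q :^ 8))
      refl q

    excess-≤ : suc excess ≤ 2 ℕ.* q ℕ.^ 8
    excess-≤ with ℕₚ.m≤n⇒∃[o]m+o≡n 3≤q
    -- The coefficients are those of 2 q⁸ - `excess` - 1 expanded at q = 3 + r; none is negative.
    ... | r , refl = ℕₚ.≤-trans (ℕₚ.m≤m+n (suc excess) (2609 ℕ.+ 12394 ℕ.* r ℕ.^ 1 ℕ.+ 19819 ℕ.* r ℕ.^ 2 ℕ.+ 16309 ℕ.* r ℕ.^ 3 ℕ.+ 7930 ℕ.* r ℕ.^ 4 ℕ.+ 2383 ℕ.* r ℕ.^ 5 ℕ.+ 437 ℕ.* r ℕ.^ 6 ℕ.+ 45 ℕ.* r ℕ.^ 7 ℕ.+ 2 ℕ.* r ℕ.^ 8)) (ℕₚ.≤-reflexive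
      (solve 1 (λ r → let q = con 3 :+ r in
        con 1 :+ (con 3 :* q :^ 7 :+ con 4 :* q :^ 6 :+ con 2 :* q :^ 5 :+ con 5 :* q :^ 4 :+ con 2 :* q :^ 3 :+ con 8 :* q :^ 2 :+ con 5 :* q :+ con 3)
        :+ (con 2609 :+ con 12394 :* r :^ 1 :+ con 19819 :* r :^ 2 :+ con 16309 :* r :^ 3 :+ con 7930 :* r :^ 4 :+ con 2383 :* r :^ 5 :+ con 437 :* r :^ 6 :+ con 45 :* r :^ 7 :+ con 2 :* r :^ 8)
        := con 2 :* q :^ 8) refl r))

    remainder-≤ : 4 ℕ.* q ℕ.^ 4 ℕ.+ 2 ≤ q ℕ.^ 8
    remainder-≤ = begin
      4 ℕ.* q ℕ.^ 4 ℕ.+ 2                ≤⟨ ℕₚ.+-monoʳ-≤ (4 ℕ.* q ℕ.^ 4) (ℕₚ.≤-trans (s≤s (s≤s z≤n)) (1+n≤q^n 4)) ⟩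
      4 ℕ.* q ℕ.^ 4 ℕ.+ q ℕ.^ 4          ≡⟨ ℕₚ.+-comm (4 ℕ.* q ℕ.^ 4) (q ℕ.^ 4) ⟩
      5 ℕ.* q ℕ.^ 4                      ≤⟨ ℕₚ.*-monoˡ-≤ (q ℕ.^ 4) (1+n≤q^n 4) ⟩
      q ℕ.^ 4 ℕ.* q ℕ.^ 4                ≡⟨ sym (ℕₚ.^-distribˡ-+-* q 4 4) ⟩
      q ℕ.^ 8                            ∎
      where open ℕₚ.≤-Reasoning

    polynomial : U s₃ ℕ.+ (4 ℕ.* q ℕ.^ 4 ℕ.+ 2) ≤ codeSize
    polynomial = begin
      U s₃ ℕ.+ (4 ℕ.* q ℕ.^ 4 ℕ.+ 2)                  ≤⟨ ℕₚ.+-mono-≤ (ℕₚ.≤-reflexive U-expanded) remainder-≤ ⟩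
      common ℕ.+ q ℕ.^ 8 ℕ.* excess ℕ.+ q ℕ.^ 8       ≡⟨ ring common (q ℕ.^ 8) excess ⟩
      common ℕ.+ q ℕ.^ 8 ℕ.* suc excess               ≤⟨ ℕₚ.+-monoʳ-≤ common (ℕₚ.*-monoʳ-≤ (q ℕ.^ 8) excess-≤) ⟩
      common ℕ.+ q ℕ.^ 8 ℕ.* (2 ℕ.* q ℕ.^ 8)          ≡⟨ sym codeSize-expanded ⟩
      codeSize                                        ∎
      where
      open ℕₚ.≤-Reasoning
      ring : ∀ c y e → c ℕ.+ y ℕ.* e ℕ.+ y ≡ c ℕ.+ y ℕ.* suc e
      ring = solve-∀

    sufficient : Sufficient q 2≤q
    sufficient = record { s = s₃ ; range = range ; polynomial = polynomial }

  sufficient : ∀ q (2≤q : 2 ≤ q) → Sufficient q 2≤q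
  sufficient q 2≤q with ℕₚ.m≤n⇒m<n∨m≡n 2≤q
  ... | inj₁ 3≤q  = subst (Sufficient q) (ℕₚ.≤-irrelevant _ 2≤q) (Large.sufficient q 3≤q)
  ... | inj₂ refl = subst (Sufficient 2) (ℕₚ.≤-irrelevant _ 2≤q) Two.sufficient

  sum-powers-shift : ∀ q t es → sum (List.map (λ e → q ℕ.^ (4 ℕ.* t ℕ.+ e)) es) ≡ q ℕ.^ (4 ℕ.* t) ℕ.* sum (List.map (q ℕ.^_) es)
  sum-powers-shift q t []       = sym (ℕₚ.*-zeroʳ (q ℕ.^ (4 ℕ.* t)))
  sum-powers-shift q t (e ∷ es) = trans
    (cong₂ ℕ._+_ (ℕₚ.^-distribˡ-+-* q (4 ℕ.* t) e) (sum-powers-shift q t es))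
    (sym (ℕₚ.*-distribˡ-+ (q ℕ.^ (4 ℕ.* t)) (q ℕ.^ e) _))

  -- Summation over the lengths n - 5 j

  module Total (q : ℕ) (2≤q : 2 ≤ q) where
    open Comparison q 2≤q
    open Bounds q 2≤q
    open Sufficient (sufficient q 2≤q)

    sum-powers-≤ : ∀ b es → All (_≤ b) es → sum (List.map (q ℕ.^_) es) ≤ length es ℕ.* q ℕ.^ b
    sum-powers-≤ b []       []       = z≤n
    sum-powers-≤ b (e ∷ es) (p ∷ ps) = ℕₚ.+-mono-≤ (ℕₚ.^-monoʳ-≤ q p) (sum-powers-≤ b es ps)

    -- A crude bound for the terms with j ≥ 1: by `polynomial`, U s is at most `codeSize`, in which
    -- the 22 further pivot sets count at most q²⁰ each, and 22 ≤ 2 q⁴.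
    U≤3q²⁴ : U s ≤ 3 ℕ.* q ℕ.^ 24
    U≤3q²⁴ = begin
      U s                                    ≤⟨ ℕₚ.m≤m+n (U s) (4 ℕ.* q ℕ.^ 4 ℕ.+ 2) ⟩
      U s ℕ.+ (4 ℕ.* q ℕ.^ 4 ℕ.+ 2)          ≤⟨ polynomial ⟩
      codeSize
        ≤⟨ ℕₚ.+-monoʳ-≤ (q ℕ.^ 24) (sum-powers-≤ 20 (List.map freedom pivots) (from-yes (All.all? (ℕ._≤? 20) (List.map freedom pivots)))) ⟩
      q ℕ.^ 24 ℕ.+ 22 ℕ.* q ℕ.^ 20           ≤⟨ ℕₚ.+-monoʳ-≤ (q ℕ.^ 24) (ℕₚ.*-monoˡ-≤ (q ℕ.^ 20) 22≤) ⟩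
      q ℕ.^ 24 ℕ.+ 2 ℕ.* q ℕ.^ 4 ℕ.* q ℕ.^ 20
        ≡⟨ cong (q ℕ.^ 24 ℕ.+_) (trans (ℕₚ.*-assoc 2 (q ℕ.^ 4) (q ℕ.^ 20)) (cong (2 ℕ.*_) (sym (ℕₚ.^-distribˡ-+-* q 4 20)))) ⟩
      3 ℕ.* q ℕ.^ 24                         ∎
      where
      open ℕₚ.≤-Reasoning
      22≤ : 22 ≤ 2 ℕ.* q ℕ.^ 4
      22≤ = ℕₚ.≤-trans (ℕₚ.m≤m+n 22 10) (ℕₚ.*-monoʳ-≤ 2 (ℕₚ.^-monoˡ-≤ 4 2≤q))

    T²≡ : ∀ t → q ℕ.^ (2 ℕ.* t) ℕ.* q ℕ.^ (2 ℕ.* t) ≡ q ℕ.^ (4 ℕ.* t)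
    T²≡ t = trans (sym (ℕₚ.^-distribˡ-+-* q (2 ℕ.* t) (2 ℕ.* t))) (cong (q ℕ.^_) (ring t))
      where ring : ∀ t → 2 ℕ.* t ℕ.+ 2 ℕ.* t ≡ 4 ℕ.* t
            ring = solve-∀

    M-bound : ∀ t → 1 ≤ t → M q (11 ℕ.+ t) ≲ q ℕ.^ (4 ℕ.* t) ℕ.* U s
    M-bound t 1≤t = ≲-resp (cong (ℕ._* U s) (T²≡ t)) (M-≲ t 1≤t s (range t 1≤t))

    module _ (t : ℕ) where
      term : ℕ → ℚ
      term j = M q (11 ℕ.+ t ∸ 5 ℕ.* j)

      tail-power : ℕ → ℕ
      tail-power j = q ℕ.^ (24 ℕ.+ 4 ℕ.* (t ∸ 5 ℕ.* j))

      term-≲ : ∀ j → 5 ℕ.* j < t → term j ≲ 3 ℕ.* tail-power j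
      term-≲ j 5j<t = subst (_≲ 3 ℕ.* tail-power j) (cong (M q) (sym (ℕₚ.+-∸-assoc 11 (ℕₚ.<⇒≤ 5j<t))))
        (≲-trans (M-bound t′ (ℕₚ.m<n⇒0<n∸m 5j<t)) (begin
          q ℕ.^ (4 ℕ.* t′) ℕ.* U s                  ≤⟨ ℕₚ.*-monoʳ-≤ (q ℕ.^ (4 ℕ.* t′)) U≤3q²⁴ ⟩
          q ℕ.^ (4 ℕ.* t′) ℕ.* (3 ℕ.* q ℕ.^ 24)     ≡⟨ ring (q ℕ.^ (4 ℕ.* t′)) (q ℕ.^ 24) ⟩
          3 ℕ.* (q ℕ.^ 24 ℕ.* q ℕ.^ (4 ℕ.* t′))     ≡⟨ cong (3 ℕ.*_) (sym (ℕₚ.^-distribˡ-+-* q 24 (4 ℕ.* t′))) ⟩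
          3 ℕ.* tail-power j                        ∎))
        where
        open ℕₚ.≤-Reasoning
        t′ = t ∸ 5 ℕ.* j
        ring : ∀ a b → a ℕ.* (3 ℕ.* b) ≡ 3 ℕ.* (b ℕ.* a)
        ring = solve-∀

      -- One step in j lowers the exponent by 20, and q² ≥ 4 already absorbs the factor 4.
      tail-step : ∀ j → 5 ℕ.* suc j < t → 3 ℕ.* tail-power j ℕ.+ 4 ℕ.* tail-power (suc j) ≤ 4 ℕ.* tail-power j
      tail-step j lt = begin
        3 ℕ.* tail-power j ℕ.+ 4 ℕ.* tail-power (suc j)   ≤⟨ ℕₚ.+-monoʳ-≤ (3 ℕ.* tail-power j) 4*≤ ⟩
        3 ℕ.* tail-power j ℕ.+ tail-power j               ≡⟨ ℕₚ.+-comm (3 ℕ.* tail-power j) (tail-power j) ⟩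
        4 ℕ.* tail-power j                                ∎
        where
        open ℕₚ.≤-Reasoning
        e′ = 24 ℕ.+ 4 ℕ.* (t ∸ 5 ℕ.* suc j)
        drop : t ∸ 5 ℕ.* j ≡ 5 ℕ.+ (t ∸ 5 ℕ.* suc j)
        drop = ℕₚ.+-cancelʳ-≡ (5 ℕ.* j) _ _ (trans (ℕₚ.m∸n+n≡m (ℕₚ.≤-trans (ℕₚ.*-monoʳ-≤ 5 (ℕₚ.n≤1+n j)) (ℕₚ.<⇒≤ lt)))
          (sym (trans (ring (t ∸ 5 ℕ.* suc j) j) (ℕₚ.m∸n+n≡m (ℕₚ.<⇒≤ lt)))))
          where ring : ∀ e j → 5 ℕ.+ e ℕ.+ 5 ℕ.* j ≡ e ℕ.+ 5 ℕ.* suc j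
                ring = solve-∀
        exponent : 2 ℕ.+ e′ ≤ 24 ℕ.+ 4 ℕ.* (t ∸ 5 ℕ.* j)
        exponent = ℕₚ.≤-trans (ℕₚ.m≤m+n (2 ℕ.+ e′) 18) (ℕₚ.≤-reflexive (trans (ring (t ∸ 5 ℕ.* suc j)) (cong (λ z → 24 ℕ.+ 4 ℕ.* z) (sym drop))))
          where ring : ∀ e → 2 ℕ.+ (24 ℕ.+ 4 ℕ.* e) ℕ.+ 18 ≡ 24 ℕ.+ 4 ℕ.* (5 ℕ.+ e)
                ring = solve-∀
        4*≤ : 4 ℕ.* tail-power (suc j) ≤ tail-power j
        4*≤ = ℕₚ.≤-trans (ℕₚ.*-monoˡ-≤ (tail-power (suc j)) (ℕₚ.^-monoˡ-≤ 2 2≤q))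
          (ℕₚ.≤-trans (ℕₚ.≤-reflexive (sym (ℕₚ.^-distribˡ-+-* q 2 e′))) (ℕₚ.^-monoʳ-≤ q exponent))

      tail-≲ : ∀ J → 5 ℕ.* J < t → sumFrom term J 1 ≲ 4 ℕ.* q ℕ.^ (4 ℕ.+ 4 ℕ.* t)
      tail-≲ zero    lt = mk≲ (0≤⟪⟫ (4 ℕ.* q ℕ.^ (4 ℕ.+ 4 ℕ.* t)))
      tail-≲ (suc J) lt = ≲-resp (cong (λ e → 4 ℕ.* q ℕ.^ e) exponent)
        (sumFrom-≲ term (λ j → 3 ℕ.* tail-power j) (λ j → 4 ℕ.* tail-power j) 1 (suc J)
          (λ j _ j≤ → term-≲ j (in-range j≤)) (λ j _ _ → ℕₚ.*-monoˡ-≤ (tail-power j) (ℕₚ.n≤1+n 3))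
          (λ j _ j<  → tail-step j (in-range j<)) (suc J) 1 ℕₚ.≤-refl ℕₚ.≤-refl)
        where
        in-range : ∀ {j} → j ≤ suc J → 5 ℕ.* j < t
        in-range j≤ = ℕₚ.≤-<-trans (ℕₚ.*-monoʳ-≤ 5 j≤) lt
        -- The origin of the 4 q⁴ in `Sufficient`: at j = 1 the exponent 24 has lost 20.
        exponent : 24 ℕ.+ 4 ℕ.* (t ∸ 5) ≡ 4 ℕ.+ 4 ℕ.* t
        exponent = trans (ring (t ∸ 5)) (cong (λ z → 4 ℕ.+ 4 ℕ.* z) (ℕₚ.m+[n∸m]≡n (ℕₚ.<⇒≤ (in-range {1} (s≤s z≤n)))))
          where ring : ∀ e → 24 ℕ.+ 4 ℕ.* e ≡ 4 ℕ.+ 4 ℕ.* (5 ℕ.+ e)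
                ring = solve-∀

      small-powers : 1 ≤ t → q ℕ.^ 4 ℕ.+ q ℕ.^ 3 ℕ.+ q ℕ.^ 2 ℕ.+ q ℕ.+ 1 ≤ 2 ℕ.* q ℕ.^ (4 ℕ.* t)
      small-powers 1≤t = begin
        q ℕ.^ 4 ℕ.+ q ℕ.^ 3 ℕ.+ q ℕ.^ 2 ℕ.+ q ℕ.+ 1       ≡⟨ ring₁ (q ℕ.^ 4) (q ℕ.^ 3) (q ℕ.^ 2) q ⟩
        q ℕ.^ 4 ℕ.+ (q ℕ.^ 3 ℕ.+ (q ℕ.^ 2 ℕ.+ suc q))     ≤⟨ ℕₚ.+-monoʳ-≤ (q ℕ.^ 4) (ℕₚ.+-monoʳ-≤ (q ℕ.^ 3) (ℕₚ.+-monoʳ-≤ (q ℕ.^ 2) 1+q≤q²)) ⟩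
        q ℕ.^ 4 ℕ.+ (q ℕ.^ 3 ℕ.+ (q ℕ.^ 2 ℕ.+ q ℕ.^ 2))   ≤⟨ ℕₚ.+-monoʳ-≤ (q ℕ.^ 4) (ℕₚ.+-monoʳ-≤ (q ℕ.^ 3) (twice 2)) ⟩
        q ℕ.^ 4 ℕ.+ (q ℕ.^ 3 ℕ.+ q ℕ.^ 3)                 ≤⟨ ℕₚ.+-monoʳ-≤ (q ℕ.^ 4) (twice 3) ⟩
        q ℕ.^ 4 ℕ.+ q ℕ.^ 4                               ≡⟨ cong (q ℕ.^ 4 ℕ.+_) (sym (ℕₚ.+-identityʳ (q ℕ.^ 4))) ⟩
        2 ℕ.* q ℕ.^ 4                                     ≤⟨ ℕₚ.*-monoʳ-≤ 2 (ℕₚ.^-monoʳ-≤ q (ℕₚ.*-monoʳ-≤ 4 1≤t)) ⟩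
        2 ℕ.* q ℕ.^ (4 ℕ.* t)                             ∎
        where
        open ℕₚ.≤-Reasoning
        ring₁ : ∀ a b c d → a ℕ.+ b ℕ.+ c ℕ.+ d ℕ.+ 1 ≡ a ℕ.+ (b ℕ.+ (c ℕ.+ suc d))
        ring₁ = solve-∀
        twice : ∀ k → q ℕ.^ k ℕ.+ q ℕ.^ k ≤ q ℕ.^ suc k
        twice k = ℕₚ.≤-trans (ℕₚ.≤-reflexive (cong (q ℕ.^ k ℕ.+_) (sym (ℕₚ.+-identityʳ (q ℕ.^ k))))) (ℕₚ.*-monoˡ-≤ (q ℕ.^ k) 2≤q)
        1+q≤q² : suc q ≤ q ℕ.^ 2
        1+q≤q² = ℕₚ.≤-trans (ℕₚ.+-monoˡ-≤ q 1≤q) (subst (λ z → z ℕ.+ z ≤ q ℕ.^ 2) (ℕₚ.*-identityʳ q) (twice 1))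

      bound-≲ : 1 ≤ t → bound q (11 ℕ.+ t) ≲ q ℕ.^ (4 ℕ.* t) ℕ.* codeSize
      bound-≲ 1≤t = ≲-trans
        (+-≲ (subst (_≲ B ℕ.* U s ℕ.+ 4 ℕ.* q ℕ.^ (4 ℕ.+ 4 ℕ.* t)) (sym (sumRange≡sumFrom 0 J term)) (+-≲ (M-bound t 1≤t) (tail-≲ J 5J<t)))
             (mk≲ (⟪⟫-mono (small-powers 1≤t))))
        (begin
          B ℕ.* U s ℕ.+ 4 ℕ.* q ℕ.^ (4 ℕ.+ 4 ℕ.* t) ℕ.+ 2 ℕ.* B   ≡⟨ cong (λ z → B ℕ.* U s ℕ.+ 4 ℕ.* z ℕ.+ 2 ℕ.* B) (ℕₚ.^-distribˡ-+-* q 4 (4 ℕ.* t)) ⟩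
          B ℕ.* U s ℕ.+ 4 ℕ.* (q ℕ.^ 4 ℕ.* B) ℕ.+ 2 ℕ.* B         ≡⟨ ring B (U s) (q ℕ.^ 4) ⟩
          B ℕ.* (U s ℕ.+ (4 ℕ.* q ℕ.^ 4 ℕ.+ 2))                   ≤⟨ ℕₚ.*-monoʳ-≤ B polynomial ⟩
          B ℕ.* codeSize                                          ∎)
        where
        open ℕₚ.≤-Reasoning
        B = q ℕ.^ (4 ℕ.* t)
        J = (11 ℕ.+ t ∸ 12) ℕ./ 5
        -- J is (t - 1) / 5 rounded down, so every length n - 5 j in the sum is still at least 12.
        5J<t : 5 ℕ.* J < t
        5J<t = ℕₚ.≤-<-trans (ℕₚ.≤-trans (ℕₚ.≤-reflexive (ℕₚ.*-comm 5 J)) (DivMod.m/n*n≤m (t ∸ 1) 5)) (ℕₚ.∸-monoʳ-< (s≤s z≤n) 1≤t)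
        ring : ∀ B u Q → B ℕ.* u ℕ.+ 4 ℕ.* (Q ℕ.* B) ℕ.+ 2 ℕ.* B ≡ B ℕ.* (u ℕ.+ (4 ℕ.* Q ℕ.+ 2))
        ring = solve-∀

  codeword-count : (q t : ℕ) → ℕ
  codeword-count q t = q ℕ.^ ((6 ℕ.+ t) ℕ.* 4) ℕ.+ sum (List.map (λ e → q ℕ.^ (4 ℕ.* t ℕ.+ e)) (List.map freedom pivots))

  bound≤cardinality : ∀ q (2≤q : 2 ≤ q) t → 1 ≤ t → bound q (11 ℕ.+ t) ≤ℚ ⟪ codeword-count q t ⟫
  bound≤cardinality q 2≤q t 1≤t = _≲_.un≲ (≲-resp count≡ (Total.bound-≲ q 2≤q t 1≤t))
    where
    count≡ : q ℕ.^ (4 ℕ.* t) ℕ.* Comparison.codeSize q 2≤q ≡ codeword-count q t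
    count≡ = trans (ℕₚ.*-distribˡ-+ (q ℕ.^ (4 ℕ.* t)) (q ℕ.^ 24) _) (cong₂ ℕ._+_
      (trans (sym (ℕₚ.^-distribˡ-+-* q (4 ℕ.* t) 24)) (cong (q ℕ.^_) (ring t)))
      (sym (sum-powers-shift q t (List.map freedom pivots))))
      where ring : ∀ t → 4 ℕ.* t ℕ.+ 24 ≡ (6 ℕ.+ t) ℕ.* 4
            ring = solve-∀

theorem3p16 : ∀ {c ℓ} (q : ℕ) (F : Field c ℓ) → HasSize F q →
    (n : ℕ) → 12 ≤ n →
    LinAlg.AbarAtLeast F 5 (n ∸ 5) 4 2 (bound q n)
theorem3p16 q F size n 12≤n = ≡.subst (λ n → LinAlg.AbarAtLeast F 5 (n ∸ 5) 4 2 (bound q n)) (ℕₚ.m+[n∸m]≡n 12≤n)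
  (construction t (s≤s z≤n) pivots-valid pivots-separated (bound q (11 ℕ.+ t)) (bound≤cardinality q 2≤q t (s≤s z≤n)))
  where
  open FiniteField q F size
  open PivotFrames using (pivots-valid; pivots-separated)
  open RationalEstimates
  -- With this t, 11 + t reduces to 12 + (n - 12), which `m+[n∸m]≡n` turns back into n.
  t = suc (n ∸ 12)
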